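{- For every even integer $m\ge 6$, the Route E direction assignment defined below is a coloring of $D_3(m)$ (each $f_c$ is a permutation of $V$), and each of $f_0,f_1,f_2$ is a single directed cycle through all $m^3$ vertices; hence the three color classes decompose the arcs of $D_3(m)$ into three directed Hamilton cycles.
   Context: $V=(\mathbb Z_m)^3$ with points $v=(i,j,k)$; $D_3(m)$ is the digraph on $V$ with arcs $v\to v+(1,0,0)$, $v\to v+(0,1,0)$, $v\to v+(0,0,1)$ (mod $m$); "direction $0,1,2$" means adding $(1,0,0),(0,1,0),(0,0,1)$ respectively. $S(v)=i+j+k\pmod m$. The Route E direction assignment gives each vertex a triple $(d_0(v),d_1(v),d_2(v))$, a permutation of $(0,1,2)$, and $f_c(v)=v+(\text{direction }d_c(v))$. Rules (coordinates mod $m$, integer ranges refer to representatives in $\{0,\dots,m-1\}$): if $S\notin\{0,1,2\}$, triple $(0,1,2)$. If $S=1$: $(1,0,2)$ if $i=0$, $(2,0,1)$ if $i\ne0$. If $S=2$: $(2,1,0)$ if $j=0$, $(0,1,2)$ if $j\ne0$. If $S=0$ and $m\equiv0,2\pmod6$: $(1,0,2)$ on $X_{102}=\{(0,0,0)\}\cup\{(i,1,m-1-i):1\le i\le m-3\}\cup\{(m-1,2,m-1)\}$; $(0,2,1)$ on $X_{021}=\{(0,1,m-1)\}\cup\{(i,m-i,0):1\le i\le m-3\}\cup\{(m-1,0,1)\}$; $(2,1,0)$ on $X_{210}=\{(0,j,m-j):2\le j\le m-1\}\cup\{(1,0,m-1)\}$; $(0,1,2)$ at $(m-2,1,1)$;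 $(2,0,1)$ at $(m-2,2,0)$; $(1,2,0)$ otherwise. If $S=0$ and $m\equiv4\pmod6$: $(1,0,2)$ on $Y_{102}=\{(0,0,0)\}\cup\{(i,1,m-1-i):2\le i\le m-3\}\cup\{(m-1,2,m-1)\}$; $(0,2,1)$ on $Y_{021}=\{(0,1,m-1)\}\cup\{(i,m-i,0):2\le i\le m-3\}\cup\{(m-1,0,1)\}$; $(2,1,0)$ on $Y_{210}=\{(0,j,m-j):2\le j\le m-1\}\cup\{(1,0,m-1)\}\cup\{(1,j,m-1-j):2\le j\le m-2\}\cup\{(2,0,m-2),(2,m-1,m-1)\}$; $(0,1,2)$ at $(1,1,m-2)$ and $(m-2,1,1)$; $(2,0,1)$ at $(1,m-1,0)$ and $(m-2,2,0)$; $(1,2,0)$ otherwise. -}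

module Defs where

open import Data.Nat using (ℕ; zero; suc; _+_; _∸_; _≡ᵇ_; _≤ᵇ_; NonZero; _%_)
open import Data.Nat.DivMod using (m%n<n)
open import Data.Bool using (Bool; true; false; if_then_else_; _∧_; _∨_)
open import Data.Fin using (Fin; toℕ; fromℕ<)
open import Data.Product using (_×_; _,_)


-- Vertex set V = (ℤ_m)^3, coordinates represented by Fin m
-- (representatives in {0,…,m-1} are given by toℕ).
V : ℕ → Set
V m = Fin m × Fin m × Fin m

inc : (m : ℕ) .{{_ : NonZero m}} → Fin m → Fin m
inc m x = fromℕ< (m%n<n (suc (toℕ x)) m)

step : (m : ℕ) .{{_ : NonZero m}} → Fin 3 → V m → V m
step m Fin.zero          (i , j , k) = (inc m i , j , k)
step m (Fin.suc Fin.zero) (i , j , k) = (i , inc m j , k)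
step m (Fin.suc (Fin.suc Fin.zero)) (i , j , k) = (i , j , inc m k)

-- The six permutations (d₀,d₁,d₂) of (0,1,2); constructor pabc means triple (a,b,c).
dir0 dir1 dir2 : Fin 3
dir0 = Fin.zero
dir1 = Fin.suc Fin.zero
dir2 = Fin.suc (Fin.suc Fin.zero)

data Triple : Set where
  p012 p021 p102 p120 p201 p210 : Triple

d : Triple → Fin 3 → Fin 3
d p012 c = c
d p021 Fin.zero = dir0
d p021 (Fin.suc Fin.zero) = dir2
d p021 (Fin.suc (Fin.suc Fin.zero)) = dir1
d p102 Fin.zero = dir1
d p102 (Fin.suc Fin.zero) = dir0
d p102 (Fin.suc (Fin.suc Fin.zero)) = dir2
d p120 Fin.zero = dir1
d p120 (Fin.suc Fin.zero) = dir2
d p120 (Fin.suc (Fin.suc Fin.zero)) = dir0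
d p201 Fin.zero = dir2
d p201 (Fin.suc Fin.zero) = dir0
d p201 (Fin.suc (Fin.suc Fin.zero)) = dir1
d p210 Fin.zero = dir2
d p210 (Fin.suc Fin.zero) = dir1
d p210 (Fin.suc (Fin.suc Fin.zero)) = dir0

pt : ℕ → ℕ → ℕ → ℕ → ℕ → ℕ → Bool
pt i j k a b c = (i ≡ᵇ a) ∧ (j ≡ᵇ b) ∧ (k ≡ᵇ c)

btw : ℕ → ℕ → ℕ → Bool
btw a x b = (a ≤ᵇ x) ∧ (x ≤ᵇ b)

caseX : ℕ → ℕ → ℕ → ℕ → Triple
caseX m i j k =
  if pt i j k 0 0 0 ∨ (btw 1 i (m ∸ 3) ∧ (j ≡ᵇ 1) ∧ (k ≡ᵇ m ∸ 1 ∸ i))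
       ∨ pt i j k (m ∸ 1) 2 (m ∸ 1)
  then p102 else
  if pt i j k 0 1 (m ∸ 1) ∨ (btw 1 i (m ∸ 3) ∧ (j ≡ᵇ m ∸ i) ∧ (k ≡ᵇ 0))
       ∨ pt i j k (m ∸ 1) 0 1
  then p021 else
  if ((i ≡ᵇ 0) ∧ btw 2 j (m ∸ 1) ∧ (k ≡ᵇ m ∸ j)) ∨ pt i j k 1 0 (m ∸ 1)
  then p210 else
  if pt i j k (m ∸ 2) 1 1 then p012 else
  if pt i j k (m ∸ 2) 2 0 then p201 else
  p120

caseY : ℕ → ℕ → ℕ → ℕ → Triple
caseY m i j k =
  if pt i j k 0 0 0 ∨ (btw 2 i (m ∸ 3) ∧ (j ≡ᵇ 1) ∧ (k ≡ᵇ m ∸ 1 ∸ i))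
       ∨ pt i j k (m ∸ 1) 2 (m ∸ 1)
  then p102 else
  if pt i j k 0 1 (m ∸ 1) ∨ (btw 2 i (m ∸ 3) ∧ (j ≡ᵇ m ∸ i) ∧ (k ≡ᵇ 0))
       ∨ pt i j k (m ∸ 1) 0 1
  then p021 else
  if ((i ≡ᵇ 0) ∧ btw 2 j (m ∸ 1) ∧ (k ≡ᵇ m ∸ j)) ∨ pt i j k 1 0 (m ∸ 1)
       ∨ ((i ≡ᵇ 1) ∧ btw 2 j (m ∸ 2) ∧ (k ≡ᵇ m ∸ 1 ∸ j))
       ∨ pt i j k 2 0 (m ∸ 2) ∨ pt i j k 2 (m ∸ 1) (m ∸ 1)
  then p210 else
  if pt i j k 1 1 (m ∸ 2) ∨ pt i j k (m ∸ 2) 1 1 then p012 else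
  if pt i j k 1 (m ∸ 1) 0 ∨ pt i j k (m ∸ 2) 2 0 then p201 else
  p120

routeE : (m : ℕ) .{{_ : NonZero m}} → V m → Triple
routeE m (i' , j' , k') =
  let i = toℕ i' ; j = toℕ j' ; k = toℕ k' ; S = (i + j + k) % m in
  if S ≡ᵇ 1 then (if i ≡ᵇ 0 then p102 else p201) else
  if S ≡ᵇ 2 then (if j ≡ᵇ 0 then p210 else p012) else
  if S ≡ᵇ 0 then (if (m % 6) ≡ᵇ 4 then caseY m i j k else caseX m i j k) else
  p012

f : (m : ℕ) .{{_ : NonZero m}} → Fin 3 → V m → V m
f m c v = step m (d (routeE m v) c) v

iter : {A : Set} → (A → A) → ℕ → A → A
iter g zero x = x
iter g (suc n) x = g (iter g n x)

-- Every step raises S = i + j + k by one, so f_c is understood through its m-fold iterate on a slice of constant S,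
-- in the two coordinates (a , b) other than the one in direction c.  This return map is (a , b) ↦ (a + 1 , b + 1)
-- except on a few lines and points.  Following the diagonals through these exceptions gives the first return map of
-- a line: for colour 0 the line a = 0, where u ↦ u + 2, or u ↦ u + 4 when m ≡ 4 (mod 6); for colour 1 the line b = 0,
-- where u ↦ u + 3, or u ↦ u + 2 (u even) and u ↦ u + 6 (u odd) when m ≡ 4 (mod 6); for colour 2 the line b = 0,
-- where u ↦ u − 1; always with finitely many exceptions that join the residue classes into one cycle.
-- Hence a root vertex reaches the whole line, then by induction on a or b the whole slice, and finally every vertex.
-- A map under which some vertex reaches everything, itself included after at least one step, is a single cycle.
--
-- The regions and orbits are linear in m, a, b and a few parameters; they are verified by computation with linear
-- forms, the inequalities being certified by Farkas multipliers.

module Submission where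

open import Defs
open import Data.Bool using (Bool; true; false; if_then_else_; _∧_; _∨_)
open import Data.Bool.Properties using (∧-conicalˡ; ∧-conicalʳ)
open import Data.Empty using (⊥; ⊥-elim)
open import Data.Fin using (Fin; toℕ; fromℕ<)
open import Data.Fin.Patterns using (0F; 1F; 2F)
open import Data.Fin.Properties using (toℕ-fromℕ<; toℕ<n; toℕ-injective; _≟_; all?; any?)
open import Data.Integer as ℤ using (ℤ; +_; -[1+_]; 0ℤ; 1ℤ; -1ℤ; +≤+)
import Data.Integer.Properties as ℤₚ
open import Data.Integer.Solver using (module +-*-Solver)
open import Data.List using (List; []; _∷_; length; map; _++_; replicate)
open import Data.List.Relation.Unary.All using (All; []; _∷_)
open import Data.List.Relation.Unary.All.Properties using (++⁺)
open import Data.Maybe using (Maybe; just; nothing)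
open import Data.Nat as ℕ using (ℕ; zero; suc; pred; _+_; _*_; _∸_; _≤_; _<_; z≤n; s≤s; _≡ᵇ_; _≤ᵇ_; NonZero; _%_; _/_)
open import Data.Nat.DivMod
open import Data.Nat.Divisibility using (_∣_; divides)
open import Data.Nat.Properties hiding (_≟_)
open import Data.Product using (_×_; _,_; proj₁; proj₂; ∃; ∃-syntax)
open import Data.Sum using (_⊎_; inj₁; inj₂)
open import Data.Unit using (⊤; tt)
open import Function.Definitions using (Bijective)
open import Relation.Binary.Definitions using (tri<; tri≈; tri>)
open import Relation.Binary.PropositionalEquality
open import Relation.Nullary using (¬_; Dec; yes; no)
open import Relation.Nullary.Decidable using (toWitness; _→-dec_)
open import Relation.Nullary.Reflects using (Reflects; ofʸ; ofⁿ; fromEquivalence; _×-reflects_; _⊎-reflects_)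
open +-*-Solver using (solve; _:=_) renaming (_:+_ to _⊹_; _:*_ to _⋆_; :-_ to ⊝_; _:-_ to _⊖_; con to lit)

-- Linear arithmetic

-- On a diagonal b - a is constant, so a first return to a line changes it by the sum of the shifts
-- of the exceptional lines met on the way. Except for colour 0 outside m ≡ 4 (mod 6), one of these
-- lines is an antidiagonal, a + b = m - 1 or a + b = m. As m is even, the parity of a + b decides
-- whether a diagonal hits it or steps over it. Hence the separate treatment of even and odd u, and
-- the half of m in the step counts.
--
-- The second table is forced by colour 1: under the first one with m ≡ 4 (mod 6) the orbit 2, 5, 8,
-- ... arrives at m - 2, which goes to 0, and 0 goes back to 2, a short cycle.
--
-- Injectivity of f_c is not known in advance; it is a consequence of reachability. Only on S = 1
-- and S = 2, where (a , b) is still in motion, is it checked directly, in order to carry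
-- reachability back from S = 3.

infixl 6 _⊞_
infixl 7 _⊡_

-- A form c ∷ c₁ ∷ … ∷ cₙ stands for c + c₁ x₁ + … + cₙ xₙ; missing coefficients and variables count as 0.
Form : Set
Form = List ℤ

dot : Form → List ℤ → ℤ
dot [] _ = 0ℤ
dot (_ ∷ _) [] = 0ℤ
dot (c ∷ f) (x ∷ ρ) = c ℤ.* x ℤ.+ dot f ρ

eval : List ℤ → Form → ℤ
eval ρ f = dot f (1ℤ ∷ ρ)

_⊞_ : Form → Form → Form
[] ⊞ g = g
(c ∷ f) ⊞ [] = c ∷ f
(c ∷ f) ⊞ (c′ ∷ g) = (c ℤ.+ c′) ∷ (f ⊞ g)

_⊡_ : ℤ → Form → Form
k ⊡ f = map (k ℤ.*_) f

constant : ℤ → Form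
constant c = c ∷ []

opposite : Form → Form
opposite f = -1ℤ ⊡ f

dot-⊞ : ∀ f g ρ → dot (f ⊞ g) ρ ≡ dot f ρ ℤ.+ dot g ρ
dot-⊞ [] g ρ = sym (ℤₚ.+-identityˡ _)
dot-⊞ (c ∷ f) [] ρ = sym (ℤₚ.+-identityʳ _)
dot-⊞ (c ∷ f) (c′ ∷ g) [] = refl
dot-⊞ (c ∷ f) (c′ ∷ g) (x ∷ ρ) rewrite dot-⊞ f g ρ = lemma c c′ x (dot f ρ) (dot g ρ)
  where
  lemma : ∀ c c′ x y z → (c ℤ.+ c′) ℤ.* x ℤ.+ (y ℤ.+ z) ≡ (c ℤ.* x ℤ.+ y) ℤ.+ (c′ ℤ.* x ℤ.+ z)
  lemma = solve 5 (λ c c′ x y z → (c ⊹ c′) ⋆ x ⊹ (y ⊹ z) := (c ⋆ x ⊹ y) ⊹ (c′ ⋆ x ⊹ z)) refl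

dot-⊡ : ∀ k f ρ → dot (k ⊡ f) ρ ≡ k ℤ.* dot f ρ
dot-⊡ k [] ρ = sym (ℤₚ.*-zeroʳ k)
dot-⊡ k (c ∷ f) [] = sym (ℤₚ.*-zeroʳ k)
dot-⊡ k (c ∷ f) (x ∷ ρ) rewrite dot-⊡ k f ρ = lemma k c x (dot f ρ)
  where
  lemma : ∀ k c x y → (k ℤ.* c) ℤ.* x ℤ.+ k ℤ.* y ≡ k ℤ.* (c ℤ.* x ℤ.+ y)
  lemma = solve 4 (λ k c x y → (k ⋆ c) ⋆ x ⊹ k ⋆ y := k ⋆ (c ⋆ x ⊹ y)) refl

eval-constant : ∀ ρ c → eval ρ (constant c) ≡ c
eval-constant ρ c = trans (ℤₚ.+-identityʳ _) (ℤₚ.*-identityʳ c)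

eval-⊞ : ∀ ρ f g → eval ρ (f ⊞ g) ≡ eval ρ f ℤ.+ eval ρ g
eval-⊞ ρ f g = dot-⊞ f g (1ℤ ∷ ρ)

eval-⊡ : ∀ ρ k f → eval ρ (k ⊡ f) ≡ k ℤ.* eval ρ f
eval-⊡ ρ k f = dot-⊡ k f (1ℤ ∷ ρ)

eval-opposite : ∀ ρ f → eval ρ (opposite f) ≡ ℤ.- eval ρ f
eval-opposite ρ f = trans (eval-⊡ ρ -1ℤ f) (ℤₚ.-1*i≡-i (eval ρ f))

subst-form : List Form → Form → Form
subst-form σ [] = []
subst-form [] (c ∷ f) = []
subst-form (s ∷ σ) (c ∷ f) = c ⊡ s ⊞ subst-form σ f

substitute : List Form → Form → Form
substitute σ f = subst-form (constant 1ℤ ∷ σ) f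

dot-subst : ∀ ρ σ f → eval ρ (subst-form σ f) ≡ dot f (map (eval ρ) σ)
dot-subst ρ σ [] = refl
dot-subst ρ [] (c ∷ f) = refl
dot-subst ρ (s ∷ σ) (c ∷ f) =
  trans (eval-⊞ ρ (c ⊡ s) (subst-form σ f)) (cong₂ ℤ._+_ (eval-⊡ ρ c s) (dot-subst ρ σ f))

eval-substitute : ∀ ρ σ f → eval ρ (substitute σ f) ≡ eval (map (eval ρ) σ) f
eval-substitute ρ σ f rewrite dot-subst ρ (constant 1ℤ ∷ σ) f = refl

Holds : List ℤ → Form → Set
Holds ρ f = 0ℤ ℤ.≤ eval ρ f

-- Fourier–Motzkin search for a certificate: nonnegative multipliers whose combination of the rows,
-- together with nonnegativity of the variables, is absurd. Only the certificate is verified.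
Row : Set
Row = Form × List ℕ

addℕ : List ℕ → List ℕ → List ℕ
addℕ [] ys = ys
addℕ (x ∷ xs) [] = x ∷ xs
addℕ (x ∷ xs) (y ∷ ys) = x ℕ.+ y ∷ addℕ xs ys

combine-rows : ℕ → Row → ℕ → Row → Row
combine-rows p (f , c) q (g , e) = (+ p) ⊡ f ⊞ (+ q) ⊡ g , addℕ (map (p ℕ.*_) c) (map (q ℕ.*_) e)

initial-rows : ℕ → List Form → List Row
initial-rows n [] = []
initial-rows n (f ∷ Γ) = (f , replicate n 0 ++ 1 ∷ []) ∷ initial-rows (suc n) Γ

nonnegative? : ℤ → Bool
nonnegative? (+ _) = true
nonnegative? -[1+ _ ] = false

trivial? : Form → Bool
trivial? [] = true
trivial? (c ∷ f) = nonnegative? c ∧ trivial? f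

record Split : Set where
  constructor signs
  field
    lower upper : List (ℕ × Row)
    rest : List Row

drop-variable : Row → Row
drop-variable (c ∷ _ ∷ f , e) = c ∷ f , e
drop-variable r = r

-- The variable being eliminated always stands right behind the constant. Dropping it brings the
-- next variable there, so every round of `search` works on the same position.
classify : List Row → Split
classify [] = signs [] [] []
classify ((c ∷ + suc n ∷ f , e) ∷ rows) = let signs l u r = classify rows in signs ((suc n , c ∷ f , e) ∷ l) u r
classify ((c ∷ -[1+ n ] ∷ f , e) ∷ rows) = let signs l u r = classify rows in signs l ((suc n , c ∷ f , e) ∷ u) r
classify (row ∷ rows) = let signs l u r = classify rows in signs l u (drop-variable row ∷ r)

insert-row : Row → List Row → List Row
insert-row (f , e) rows = if trivial? f then rows else (f , e) ∷ rows

pair-with : ℕ × Row → List (ℕ × Row) → List Row → List Row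
pair-with _ [] rows = rows
pair-with (p , f) ((q , g) ∷ us) rows = insert-row (combine-rows q f p g) (pair-with (p , f) us rows)

pair-all : List (ℕ × Row) → List (ℕ × Row) → List Row → List Row
pair-all [] us rows = rows
pair-all (l ∷ ls) us rows = pair-with l us (pair-all ls us rows)

certificate : List Row → List ℕ
certificate [] = []
certificate ((-[1+ _ ] ∷ _ , e) ∷ _) = e
certificate (_ ∷ rows) = certificate rows

search : ℕ → List Row → List ℕ
search zero rows = certificate rows
search (suc n) rows =
  -- The added lower row is x ≥ 0 for the eliminated variable. Its multiplier list is empty, so the
  -- recorded combination of the hypotheses may end with negative coefficients, which `absurd?`
  -- accepts because the variables are nonnegative.
  let signs l u r = classify rows in search n (pair-all ((1 , 0ℤ ∷ [] , []) ∷ l) u r)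

combination : List ℕ → List Form → Form
combination [] _ = []
combination (_ ∷ _) [] = []
combination (c ∷ cs) (f ∷ Γ) = (+ c) ⊡ f ⊞ combination cs Γ

nonpositive? : Form → Bool
nonpositive? [] = true
nonpositive? (+ zero ∷ f) = nonpositive? f
nonpositive? (+ suc _ ∷ f) = false
nonpositive? (-[1+ _ ] ∷ f) = nonpositive? f

absurd? : Form → Bool
absurd? (-[1+ _ ] ∷ f) = nonpositive? f
absurd? _ = false

variables : List Form → ℕ
variables [] = 0
variables (f ∷ Γ) = length f ℕ.⊔ variables Γ

refutes : List Form → Bool
refutes Γ = absurd? (combination (search (variables Γ) (initial-rows 0 Γ)) Γ)

-- Over the integers f < 0 means -f - 1 ≥ 0. The elimination is rational, but negating the goal in
-- this way rounds it, so that x ≤ y follows from 2x ≤ 2y + 1.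
entails : List Form → Form → Bool
entails Γ f = refutes ((opposite f ⊞ constant -1ℤ) ∷ Γ)

NonNegative : List ℤ → Set
NonNegative = All (0ℤ ℤ.≤_)

combination-holds : ∀ ρ cs Γ → All (Holds ρ) Γ → Holds ρ (combination cs Γ)
combination-holds ρ [] Γ h = ℤₚ.≤-refl
combination-holds ρ (c ∷ cs) [] h = ℤₚ.≤-refl
combination-holds ρ (c ∷ cs) (f ∷ Γ) (h ∷ hs)
  rewrite eval-⊞ ρ ((+ c) ⊡ f) (combination cs Γ) | eval-⊡ ρ (+ c) f =
  ℤₚ.+-mono-≤ (subst (ℤ._≤ (+ c) ℤ.* eval ρ f) (ℤₚ.*-zeroʳ (+ c)) (ℤₚ.*-monoˡ-≤-nonNeg (+ c) h))
              (combination-holds ρ cs Γ hs)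

nonpositive-dot : ∀ f ρ → NonNegative ρ → nonpositive? f ≡ true → dot f ρ ℤ.≤ 0ℤ
nonpositive-dot [] ρ _ _ = ℤₚ.≤-refl
nonpositive-dot (_ ∷ _) [] _ _ = ℤₚ.≤-refl
nonpositive-dot (+ zero ∷ f) (x ∷ ρ) (_ ∷ n) e = subst (ℤ._≤ 0ℤ) (sym (ℤₚ.+-identityˡ _)) (nonpositive-dot f ρ n e)
nonpositive-dot (-[1+ k ] ∷ f) (x ∷ ρ) (p ∷ n) e =
  ℤₚ.+-mono-≤ (subst (-[1+ k ] ℤ.* x ℤ.≤_) (ℤₚ.*-zeroʳ -[1+ k ]) (ℤₚ.*-monoˡ-≤-nonPos -[1+ k ] p))
              (nonpositive-dot f ρ n e)

absurd-form : ∀ ρ f → NonNegative ρ → absurd? f ≡ true → ¬ Holds ρ f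
absurd-form ρ (-[1+ k ] ∷ f) n e h = ℤₚ.<⇒≱ ℤ.-<+ (ℤₚ.≤-trans h
  (subst (eval ρ (-[1+ k ] ∷ f) ℤ.≤_) (trans (ℤₚ.+-identityʳ _) (ℤₚ.*-identityʳ -[1+ k ]))
         (ℤₚ.+-monoʳ-≤ (-[1+ k ] ℤ.* 1ℤ) (nonpositive-dot f ρ n e))))

refutes-sound : ∀ ρ Γ → NonNegative ρ → refutes Γ ≡ true → ¬ All (Holds ρ) Γ
refutes-sound ρ Γ n e h = absurd-form ρ (combination cs Γ) n e (combination-holds ρ cs Γ h)
  where
  cs = search (variables Γ) (initial-rows 0 Γ)

entails-sound : ∀ ρ Γ f → NonNegative ρ → entails Γ f ≡ true → All (Holds ρ) Γ → Holds ρ f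
entails-sound ρ Γ f n e h = ℤₚ.≮⇒≥ λ f<0 → refutes-sound ρ ((opposite f ⊞ constant -1ℤ) ∷ Γ) n e (negated f<0 ∷ h)
  where
  negated : eval ρ f ℤ.< 0ℤ → Holds ρ (opposite f ⊞ constant -1ℤ)
  negated f<0 rewrite eval-⊞ ρ (opposite f) (constant -1ℤ) | eval-opposite ρ f | eval-constant ρ -1ℤ
    = subst (0ℤ ℤ.≤_) (lemma (eval ρ f)) (ℤₚ.i≤j⇒0≤j-i (ℤₚ.i<j⇒suc[i]≤j f<0))
    where
    lemma : ∀ x → 0ℤ ℤ.- (1ℤ ℤ.+ x) ≡ (ℤ.- x) ℤ.+ -1ℤ
    lemma = solve 1 (λ x → lit 0ℤ ⊖ (lit 1ℤ ⊹ x) := (⊝ x) ⊹ lit -1ℤ) refl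

-- Linear statements about natural numbers

infix 4 _⊢_ _⊢⊥
infix 6 _:≤_ _:<_ _:≡_
infixl 7 _:+_
infixl 8 _:*_
infix 9 #_

data Expr : Set where
  var  : ℕ → Expr
  #_   : ℕ → Expr
  _:+_ : Expr → Expr → Expr
  _:*_ : ℕ → Expr → Expr

data Atom : Set where
  _:≤_ _:≡_ : Expr → Expr → Atom

_:<_ : Expr → Expr → Atom
a :< b = # 1 :+ a :≤ b

lookup : List ℕ → ℕ → ℕ
lookup [] _ = 0
lookup (x ∷ ρ) zero = x
lookup (x ∷ ρ) (suc n) = lookup ρ n

⟦_⟧ : Expr → List ℕ → ℕ
⟦ var n ⟧ ρ = lookup ρ n
⟦ # n ⟧ ρ = n
⟦ a :+ b ⟧ ρ = ⟦ a ⟧ ρ + ⟦ b ⟧ ρ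
⟦ k :* a ⟧ ρ = k * ⟦ a ⟧ ρ

⟦_⟧ₐ : Atom → List ℕ → Set
⟦ a :≤ b ⟧ₐ ρ = ⟦ a ⟧ ρ ≤ ⟦ b ⟧ ρ
⟦ a :≡ b ⟧ₐ ρ = ⟦ a ⟧ ρ ≡ ⟦ b ⟧ ρ

unit : ℕ → Form
unit zero = 1ℤ ∷ []
unit (suc n) = 0ℤ ∷ unit n

form : Expr → Form
form (var n) = 0ℤ ∷ unit n
form (# n) = constant (+ n)
form (a :+ b) = form a ⊞ form b
form (k :* a) = (+ k) ⊡ form a

ι : List ℕ → List ℤ
ι = map (λ n → + n)

dot-unit : ∀ n ρ → dot (unit n) (ι ρ) ≡ + lookup ρ n
dot-unit zero [] = refl
dot-unit zero (x ∷ ρ) = trans (ℤₚ.+-identityʳ _) (ℤₚ.*-identityˡ (+ x))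
dot-unit (suc n) [] = refl
dot-unit (suc n) (x ∷ ρ) = trans (ℤₚ.+-identityˡ _) (dot-unit n ρ)

eval-form : ∀ ρ e → eval (ι ρ) (form e) ≡ + ⟦ e ⟧ ρ
eval-form ρ (var n) = trans (ℤₚ.+-identityˡ _) (dot-unit n ρ)
eval-form ρ (# n) = eval-constant (ι ρ) (+ n)
eval-form ρ (a :+ b) rewrite eval-⊞ (ι ρ) (form a) (form b) | eval-form ρ a | eval-form ρ b = refl
eval-form ρ (k :* a) rewrite eval-⊡ (ι ρ) (+ k) (form a) | eval-form ρ a = sym (ℤₚ.pos-* k (⟦ a ⟧ ρ))

infixl 6 _⊟_

_⊟_ : Form → Form → Form
f ⊟ g = f ⊞ opposite g

eval-⊟ : ∀ ρ f g → eval ρ (f ⊟ g) ≡ eval ρ f ℤ.- eval ρ g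
eval-⊟ ρ f g rewrite eval-⊞ ρ f (opposite g) | eval-opposite ρ g = refl

⊟-holds : ∀ ρ f g → eval ρ f ℤ.≤ eval ρ g → Holds ρ (g ⊟ f)
⊟-holds ρ f g h = subst (0ℤ ℤ.≤_) (sym (eval-⊟ ρ g f)) (ℤₚ.i≤j⇒0≤j-i h)

holds-⊟ : ∀ ρ f g → Holds ρ (g ⊟ f) → eval ρ f ℤ.≤ eval ρ g
holds-⊟ ρ f g h = ℤₚ.0≤i-j⇒j≤i (subst (0ℤ ℤ.≤_) (eval-⊟ ρ g f) h)

nonnegative-ι : ∀ ρ → NonNegative (ι ρ)
nonnegative-ι [] = []
nonnegative-ι (x ∷ ρ) = +≤+ z≤n ∷ nonnegative-ι ρ

atom-forms : Atom → List Form
atom-forms (a :≤ b) = form b ⊟ form a ∷ []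
atom-forms (a :≡ b) = form b ⊟ form a ∷ form a ⊟ form b ∷ []

≤-holds : ∀ ρ a b → ⟦ a ⟧ ρ ≤ ⟦ b ⟧ ρ → Holds (ι ρ) (form b ⊟ form a)
≤-holds ρ a b h = ⊟-holds (ι ρ) (form a) (form b) (subst₂ ℤ._≤_ (sym (eval-form ρ a)) (sym (eval-form ρ b)) (+≤+ h))

holds-≤ : ∀ ρ a b → Holds (ι ρ) (form b ⊟ form a) → ⟦ a ⟧ ρ ≤ ⟦ b ⟧ ρ
holds-≤ ρ a b h = ℤₚ.drop‿+≤+ (subst₂ ℤ._≤_ (eval-form ρ a) (eval-form ρ b) (holds-⊟ (ι ρ) (form a) (form b) h))

atom-holds : ∀ ρ a → ⟦ a ⟧ₐ ρ → All (Holds (ι ρ)) (atom-forms a)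
atom-holds ρ (a :≤ b) h = ≤-holds ρ a b h ∷ []
atom-holds ρ (a :≡ b) h = ≤-holds ρ a b (≤-reflexive h) ∷ ≤-holds ρ b a (≤-reflexive (sym h)) ∷ []

holds-atom : ∀ ρ a → All (Holds (ι ρ)) (atom-forms a) → ⟦ a ⟧ₐ ρ
holds-atom ρ (a :≤ b) (h ∷ []) = holds-≤ ρ a b h
holds-atom ρ (a :≡ b) (h ∷ g ∷ []) = ≤-antisym (holds-≤ ρ a b h) (holds-≤ ρ b a g)

entails-all : List Form → List Form → Bool
entails-all Γ [] = true
entails-all Γ (f ∷ fs) = entails Γ f ∧ entails-all Γ fs

entails-all-sound : ∀ ρ Γ fs → NonNegative ρ → entails-all Γ fs ≡ true → All (Holds ρ) Γ → All (Holds ρ) fs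
entails-all-sound ρ Γ [] n e h = []
entails-all-sound ρ Γ (f ∷ fs) n e h =
  entails-sound ρ Γ f n (∧-conicalˡ _ _ e) h ∷ entails-all-sound ρ Γ fs n (∧-conicalʳ (entails Γ f) _ e) h

forms : List Atom → List Form
forms [] = []
forms (a ∷ as) = atom-forms a ++ forms as

-- A singleton is kept apart so that a sequent with one conclusion delivers it bare, without a
-- trailing unit.
⟦_⟧ₗ : List Atom → List ℕ → Set
⟦ [] ⟧ₗ ρ = ⊤
⟦ a ∷ [] ⟧ₗ ρ = ⟦ a ⟧ₐ ρ
⟦ a ∷ b ∷ as ⟧ₗ ρ = ⟦ a ⟧ₐ ρ × ⟦ b ∷ as ⟧ₗ ρ

forms-hold : ∀ ρ as → ⟦ as ⟧ₗ ρ → All (Holds (ι ρ)) (forms as)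
forms-hold ρ [] h = []
forms-hold ρ (a ∷ []) h = ++⁺ (atom-holds ρ a h) []
forms-hold ρ (a ∷ b ∷ as) (h , hs) = ++⁺ (atom-holds ρ a h) (forms-hold ρ (b ∷ as) hs)

data Sequent : Set where
  _⊢_ : List Atom → List Atom → Sequent
  _⊢⊥ : List Atom → Sequent

valid : Sequent → Bool
valid (Γ ⊢ Δ) = check Δ
  where
  check : List Atom → Bool
  check [] = true
  check (a ∷ as) = entails-all (forms Γ) (atom-forms a) ∧ check as
valid (Γ ⊢⊥) = refutes (forms Γ)

implies : List Atom → Set → List ℕ → Set
implies [] G ρ = G
implies (a ∷ as) G ρ = ⟦ a ⟧ₐ ρ → implies as G ρ

⟦_⟧ₛ : Sequent → List ℕ → Set
⟦ Γ ⊢ Δ ⟧ₛ ρ = implies Γ (⟦ Δ ⟧ₗ ρ) ρ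
⟦ Γ ⊢⊥ ⟧ₛ ρ = implies Γ ⊥ ρ

curry-forms : ∀ ρ Γ {G : Set} → (All (Holds (ι ρ)) (forms Γ) → G) → implies Γ G ρ
curry-forms ρ [] k = k []
curry-forms ρ (a ∷ Γ) k = λ h → curry-forms ρ Γ λ hs → k (++⁺ (atom-holds ρ a h) hs)

sequent-sound : ∀ ρ s → valid s ≡ true → ⟦ s ⟧ₛ ρ
sequent-sound ρ (Γ ⊢⊥) e = curry-forms ρ Γ (refutes-sound (ι ρ) (forms Γ) (nonnegative-ι ρ) e)
sequent-sound ρ (Γ ⊢ Δ) e = curry-forms ρ Γ (λ h → conclude Δ e h)
  where
  atom : ∀ a → entails-all (forms Γ) (atom-forms a) ≡ true → All (Holds (ι ρ)) (forms Γ) → ⟦ a ⟧ₐ ρ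
  atom a e h = holds-atom ρ a (entails-all-sound (ι ρ) (forms Γ) (atom-forms a) (nonnegative-ι ρ) e h)
  conclude : ∀ Δ → valid (Γ ⊢ Δ) ≡ true → All (Holds (ι ρ)) (forms Γ) → ⟦ Δ ⟧ₗ ρ
  conclude [] e h = tt
  conclude (a ∷ []) e h = atom a (∧-conicalˡ _ _ e) h
  conclude (a ∷ b ∷ as) e h =
    atom a (∧-conicalˡ _ _ e) h , conclude (b ∷ as) (∧-conicalʳ (entails-all (forms Γ) (atom-forms a)) _ e) h

-- Higher-order syntax: a sequent or path is written with bound Agda variables, which `instantiate`
-- turns into consecutive `var`s in the order of quantification.
Function : ℕ → Set → Set
Function zero A = A
Function (suc n) A = Expr → Function n A

instantiate : ∀ {A} n → ℕ → Function n A → A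
instantiate zero k f = f
instantiate (suc n) k f = instantiate n (suc k) (f (var k))

Forall : ℕ → (List ℕ → Set) → Set
Forall zero P = P []
Forall (suc n) P = ∀ x → Forall n (λ ρ → P (x ∷ ρ))

forall-intro : ∀ n {P : List ℕ → Set} → (∀ ρ → P ρ) → Forall n P
forall-intro zero p = p []
forall-intro (suc n) p x = forall-intro n (λ ρ → p (x ∷ ρ))

abstract
  linear : ∀ n (s : Function n Sequent) → valid (instantiate n 0 s) ≡ true → Forall n ⟦ instantiate n 0 s ⟧ₛ
  linear n s e = forall-intro n (λ ρ → sequent-sound ρ (instantiate n 0 s) e)

-- The assignment on the slice S = 0

infixr 3 _and_
infixr 2 _or_

data Guard : Set where
  atom     : Atom → Guard
  _and_ _or_ : Guard → Guard → Guard

⟦_⟧ᵍ : Guard → List ℕ → Set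
⟦ atom a ⟧ᵍ ρ = ⟦ a ⟧ₐ ρ
⟦ g and h ⟧ᵍ ρ = ⟦ g ⟧ᵍ ρ × ⟦ h ⟧ᵍ ρ
⟦ g or h ⟧ᵍ ρ = ⟦ g ⟧ᵍ ρ ⊎ ⟦ h ⟧ᵍ ρ

-- The tables have disjunctions only at the top of a guard, where `decide` splits them. It therefore
-- suffices that here they yield no consequence, and that `certain` rejects them.
consequences : List Form → Guard → List Form
consequences σ (atom a) = map (substitute σ) (atom-forms a)
consequences σ (g and h) = consequences σ g ++ consequences σ h
consequences σ (g or h) = []

certain : List Form → List Form → Guard → Bool
certain Γ σ (atom a) = entails-all Γ (map (substitute σ) (atom-forms a))
certain Γ σ (g and h) = certain Γ σ g ∧ certain Γ σ h
certain Γ σ (g or h) = false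

decide : List Form → List Form → Guard → Maybe Bool
decide Γ σ (g or h) with decide Γ σ g
... | just true = just true
... | nothing = nothing
... | just false = decide Γ σ h
decide Γ σ g with refutes (consequences σ g ++ Γ)
... | true = just false
... | false = if certain Γ σ g then just true else nothing

-- Guards speak of γ = (m , i , j , k), rules of ρ = (m , a , b); σ writes the former as forms in
-- the latter.
Instance : List ℤ → List Form → List ℕ → Set
Instance ρ σ γ = map (eval ρ) σ ≡ ι γ

module _ {ρ : List ℤ} {Γ σ : List Form} {γ : List ℕ} (n : NonNegative ρ) (s : Instance ρ σ γ) (hyp : All (Holds ρ) Γ) where

  substitute-holds : ∀ f → Holds (ι γ) f → Holds ρ (substitute σ f)
  substitute-holds f h = subst (0ℤ ℤ.≤_) (sym (trans (eval-substitute ρ σ f) (cong (λ ρ′ → eval ρ′ f) s))) h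

  holds-substitute : ∀ f → Holds ρ (substitute σ f) → Holds (ι γ) f
  holds-substitute f h = subst (0ℤ ℤ.≤_) (trans (eval-substitute ρ σ f) (cong (λ ρ′ → eval ρ′ f) s)) h

  substitute-all : ∀ fs → All (Holds (ι γ)) fs → All (Holds ρ) (map (substitute σ) fs)
  substitute-all [] [] = []
  substitute-all (f ∷ fs) (h ∷ hs) = substitute-holds f h ∷ substitute-all fs hs

  all-substitute : ∀ fs → All (Holds ρ) (map (substitute σ) fs) → All (Holds (ι γ)) fs
  all-substitute [] [] = []
  all-substitute (f ∷ fs) (h ∷ hs) = holds-substitute f h ∷ all-substitute fs hs

  consequences-hold : ∀ g → ⟦ g ⟧ᵍ γ → All (Holds ρ) (consequences σ g)
  consequences-hold (atom a) h = substitute-all (atom-forms a) (atom-holds γ a h)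
  consequences-hold (g and g′) (h , h′) = ++⁺ (consequences-hold g h) (consequences-hold g′ h′)
  consequences-hold (g or g′) h = []

  certain-sound : ∀ g → certain Γ σ g ≡ true → ⟦ g ⟧ᵍ γ
  certain-sound (atom a) e =
    holds-atom γ a (all-substitute (atom-forms a) (entails-all-sound ρ Γ (map (substitute σ) (atom-forms a)) n e hyp))
  certain-sound (g and h) e = certain-sound g (∧-conicalˡ _ _ e) , certain-sound h (∧-conicalʳ (certain Γ σ g) _ e)

  refuted : ∀ g → refutes (consequences σ g ++ Γ) ≡ true → ¬ ⟦ g ⟧ᵍ γ
  refuted g e h = refutes-sound ρ (consequences σ g ++ Γ) n e (++⁺ (consequences-hold g h) hyp)

  decide-sound : ∀ g b → decide Γ σ g ≡ just b → Reflects (⟦ g ⟧ᵍ γ) b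
  decide-sound (atom a) b e with refutes (consequences σ (atom a) ++ Γ) in eq
  decide-sound (atom a) b refl | true = ofⁿ (refuted (atom a) eq)
  decide-sound (atom a) b e | false with certain Γ σ (atom a) in eq′
  decide-sound (atom a) b refl | false | true = ofʸ (certain-sound (atom a) eq′)
  decide-sound (g and h) b e with refutes (consequences σ (g and h) ++ Γ) in eq
  decide-sound (g and h) b refl | true = ofⁿ (refuted (g and h) eq)
  decide-sound (g and h) b e | false with certain Γ σ (g and h) in eq′
  decide-sound (g and h) b refl | false | true = ofʸ (certain-sound (g and h) eq′)
  decide-sound (g or h) b e with decide Γ σ g in eq
  decide-sound (g or h) b refl | just true with ofʸ p ← decide-sound g true eq = ofʸ (inj₁ p)
  decide-sound (g or h) b e | just false with decide-sound g false eq | decide-sound h b e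
  ... | ofⁿ ¬p | ofʸ q = ofʸ (inj₂ q)
  ... | ofⁿ ¬p | ofⁿ ¬q = ofⁿ λ { (inj₁ p) → ¬p p ; (inj₂ q) → ¬q q }

data Tree : Set where
  leaf : Triple → Tree
  node : Guard → Triple → Tree → Tree

-- The index repeats the conditional of the tables, so `caseX m i j k` is represented as it stands;
-- each `node` only asks that the Boolean test reflect the linear guard.
data Represents (γ : List ℕ) : Tree → Triple → Set where
  leaf : ∀ τ → Represents γ (leaf τ) τ
  node : ∀ {g τ t b τ′} → Reflects (⟦ g ⟧ᵍ γ) b → Represents γ t τ′ → Represents γ (node g τ t) (if b then τ else τ′)

agree : Fin 3 → Maybe (Fin 3) → Maybe (Fin 3)
agree e nothing = nothing
agree e (just e′) with e ≟ e′
... | yes _ = just e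
... | no _ = nothing

agree-sound : ∀ e r {e′} → agree e r ≡ just e′ → e ≡ e′ × r ≡ just e′
agree-sound e (just e″) h with e ≟ e″
agree-sound e (just .e) refl | yes refl = refl , refl

-- An undecided guard is harmless when both branches give colour c the same direction.
follow : Fin 3 → List Form → List Form → Tree → Maybe (Fin 3)
follow c Γ σ (leaf τ) = just (d τ c)
follow c Γ σ (node g τ t) with decide Γ σ g
... | just true = just (d τ c)
... | just false = follow c Γ σ t
... | nothing = agree (d τ c) (follow c Γ σ t)

follow-sound : ∀ {ρ Γ σ γ} → NonNegative ρ → Instance ρ σ γ → All (Holds ρ) Γ →
               ∀ c t {τ} e → Represents γ t τ → follow c Γ σ t ≡ just e → d τ c ≡ e
follow-sound n s h c (leaf τ) e (leaf .τ) refl = refl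
follow-sound {Γ = Γ} {σ} n s h c (node g τ t) e (node r q) eq with decide Γ σ g in dec
... | just true with r | decide-sound n s h g true dec
...   | ofʸ _ | _ with refl ← eq = refl
...   | ofⁿ ¬p | ofʸ p = ⊥-elim (¬p p)
follow-sound {Γ = Γ} {σ} n s h c (node g τ t) e (node r q) eq | just false with r | decide-sound n s h g false dec
...   | ofʸ p | ofⁿ ¬p = ⊥-elim (¬p p)
...   | ofⁿ _ | _ = follow-sound n s h c t e q eq
follow-sound {Γ = Γ} {σ} n s h c (node g τ t) e (node r q) eq | nothing
  with agree-sound (d τ c) (follow c Γ σ t) eq | r
... | eq₁ , _ | ofʸ _ = eq₁
... | _ , eq₂ | ofⁿ _ = follow-sound n s h c t e q eq₂

≡ᵇ-reflects : ∀ x y → Reflects (x ≡ y) (x ≡ᵇ y)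
≡ᵇ-reflects x y = fromEquivalence (≡ᵇ⇒≡ x y) (≡⇒≡ᵇ x y)

reflects-map : ∀ {P Q : Set} {b} → (P → Q) → (Q → P) → Reflects P b → Reflects Q b
reflects-map to from (ofʸ p) = ofʸ (to p)
reflects-map to from (ofⁿ ¬p) = ofⁿ (λ q → ¬p (from q))

-- Truncated subtraction is not linear. Under c ≤ m it can be moved to the other side, where it
-- becomes an addition.
≡ᵇ∸-reflects : ∀ {c m} x → c ≤ m → Reflects (c + x ≡ m) (x ≡ᵇ m ∸ c)
≡ᵇ∸-reflects {c} {m} x c≤m = reflects-map
  (λ e → trans (cong (λ y → c + y) e) (m+[n∸m]≡n c≤m))
  (λ e → sym (trans (cong (_∸ c) (sym e)) (m+n∸m≡n c x)))
  (≡ᵇ-reflects x (m ∸ c))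

≤ᵇ∸-reflects : ∀ {c m} x → c ≤ m → Reflects (c + x ≤ m) (x ≤ᵇ m ∸ c)
≤ᵇ∸-reflects {c} {m} x c≤m = reflects-map
  (λ h → subst (λ y → c + x ≤ y) (m+[n∸m]≡n c≤m) (+-monoʳ-≤ c h))
  (λ h → subst (_≤ m ∸ c) (m+n∸m≡n c x) (∸-monoˡ-≤ c h))
  (≤ᵇ-reflects-≤ x (m ∸ c))

≡ᵇ∸1∸-reflects : ∀ {i m} x → i < m → Reflects (1 + i + x ≡ m) (x ≡ᵇ m ∸ 1 ∸ i)
≡ᵇ∸1∸-reflects {i} {m} x h rewrite ∸-+-assoc m 1 i = ≡ᵇ∸-reflects x h

-- The two tables as decision trees

mᵉ iᵉ jᵉ kᵉ : Expr
mᵉ = var 0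
iᵉ = var 1
jᵉ = var 2
kᵉ = var 3

infix 4 _==_ _=≤_
_==_ _=≤_ : Expr → Expr → Guard
a == b = atom (a :≡ b)
a =≤ b = atom (a :≤ b)

at : Guard → Guard → Guard → Guard
at a b c = a and b and c

caseX-tree caseY-tree : Tree
caseX-tree =
  node (at (iᵉ == # 0) (jᵉ == # 0) (kᵉ == # 0)
        or ((# 1 =≤ iᵉ and # 3 :+ iᵉ =≤ mᵉ) and jᵉ == # 1 and # 1 :+ iᵉ :+ kᵉ == mᵉ)
        or at (# 1 :+ iᵉ == mᵉ) (jᵉ == # 2) (# 1 :+ kᵉ == mᵉ)) p102 (
  node (at (iᵉ == # 0) (jᵉ == # 1) (# 1 :+ kᵉ == mᵉ)
        or ((# 1 =≤ iᵉ and # 3 :+ iᵉ =≤ mᵉ) and iᵉ :+ jᵉ == mᵉ and kᵉ == # 0)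
        or at (# 1 :+ iᵉ == mᵉ) (jᵉ == # 0) (kᵉ == # 1)) p021 (
  node ((iᵉ == # 0 and (# 2 =≤ jᵉ and # 1 :+ jᵉ =≤ mᵉ) and jᵉ :+ kᵉ == mᵉ)
        or at (iᵉ == # 1) (jᵉ == # 0) (# 1 :+ kᵉ == mᵉ)) p210 (
  node (at (# 2 :+ iᵉ == mᵉ) (jᵉ == # 1) (kᵉ == # 1)) p012 (
  node (at (# 2 :+ iᵉ == mᵉ) (jᵉ == # 2) (kᵉ == # 0)) p201 (
  leaf p120)))))
caseY-tree =
  node (at (iᵉ == # 0) (jᵉ == # 0) (kᵉ == # 0)
        or ((# 2 =≤ iᵉ and # 3 :+ iᵉ =≤ mᵉ) and jᵉ == # 1 and # 1 :+ iᵉ :+ kᵉ == mᵉ)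
        or at (# 1 :+ iᵉ == mᵉ) (jᵉ == # 2) (# 1 :+ kᵉ == mᵉ)) p102 (
  node (at (iᵉ == # 0) (jᵉ == # 1) (# 1 :+ kᵉ == mᵉ)
        or ((# 2 =≤ iᵉ and # 3 :+ iᵉ =≤ mᵉ) and iᵉ :+ jᵉ == mᵉ and kᵉ == # 0)
        or at (# 1 :+ iᵉ == mᵉ) (jᵉ == # 0) (kᵉ == # 1)) p021 (
  node ((iᵉ == # 0 and (# 2 =≤ jᵉ and # 1 :+ jᵉ =≤ mᵉ) and jᵉ :+ kᵉ == mᵉ)
        or at (iᵉ == # 1) (jᵉ == # 0) (# 1 :+ kᵉ == mᵉ)
        or (iᵉ == # 1 and (# 2 =≤ jᵉ and # 2 :+ jᵉ =≤ mᵉ) and # 1 :+ jᵉ :+ kᵉ == mᵉ)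
        or at (iᵉ == # 2) (jᵉ == # 0) (# 2 :+ kᵉ == mᵉ)
        or at (iᵉ == # 2) (# 1 :+ jᵉ == mᵉ) (# 1 :+ kᵉ == mᵉ)) p210 (
  node (at (iᵉ == # 1) (jᵉ == # 1) (# 2 :+ kᵉ == mᵉ)
        or at (# 2 :+ iᵉ == mᵉ) (jᵉ == # 1) (kᵉ == # 1)) p012 (
  node (at (iᵉ == # 1) (# 1 :+ jᵉ == mᵉ) (kᵉ == # 0)
        or at (# 2 :+ iᵉ == mᵉ) (jᵉ == # 2) (kᵉ == # 0)) p201 (
  leaf p120)))))

module _ {m i j k : ℕ} (6≤m : 6 ≤ m) (i<m : i < m) (j<m : j < m) where
  private
    below : ∀ {c} → c ≤ 6 → c ≤ m
    below c≤6 = ≤-trans c≤6 6≤m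
    1≤m : 1 ≤ m
    1≤m = below (s≤s z≤n)
    2≤m : 2 ≤ m
    2≤m = below (s≤s (s≤s z≤n))
    3≤m : 3 ≤ m
    3≤m = below (s≤s (s≤s (s≤s z≤n)))

    is : ∀ x y → Reflects (x ≡ y) (x ≡ᵇ y)
    is = ≡ᵇ-reflects
    pt-reflects : ∀ {P Q R : Set} {a b c} → Reflects P a → Reflects Q b → Reflects R c →
                  Reflects (P × Q × R) (a ∧ b ∧ c)
    pt-reflects p q r = p ×-reflects q ×-reflects r
    btw-reflects : ∀ a x c → c ≤ m → Reflects (a ≤ x × c + x ≤ m) (btw a x (m ∸ c))
    btw-reflects a x c c≤m = ≤ᵇ-reflects-≤ a x ×-reflects ≤ᵇ∸-reflects x c≤m

  caseX-represents : Represents (m ∷ i ∷ j ∷ k ∷ []) caseX-tree (caseX m i j k)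
  caseX-represents =
    node (pt-reflects (is i 0) (is j 0) (is k 0)
          ⊎-reflects (btw-reflects 1 i 3 3≤m ×-reflects is j 1 ×-reflects ≡ᵇ∸1∸-reflects k i<m)
          ⊎-reflects pt-reflects (≡ᵇ∸-reflects i 1≤m) (is j 2) (≡ᵇ∸-reflects k 1≤m)) (
    node (pt-reflects (is i 0) (is j 1) (≡ᵇ∸-reflects k 1≤m)
          ⊎-reflects (btw-reflects 1 i 3 3≤m ×-reflects ≡ᵇ∸-reflects j (<⇒≤ i<m) ×-reflects is k 0)
          ⊎-reflects pt-reflects (≡ᵇ∸-reflects i 1≤m) (is j 0) (is k 1)) (
    node ((is i 0 ×-reflects btw-reflects 2 j 1 1≤m ×-reflects ≡ᵇ∸-reflects k (<⇒≤ j<m))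
          ⊎-reflects pt-reflects (is i 1) (is j 0) (≡ᵇ∸-reflects k 1≤m)) (
    node (pt-reflects (≡ᵇ∸-reflects i 2≤m) (is j 1) (is k 1)) (
    node (pt-reflects (≡ᵇ∸-reflects i 2≤m) (is j 2) (is k 0)) (
    leaf p120)))))

  caseY-represents : Represents (m ∷ i ∷ j ∷ k ∷ []) caseY-tree (caseY m i j k)
  caseY-represents =
    node (pt-reflects (is i 0) (is j 0) (is k 0)
          ⊎-reflects (btw-reflects 2 i 3 3≤m ×-reflects is j 1 ×-reflects ≡ᵇ∸1∸-reflects k i<m)
          ⊎-reflects pt-reflects (≡ᵇ∸-reflects i 1≤m) (is j 2) (≡ᵇ∸-reflects k 1≤m)) (
    node (pt-reflects (is i 0) (is j 1) (≡ᵇ∸-reflects k 1≤m)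
          ⊎-reflects (btw-reflects 2 i 3 3≤m ×-reflects ≡ᵇ∸-reflects j (<⇒≤ i<m) ×-reflects is k 0)
          ⊎-reflects pt-reflects (≡ᵇ∸-reflects i 1≤m) (is j 0) (is k 1)) (
    node ((is i 0 ×-reflects btw-reflects 2 j 1 1≤m ×-reflects ≡ᵇ∸-reflects k (<⇒≤ j<m))
          ⊎-reflects pt-reflects (is i 1) (is j 0) (≡ᵇ∸-reflects k 1≤m)
          ⊎-reflects (is i 1 ×-reflects btw-reflects 2 j 2 2≤m ×-reflects ≡ᵇ∸1∸-reflects k j<m)
          ⊎-reflects pt-reflects (is i 2) (is j 0) (≡ᵇ∸-reflects k 2≤m)
          ⊎-reflects pt-reflects (is i 2) (≡ᵇ∸-reflects j 1≤m) (≡ᵇ∸-reflects k 1≤m)) (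
    node (pt-reflects (is i 1) (is j 1) (≡ᵇ∸-reflects k 2≤m)
          ⊎-reflects pt-reflects (≡ᵇ∸-reflects i 2≤m) (is j 1) (is k 1)) (
    node (pt-reflects (is i 1) (≡ᵇ∸-reflects j 1≤m) (is k 0)
          ⊎-reflects pt-reflects (≡ᵇ∸-reflects i 2≤m) (is j 2) (is k 0)) (
    leaf p120)))))

-- Return maps to a slice

axis₁ axis₂ : Fin 3 → Fin 3
axis₁ 0F = 1F
axis₁ 1F = 0F
axis₁ 2F = 0F
axis₂ 0F = 2F
axis₂ 1F = 2F
axis₂ 2F = 1F

bump : {A : Set} → (A → A) → Fin 3 → (Fin 3 → A) → Fin 3 → A
bump s 0F g 0F = s (g 0F)
bump s 1F g 1F = s (g 1F)
bump s 2F g 2F = s (g 2F)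
bump s _  g e  = g e

coords : ∀ {m} → V m → Fin 3 → ℕ
coords (i , j , k) 0F = toℕ i
coords (i , j , k) 1F = toℕ j
coords (i , j , k) 2F = toℕ k

module Residues (m : ℕ) .{{_ : NonZero m}} where

  %-idem-+ˡ : ∀ a b → (a % m + b) % m ≡ (a + b) % m
  %-idem-+ˡ a b = trans (%-distribˡ-+ (a % m) b m)
    (trans (cong (λ r → (r + b % m) % m) (m%n%n≡m%n a m)) (sym (%-distribˡ-+ a b m)))

  %-idem-suc : ∀ a → suc (a % m) % m ≡ suc a % m
  %-idem-suc a = trans (cong (_% m) (+-comm 1 (a % m))) (trans (%-idem-+ˡ a 1) (cong (_% m) (+-comm a 1)))

  toℕ-inc : ∀ x → toℕ (inc m x) ≡ suc (toℕ x) % m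
  toℕ-inc x = toℕ-fromℕ< (m%n<n (suc (toℕ x)) m)

  m+k%m : ∀ k → (m + k) % m ≡ k % m
  m+k%m k = trans (cong (_% m) (+-comm m k)) ([m+n]%n≡m%n k m)

  -- The values of g are representatives that are never reduced modulo m. A step adds 1 to one of
  -- them even across the edge, so the symbolic coordinates stay linear.
  coords-step : ∀ d v g → (∀ e → coords v e ≡ g e % m) → ∀ e → coords (step m d v) e ≡ bump suc d g e % m
  coords-step d v g h = go d
    where
    next : ∀ x {a} → toℕ x ≡ a % m → toℕ (inc m x) ≡ suc a % m
    next x {a} e = trans (toℕ-inc x) (trans (cong (λ y → suc y % m) e) (%-idem-suc a))
    go : ∀ d e → coords (step m d v) e ≡ bump suc d g e % m
    go 0F 0F = next _ (h 0F)
    go 0F 1F = h 1F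
    go 0F 2F = h 2F
    go 1F 0F = h 0F
    go 1F 1F = next _ (h 1F)
    go 1F 2F = h 2F
    go 2F 0F = h 0F
    go 2F 1F = h 1F
    go 2F 2F = next _ (h 2F)

  coords<m : ∀ v e → coords {m} v e < m
  coords<m (i , j , k) 0F = toℕ<n i
  coords<m (i , j , k) 1F = toℕ<n j
  coords<m (i , j , k) 2F = toℕ<n k

  total : V m → ℕ
  total v = coords v 0F + coords v 1F + coords v 2F

  total-split : ∀ c v → total v ≡ coords v c + (coords v (axis₁ c) + coords v (axis₂ c))
  total-split 0F (i , j , k) = +-assoc (toℕ i) (toℕ j) (toℕ k)
  total-split 1F (i , j , k) = trans (cong (_+ toℕ k) (+-comm (toℕ i) (toℕ j))) (+-assoc (toℕ j) (toℕ i) (toℕ k))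
  total-split 2F (i , j , k) = +-comm (toℕ i + toℕ j) (toℕ k)

  own-step-first : ∀ c v → coords (step m c v) (axis₁ c) ≡ coords v (axis₁ c)
  own-step-first 0F v = refl
  own-step-first 1F v = refl
  own-step-first 2F v = refl

  own-step-second : ∀ c v → coords (step m c v) (axis₂ c) ≡ coords v (axis₂ c)
  own-step-second 0F v = refl
  own-step-second 1F v = refl
  own-step-second 2F v = refl

  S : V m → ℕ
  S v = total v % m

  S-step : ∀ d v → S (step m d v) ≡ suc (S v) % m
  S-step d (i , j , k) = trans (go d) (sym (%-idem-suc (toℕ i + toℕ j + toℕ k)))
    where
    go : ∀ d → S (step m d (i , j , k)) ≡ suc (toℕ i + toℕ j + toℕ k) % m
    go 0F = begin
      (toℕ (inc m i) + toℕ j + toℕ k) % m        ≡⟨ cong (λ x → (x + toℕ j + toℕ k) % m) (toℕ-inc i) ⟩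
      (suc (toℕ i) % m + toℕ j + toℕ k) % m      ≡⟨ cong (_% m) (+-assoc (suc (toℕ i) % m) (toℕ j) (toℕ k)) ⟩
      (suc (toℕ i) % m + (toℕ j + toℕ k)) % m    ≡⟨ %-idem-+ˡ (suc (toℕ i)) (toℕ j + toℕ k) ⟩
      suc (toℕ i + (toℕ j + toℕ k)) % m          ≡⟨ cong (λ x → suc x % m) (sym (+-assoc (toℕ i) (toℕ j) (toℕ k))) ⟩
      suc (toℕ i + toℕ j + toℕ k) % m            ∎
      where open ≡-Reasoning
    go 1F = begin
      (toℕ i + toℕ (inc m j) + toℕ k) % m        ≡⟨ cong (λ x → (toℕ i + x + toℕ k) % m) (toℕ-inc j) ⟩
      (toℕ i + suc (toℕ j) % m + toℕ k) % m      ≡⟨ cong (λ x → (x + toℕ k) % m) (+-comm (toℕ i) _) ⟩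
      (suc (toℕ j) % m + toℕ i + toℕ k) % m      ≡⟨ cong (_% m) (+-assoc (suc (toℕ j) % m) (toℕ i) (toℕ k)) ⟩
      (suc (toℕ j) % m + (toℕ i + toℕ k)) % m    ≡⟨ %-idem-+ˡ (suc (toℕ j)) (toℕ i + toℕ k) ⟩
      suc (toℕ j + (toℕ i + toℕ k)) % m          ≡⟨ cong (λ x → suc x % m) (sym (+-assoc (toℕ j) (toℕ i) (toℕ k))) ⟩
      suc (toℕ j + toℕ i + toℕ k) % m            ≡⟨ cong (λ x → suc (x + toℕ k) % m) (+-comm (toℕ j) (toℕ i)) ⟩
      suc (toℕ i + toℕ j + toℕ k) % m            ∎
      where open ≡-Reasoning
    go 2F = begin
      (toℕ i + toℕ j + toℕ (inc m k)) % m        ≡⟨ cong (λ x → (toℕ i + toℕ j + x) % m) (toℕ-inc k) ⟩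
      (toℕ i + toℕ j + suc (toℕ k) % m) % m      ≡⟨ cong (_% m) (+-comm (toℕ i + toℕ j) _) ⟩
      (suc (toℕ k) % m + (toℕ i + toℕ j)) % m    ≡⟨ %-idem-+ˡ (suc (toℕ k)) (toℕ i + toℕ j) ⟩
      suc (toℕ k + (toℕ i + toℕ j)) % m          ≡⟨ cong (λ x → suc x % m) (+-comm (toℕ k) (toℕ i + toℕ j)) ⟩
      suc (toℕ i + toℕ j + toℕ k) % m            ∎
      where open ≡-Reasoning

-- Symbolic computation of the m-fold iterate of f_c on the slice S = 0.  The vertex is known through its two
-- coordinates a, b in the directions other than c; the remaining one is t·m − a − b with t ∈ {0,1,2}.
m-form a-form b-form : Form
m-form = form (var 0)
a-form = form (var 1)
b-form = form (var 2)

own-form : ℕ → Form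
own-form t = (+ t) ⊡ m-form ⊟ (a-form ⊞ b-form)

start-forms : Fin 3 → ℕ → Fin 3 → Form
start-forms 0F t 0F = own-form t
start-forms 0F t 1F = a-form
start-forms 0F t 2F = b-form
start-forms 1F t 0F = a-form
start-forms 1F t 1F = own-form t
start-forms 1F t 2F = b-form
start-forms 2F t 0F = a-form
start-forms 2F t 1F = b-form
start-forms 2F t 2F = own-form t

bump-form : Form → Form
bump-form f = f ⊞ constant 1ℤ

-- On S = 1 and S = 2 the tables ask whether a coordinate vanishes modulo m. It was below m on S = 0
-- and has grown by at most 2 since, so it is 0, m, strictly between these, or strictly between m
-- and 2m.
zero-residue : List Form → Form → Maybe Bool
zero-residue Γ f =
  if entails Γ (opposite f) then just true else
  if entails-all Γ (f ⊟ m-form ∷ m-form ⊟ f ∷ []) then just true else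
  if entails-all Γ (f ⊟ constant 1ℤ ∷ m-form ⊟ bump-form f ∷ []) then just false else
  if entails-all Γ (f ⊟ bump-form m-form ∷ (+ 2) ⊡ m-form ⊟ bump-form f ∷ []) then just false else
  nothing

slice1 slice2 : Bool → Triple
slice1 z = if z then p102 else p201
slice2 z = if z then p210 else p012

-- Displacements are compared before reduction: at (0 , m - 1) colour 0 has shift (0 , 3) and lands
-- at b = m + 2. Returning below m is a separate move.
lands : List Form → Fin 3 → ℕ → ℕ → (Fin 3 → Form) → Bool
lands Γ c da db G =
  entails-all Γ (G (axis₁ c) ⊟ A ∷ A ⊟ G (axis₁ c) ∷ G (axis₂ c) ⊟ B ∷ B ⊟ G (axis₂ c) ∷ [])
  where
  A = a-form ⊞ constant (+ da)
  B = b-form ⊞ constant (+ db)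

-- A test that Γ does not settle is harmless if both outcomes lead to the same displacement.
either : Maybe Bool → (Bool → Bool) → Bool
either nothing check = check true ∧ check false
either (just z) check = check z

moves2 moves1 : List Form → Fin 3 → ℕ → ℕ → (Fin 3 → Form) → Bool → Bool
moves2 Γ c da db G z = lands Γ c da db (bump bump-form (d (slice2 z) c) G)
moves1 Γ c da db G z = either (zero-residue Γ (G′ 1F)) (moves2 Γ c da db G′)
  where G′ = bump bump-form (d (slice1 z) c) G

moves0 : List Form → Fin 3 → ℕ → ℕ → (Fin 3 → Form) → Maybe (Fin 3) → Bool
moves0 Γ c da db G nothing = false
moves0 Γ c da db G (just e) = either (zero-residue Γ (G′ 0F)) (moves1 Γ c da db G′)
  where G′ = bump bump-form e G

triple-forms : (Fin 3 → Form) → List Form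
triple-forms G = m-form ∷ G 0F ∷ G 1F ∷ G 2F ∷ []

own-bounds : ℕ → List Form
own-bounds t = own-form t ∷ m-form ⊟ bump-form (own-form t) ∷ []

moves-under : Tree → Fin 3 → List Form → ℕ → ℕ → ℕ → Bool
moves-under tree c Γ da db t = if refutes Γ then true else
  moves0 Γ c da db (start-forms c t) (follow c Γ (triple-forms (start-forms c t)) tree)

-- The case distinction on whether the remaining coordinate vanishes lets a region cross the line i = 0.
moves-with : Tree → Fin 3 → List Form → ℕ → ℕ → ℕ → Bool
moves-with tree c Γ da db t =
  moves-under tree c (opposite (own-form t) ∷ own-bounds t ++ Γ) da db t ∧
  moves-under tree c ((own-form t ⊟ constant 1ℤ) ∷ own-bounds t ++ Γ) da db t

region-forms : List Atom → List Form
region-forms as = forms (var 1 :< var 0 ∷ var 2 :< var 0 ∷ as)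

moves-all : Tree → Fin 3 → ℕ → ℕ → List Form → Bool
moves-all tree c da db Γ = moves-with tree c Γ da db 0 ∧ moves-with tree c Γ da db 1 ∧ moves-with tree c Γ da db 2

-- Cuts make it possible to treat a region that is covered by several guards but contained in none of them.
cut : List (Expr × Expr) → (List Form → Bool) → List Form → Bool
cut [] check Γ = check Γ
cut ((x , y) ∷ cs) check Γ =
  cut cs check (forms (x :< y ∷ []) ++ Γ) ∧ cut cs check (forms (y :≤ x ∷ []) ++ Γ)

moves : Tree → Fin 3 → List Atom → List (Expr × Expr) → ℕ → ℕ → Bool
moves tree c as cs da db = cut cs (moves-all tree c da db) (form (var 0) ⊟ constant (+ 6) ∷ region-forms as)

-- Rules, moves and paths

m̂ â b̂ : Expr
m̂ = var 0
â = var 1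
b̂ = var 2

at-origin : List Atom
at-origin = â :≡ # 0 ∷ b̂ :≡ # 0 ∷ []

record Rule (tree : Tree) (c : Fin 3) : Set where
  constructor rule
  field
    atoms : List Atom
    cuts  : List (Expr × Expr)
    Δ₁ Δ₂ : ℕ
    ok    : moves tree c atoms cuts Δ₁ Δ₂ ≡ true

-- Regions demand a, b < m, while displacements may overshoot. A wrap subtracts m and changes the
-- representative only, not the vertex.
data Move (tree : Tree) (c : Fin 3) : Set where
  go : Form → Rule tree c → Move tree c
  wrap₁ wrap₂ : Move tree c

slope : Form → ℕ → ℕ → ℤ
slope g p q = dot g (0ℤ ∷ 0ℤ ∷ + p ∷ + q ∷ [])

-- A linear constraint holds along a segment of N points if it holds at the end where it is smallest.
smallest : Form → Form → ℤ → Form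
smallest N g₀ (+ _) = g₀
smallest N g₀ s = g₀ ⊞ s ⊡ (N ⊟ constant 1ℤ)

along : List Form → Form → Form → Form → ℕ → ℕ → List Form → Bool
along Γ N A B p q [] = true
along Γ N A B p q (g ∷ gs) =
  entails Γ (smallest N (substitute (m-form ∷ A ∷ B ∷ []) g) (slope g p q)) ∧ along Γ N A B p q gs

reaches : ∀ {tree c} → List Form → Form → Form → List (Move tree c) → Form → Form → Bool
reaches Γ A B [] A′ B′ = entails-all Γ (A ⊟ A′ ∷ A′ ⊟ A ∷ B ⊟ B′ ∷ B′ ⊟ B ∷ [])
reaches Γ A B (go N (rule as _ p q _) ∷ cs) A′ B′ =
  entails Γ N ∧
  -- The region matters only if the segment has a point, so N ≥ 1 is assumed here; N = 0 does occur
  -- for small parameters.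
  along (N ⊟ constant 1ℤ ∷ Γ) N A B p q (region-forms as) ∧
  reaches Γ (A ⊞ (+ p) ⊡ N) (B ⊞ (+ q) ⊡ N) cs A′ B′
reaches Γ A B (wrap₁ ∷ cs) A′ B′ = entails Γ (A ⊟ m-form) ∧ reaches Γ (A ⊟ m-form) B cs A′ B′
reaches Γ A B (wrap₂ ∷ cs) A′ B′ = entails Γ (B ⊟ m-form) ∧ reaches Γ A (B ⊟ m-form) cs A′ B′

-- Variable 0 of every expression in a path is m.
record Path (tree : Tree) (c : Fin 3) : Set where
  constructor path
  field
    hypotheses : List Atom
    source     : Expr × Expr
    route      : List (Move tree c)
    target     : Expr × Expr

checked : ∀ {tree c} → Path tree c → Bool
checked (path Γ (a , b) cs (a′ , b′)) =
  reaches (form (var 0) ⊟ constant (+ 6) ∷ forms Γ) (form a) (form b) cs (form a′) (form b′)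

-- Soundness of the symbolic computation

Tracks : List ℤ → (Fin 3 → ℕ) → (Fin 3 → Form) → Set
Tracks ρ g G = ∀ e → eval ρ (G e) ≡ + g e

eval-bump : ∀ ρ f {n} → eval ρ f ≡ + n → eval ρ (bump-form f) ≡ + suc n
eval-bump ρ f {n} e rewrite eval-⊞ ρ f (constant 1ℤ) | e | eval-constant ρ 1ℤ = cong +_ (+-comm n 1)

bump-tracks : ∀ {ρ g G} d → Tracks ρ g G → Tracks ρ (bump suc d g) (bump bump-form d G)
bump-tracks {ρ} {g} {G} 0F h 0F = eval-bump ρ (G 0F) (h 0F)
bump-tracks 0F h 1F = h 1F
bump-tracks 0F h 2F = h 2F
bump-tracks 1F h 0F = h 0F
bump-tracks {ρ} {g} {G} 1F h 1F = eval-bump ρ (G 1F) (h 1F)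
bump-tracks 1F h 2F = h 2F
bump-tracks 2F h 0F = h 0F
bump-tracks 2F h 1F = h 1F
bump-tracks {ρ} {g} {G} 2F h 2F = eval-bump ρ (G 2F) (h 2F)

⊟-+ : ∀ ρ f g → Holds ρ (g ⊟ f) → ∀ {k l} → eval ρ f ≡ + k → eval ρ g ≡ + l → k ≤ l
⊟-+ ρ f g h e₁ e₂ = ℤₚ.drop‿+≤+ (subst₂ ℤ._≤_ e₁ e₂ (holds-⊟ ρ f g h))

+-⊟ : ∀ ρ f g {k l} → eval ρ f ≡ + k → eval ρ g ≡ + l → k ≤ l → Holds ρ (g ⊟ f)
+-⊟ ρ f g e₁ e₂ h = ⊟-holds ρ f g (subst₂ ℤ._≤_ (sym e₁) (sym e₂) (+≤+ h))

module Dynamics (m : ℕ) .{{_ : NonZero m}} (6≤m : 6 ≤ m) (c : Fin 3) (tree : Tree)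
  (represents : ∀ {i j k} → i < m → j < m → k < m →
    Represents (m ∷ i ∷ j ∷ k ∷ []) tree (if (m % 6) ≡ᵇ 4 then caseY m i j k else caseX m i j k)) where

  open Residues m

  -- The slice is made an argument of `routeE`, so that a known value of S selects the branch by
  -- computation.
  route : ℕ → ℕ → ℕ → ℕ → Triple
  route s i j k =
    if s ≡ᵇ 1 then (if i ≡ᵇ 0 then p102 else p201) else
    if s ≡ᵇ 2 then (if j ≡ᵇ 0 then p210 else p012) else
    if s ≡ᵇ 0 then (if (m % 6) ≡ᵇ 4 then caseY m i j k else caseX m i j k) else
    p012

  f-step : ∀ v {s} → S v ≡ s → ∀ {e} → d (route s (coords v 0F) (coords v 1F) (coords v 2F)) c ≡ e → f m c v ≡ step m e v
  f-step v@(_ , _ , _) refl refl = refl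

  0<m : 0 < m
  0<m = ≤-trans (s≤s z≤n) 6≤m

  root : V m
  root = fromℕ< 0<m , fromℕ< 0<m , fromℕ< 0<m

  Reached : V m → Set
  Reached v = ∃ λ n → iter (f m c) n root ≡ v

  advance : ∀ {v w} → f m c v ≡ w → Reached v → Reached w
  advance e (n , h) = suc n , trans (cong (f m c) h) e

  -- Slice and two coordinates determine a vertex, so this says that one particular vertex is
  -- reached. The numbers a and b are arbitrary representatives, which makes wrapping a mere
  -- congruence.
  record At (s a b : ℕ) : Set where
    constructor located
    field
      vertex  : V m
      reached : Reached vertex
      slice   : S vertex ≡ s
      first   : coords vertex (axis₁ c) ≡ a % m
      second  : coords vertex (axis₂ c) ≡ b % m

  S-next : ∀ {v s} e → S v ≡ s → suc s < m → S (step m e v) ≡ suc s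
  S-next {v} e h lt = trans (S-step e v) (trans (cong (λ s → suc s % m) h) (m<n⇒m%n≡m lt))

  rest-step : ∀ {s a b} → At (3 + s) a b → At (suc (3 + s) % m) a b
  rest-step (located v r sl p q) = located (step m c v) (advance (f-step v sl refl) r)
    (trans (S-step c v) (cong (λ s → suc s % m) sl))
    (trans (own-step-first c v) p) (trans (own-step-second c v) q)

  -- From S = 3 to S = 0 colour c only moves in direction c, so (a , b) is the same on all these slices.
  climb : ∀ {a b} s → 3 + s < m → At 3 a b → At (3 + s) a b
  climb zero lt r = r
  climb (suc s) lt r = subst (λ s → At s _ _) (m<n⇒m%n≡m lt) (rest-step (climb s (<-trans (n<1+n _) lt) r))

  return : ∀ {a b} → At 3 a b → At 0 a b
  -- The climb of m - 4 steps ends at S = m - 1; one more step of the same kind closes the round at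
  -- S = 0.
  return {a} {b} r = subst (λ s → At s a b) last (rest-step (climb (m ∸ 4) lt r))
    where
    eq′ : suc (3 + (m ∸ 4)) ≡ m
    eq′ = m+[n∸m]≡n (≤-trans (s≤s (s≤s (s≤s (s≤s z≤n)))) 6≤m)
    lt : 3 + (m ∸ 4) < m
    lt = ≤-reflexive eq′
    last : suc (3 + (m ∸ 4)) % m ≡ 0
    last = trans (cong (_% m) eq′) (n%n≡0 m)

  module _ {a b : ℕ} where
    private
      ρ : List ℤ
      ρ = ι (m ∷ a ∷ b ∷ [])

      eval-m : eval ρ m-form ≡ + m
      eval-m = eval-form (m ∷ a ∷ b ∷ []) (var 0)
      eval-a : eval ρ a-form ≡ + a
      eval-a = eval-form (m ∷ a ∷ b ∷ []) (var 1)
      eval-b : eval ρ b-form ≡ + b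
      eval-b = eval-form (m ∷ a ∷ b ∷ []) (var 2)

      non-negative : NonNegative ρ
      non-negative = nonnegative-ι (m ∷ a ∷ b ∷ [])

    eval-own : ∀ {x} t → x + (a + b) ≡ t * m → eval ρ (own-form t) ≡ + x
    eval-own {x} t h rewrite eval-⊟ ρ ((+ t) ⊡ m-form) (a-form ⊞ b-form) | eval-⊡ ρ (+ t) m-form
      | eval-⊞ ρ a-form b-form | eval-m | eval-a | eval-b | sym (ℤₚ.pos-* t m) | sym h =
      trans (ℤₚ.[+m]-[+n]≡m⊖n (x + (a + b)) (a + b))
        (trans (ℤₚ.⊖-≥ (m≤n+m (a + b) x)) (cong +_ (m+n∸n≡m x (a + b))))

    module _ {Γ : List Form} (hyp : All (Holds ρ) Γ) where

      entailed : ∀ fs → entails-all Γ fs ≡ true → All (Holds ρ) fs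
      entailed fs e = entails-all-sound ρ Γ fs non-negative e hyp

      zero-residue-sound : ∀ h {n} z → eval ρ h ≡ + n → zero-residue Γ h ≡ just z → (n % m ≡ᵇ 0) ≡ z
      zero-residue-sound h {n} z eh e with entails Γ (opposite h) in e₁
      zero-residue-sound h {n} z eh refl | true = subst (λ n → (n % m ≡ᵇ 0) ≡ true) (sym n≡0) (cong (_≡ᵇ 0) (m<n⇒m%n≡m 0<m))
        where
        n≡0 : n ≡ 0
        n≡0 = n≤0⇒n≡0 (ℤₚ.drop‿+≤+ (ℤₚ.neg-cancel-≤ (subst (0ℤ ℤ.≤_) (trans (eval-opposite ρ h) (cong ℤ.-_ eh))
          (entails-sound ρ Γ (opposite h) non-negative e₁ hyp))))
      ... | false with entails-all Γ (h ⊟ m-form ∷ m-form ⊟ h ∷ []) in e₂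
      zero-residue-sound h {n} z eh refl | false | true with entailed (h ⊟ m-form ∷ m-form ⊟ h ∷ []) e₂
      ... | p ∷ q ∷ [] = subst (λ n → (n % m ≡ᵇ 0) ≡ true)
        (≤-antisym (⊟-+ ρ m-form h p eval-m eh) (⊟-+ ρ h m-form q eh eval-m)) (cong (_≡ᵇ 0) (n%n≡0 m))
      zero-residue-sound h {n} z eh e | false | false
        with entails-all Γ (h ⊟ constant 1ℤ ∷ m-form ⊟ bump-form h ∷ []) in e₃
      zero-residue-sound h {n} z eh refl | false | false | true with entailed (h ⊟ constant 1ℤ ∷ m-form ⊟ bump-form h ∷ []) e₃
      ... | p ∷ q ∷ [] with n | ⊟-+ ρ (constant 1ℤ) h p (eval-constant ρ 1ℤ) eh | ⊟-+ ρ (bump-form h) m-form q (eval-bump ρ h eh) eval-m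
      ...   | suc n′ | _ | lt = cong (_≡ᵇ 0) (m<n⇒m%n≡m lt)
      zero-residue-sound h {n} z eh e | false | false | false
        with entails-all Γ (h ⊟ bump-form m-form ∷ (+ 2) ⊡ m-form ⊟ bump-form h ∷ []) in e₄
      zero-residue-sound h {n} z eh refl | false | false | false | true with entailed (h ⊟ bump-form m-form ∷ (+ 2) ⊡ m-form ⊟ bump-form h ∷ []) e₄
      ... | p ∷ q ∷ [] = beyond
        (⊟-+ ρ (bump-form m-form) h p (eval-bump ρ m-form eval-m) eh)
        (⊟-+ ρ (bump-form h) ((+ 2) ⊡ m-form) q (eval-bump ρ h eh)
          (trans (eval-⊡ ρ (+ 2) m-form) (trans (cong (+ 2 ℤ.*_) eval-m) (sym (ℤₚ.pos-* 2 m)))))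
        where
        beyond : ∀ {n} → m < n → n < 2 * m → (n % m ≡ᵇ 0) ≡ false
        beyond {n} m<n n<2m with n ∸ m in eq | m+[n∸m]≡n (<⇒≤ m<n)
        ... | zero | h = ⊥-elim (<-irrefl (trans (sym (+-identityʳ m)) h) m<n)
        ... | suc k | refl = cong (_≡ᵇ 0) (trans (m+k%m (suc k)) (m<n⇒m%n≡m
          (+-cancelˡ-< m (suc k) m (subst (λ y → m + suc k < y) (cong (λ y → m + y) (+-identityʳ m)) n<2m))))

      lands-sound : ∀ {v g G} p q → Tracks ρ g G → lands Γ c p q G ≡ true → (∀ e → coords v e ≡ g e % m) →
                    Reached v → S v ≡ 3 → At 3 (a + p) (b + q)
      lands-sound {v} {g} {G} p q tr e h r sl with entailed (G (axis₁ c) ⊟ (a-form ⊞ constant (+ p)) ∷ (a-form ⊞ constant (+ p)) ⊟ G (axis₁ c) ∷ G (axis₂ c) ⊟ (b-form ⊞ constant (+ q)) ∷ (b-form ⊞ constant (+ q)) ⊟ G (axis₂ c) ∷ []) e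
      ... | h₁ ∷ h₂ ∷ h₃ ∷ h₄ ∷ [] = located v r sl
        (trans (h (axis₁ c)) (cong (_% m) (equal (axis₁ c) (a-form ⊞ constant (+ p)) (shifted a-form eval-a p) h₁ h₂)))
        (trans (h (axis₂ c)) (cong (_% m) (equal (axis₂ c) (b-form ⊞ constant (+ q)) (shifted b-form eval-b q) h₃ h₄)))
        where
        shifted : ∀ f {n} → eval ρ f ≡ + n → ∀ p → eval ρ (f ⊞ constant (+ p)) ≡ + (n + p)
        shifted f e p rewrite eval-⊞ ρ f (constant (+ p)) | e | eval-constant ρ (+ p) = refl
        equal : ∀ s f {n} → eval ρ f ≡ + n → Holds ρ (G s ⊟ f) → Holds ρ (f ⊟ G s) → g s ≡ n
        equal s f e h₁ h₂ = ≤-antisym (⊟-+ ρ (G s) f h₂ (tr s) e) (⊟-+ ρ f (G s) h₁ e (tr s))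

      either-sound : ∀ h {n} check → eval ρ h ≡ + n → either (zero-residue Γ h) check ≡ true → check (n % m ≡ᵇ 0) ≡ true
      either-sound h {n} check eh e with zero-residue Γ h in eq
      ... | just z = subst (λ z → check z ≡ true) (sym (zero-residue-sound h z eh eq)) e
      ... | nothing with n % m ≡ᵇ 0
      ...   | true = ∧-conicalˡ _ _ e
      ...   | false = ∧-conicalʳ (check true) _ e

      moves2-sound : ∀ {v g G} p q → Tracks ρ g G → moves2 Γ c p q G (g 1F % m ≡ᵇ 0) ≡ true →
                     (∀ e → coords v e ≡ g e % m) → Reached v → S v ≡ 2 → At 3 (a + p) (b + q)
      moves2-sound {v} {g} {G} p q tr e h r sl =
        lands-sound {step m dir v} {bump suc dir g} {bump bump-form dir G} p q (bump-tracks {ρ} {g} {G} dir tr) e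
          (coords-step dir v g h) (advance (f-step v sl eq) r)
          (S-next {v = v} dir sl (≤-trans (s≤s (s≤s (s≤s (s≤s z≤n)))) 6≤m))
        where
        dir = d (slice2 (g 1F % m ≡ᵇ 0)) c
        eq : d (route 2 (coords v 0F) (coords v 1F) (coords v 2F)) c ≡ dir
        eq rewrite h 1F = refl

      moves1-sound : ∀ {v g G} p q → Tracks ρ g G → moves1 Γ c p q G (g 0F % m ≡ᵇ 0) ≡ true →
                     (∀ e → coords v e ≡ g e % m) → Reached v → S v ≡ 1 → At 3 (a + p) (b + q)
      moves1-sound {v} {g} {G} p q tr e h r sl =
        moves2-sound {step m dir v} {bump suc dir g} {G′} p q tr′ (either-sound (G′ 1F) (moves2 Γ c p q G′) (tr′ 1F) e)
          (coords-step dir v g h) (advance (f-step v sl eq) r)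
          (S-next {v = v} dir sl (≤-trans (s≤s (s≤s (s≤s z≤n))) 6≤m))
        where
        dir = d (slice1 (g 0F % m ≡ᵇ 0)) c
        G′ = bump bump-form dir G
        tr′ = bump-tracks {ρ} {g} {G} dir tr
        eq : d (route 1 (coords v 0F) (coords v 1F) (coords v 2F)) c ≡ dir
        eq rewrite h 0F = refl

      moves-under-sound : ∀ {v} p q t → Tracks ρ (coords v) (start-forms c t) →
                          moves-under tree c Γ p q t ≡ true → Reached v → S v ≡ 0 → At 3 (a + p) (b + q)
      moves-under-sound {v} p q t tr e r sl with refutes Γ in eq
      ... | true = ⊥-elim (refutes-sound ρ Γ non-negative eq hyp)
      ... | false with follow c Γ (triple-forms (start-forms c t)) tree in eq′
      ...   | just dir = moves1-sound {step m dir v} {bump suc dir (coords v)} {G′} p q tr′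
        (either-sound (G′ 0F) (moves1 Γ c p q G′) (tr′ 0F) e)
        (coords-step dir v (coords v) (λ s → sym (m<n⇒m%n≡m (coords<m v s))))
        (advance (f-step v sl direction) r) (S-next {v = v} dir sl (≤-trans (s≤s (s≤s z≤n)) 6≤m))
        where
        G′ = bump bump-form dir (start-forms c t)
        tr′ = bump-tracks {ρ} {coords v} {start-forms c t} dir tr
        inst : Instance ρ (triple-forms (start-forms c t)) (m ∷ coords v 0F ∷ coords v 1F ∷ coords v 2F ∷ [])
        inst = cong₂ _∷_ eval-m (cong₂ _∷_ (tr 0F) (cong₂ _∷_ (tr 1F) (cong₂ _∷_ (tr 2F) refl)))
        direction = follow-sound non-negative inst hyp c tree dir
          (represents (coords<m v 0F) (coords<m v 1F) (coords<m v 2F)) eq′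

    start-tracks : ∀ v t {x} → coords v c ≡ x → coords v (axis₁ c) ≡ a → coords v (axis₂ c) ≡ b →
                   x + (a + b) ≡ t * m → Tracks ρ (coords {m} v) (start-forms c t)
    start-tracks v t refl p q h = cases c refl
      where
      own = eval-own {coords v c} t h
      cases : ∀ c′ → c ≡ c′ → Tracks ρ (coords v) (start-forms c t)
      cases 0F refl 0F = own
      cases 0F refl 1F = trans eval-a (cong +_ (sym p))
      cases 0F refl 2F = trans eval-b (cong +_ (sym q))
      cases 1F refl 0F = trans eval-a (cong +_ (sym p))
      cases 1F refl 1F = own
      cases 1F refl 2F = trans eval-b (cong +_ (sym q))
      cases 2F refl 0F = trans eval-a (cong +_ (sym p))
      cases 2F refl 1F = trans eval-b (cong +_ (sym q))
      cases 2F refl 2F = own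

    moves-with-sound : ∀ {Γ v} p q t → All (Holds ρ) Γ → coords v (axis₁ c) ≡ a → coords v (axis₂ c) ≡ b →
                       coords v c + (a + b) ≡ t * m → moves-with tree c Γ p q t ≡ true →
                       Reached v → S v ≡ 0 → At 3 (a + p) (b + q)
    moves-with-sound {Γ} {v} p q t hyp ea eb h e r sl = by-own (coords v c) refl
      where
      own : eval ρ (own-form t) ≡ + coords v c
      own = eval-own t h
      bounds : All (Holds ρ) (own-bounds t ++ Γ)
      bounds = subst (0ℤ ℤ.≤_) (sym own) (+≤+ z≤n)
        ∷ +-⊟ ρ (bump-form (own-form t)) m-form (eval-bump ρ (own-form t) own) eval-m (coords<m v c) ∷ hyp
      tr = start-tracks v t refl ea eb h
      by-own : ∀ x → coords v c ≡ x → At 3 (a + p) (b + q)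
      by-own zero ex = moves-under-sound
        (subst (0ℤ ℤ.≤_) (sym (trans (eval-opposite ρ (own-form t)) (cong ℤ.-_ (trans own (cong +_ ex))))) (+≤+ z≤n) ∷ bounds)
        {v = v} p q t tr (∧-conicalˡ _ _ e) r sl
      by-own (suc x) ex = moves-under-sound
        (+-⊟ ρ (constant 1ℤ) (own-form t) (eval-constant ρ 1ℤ) (trans own (cong +_ ex)) (s≤s z≤n) ∷ bounds)
        {v = v} p q t tr (∧-conicalʳ (moves-under tree c _ p q t) _ e) r sl

    cut-sound : ∀ cs check Γ → cut cs check Γ ≡ true → All (Holds ρ) Γ →
                ∃[ Γ′ ] check Γ′ ≡ true × All (Holds ρ) Γ′
    cut-sound [] check Γ e hyp = Γ , e , hyp
    cut-sound ((x , y) ∷ cs) check Γ e hyp with <-≤-connex (⟦ x ⟧ (m ∷ a ∷ b ∷ [])) (⟦ y ⟧ (m ∷ a ∷ b ∷ []))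
    ... | inj₁ lt = cut-sound cs check (forms (x :< y ∷ []) ++ Γ) (∧-conicalˡ _ _ e)
      (++⁺ (forms-hold (m ∷ a ∷ b ∷ []) (x :< y ∷ []) lt) hyp)
    ... | inj₂ ge = cut-sound cs check (forms (y :≤ x ∷ []) ++ Γ)
      (∧-conicalʳ (cut cs check (forms (x :< y ∷ []) ++ Γ)) _ e)
      (++⁺ (forms-hold (m ∷ a ∷ b ∷ []) (y :≤ x ∷ []) ge) hyp)

    apply-rule : (R : Rule tree c) → All (Holds ρ) (region-forms (Rule.atoms R)) → At 0 a b →
                 At 3 (a + Rule.Δ₁ R) (b + Rule.Δ₂ R)
    apply-rule (rule as cs p q ok) region@(ha ∷ hb ∷ _) (located v r sl ea eb)
      with cut-sound cs (moves-all tree c p q) (form (var 0) ⊟ constant (+ 6) ∷ region-forms as) ok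
        (+-⊟ ρ (constant (+ 6)) m-form (eval-constant ρ (+ 6)) eval-m 6≤m ∷ region)
    ... | Γ , ok′ , hyp = by-quotient (total v / m) refl
      where
      a<m : a < m
      a<m = holds-≤ (m ∷ a ∷ b ∷ []) (# 1 :+ var 1) (var 0) ha
      b<m : b < m
      b<m = holds-≤ (m ∷ a ∷ b ∷ []) (# 1 :+ var 2) (var 0) hb
      ea′ = trans ea (m<n⇒m%n≡m a<m)
      eb′ = trans eb (m<n⇒m%n≡m b<m)
      total≡ : coords v c + (a + b) ≡ total v / m * m
      total≡ = trans (sym (trans (total-split c v) (cong₂ (λ a b → coords v c + (a + b)) ea′ eb′)))
        (trans (m≡m%n+[m/n]*n (total v) m) (cong (λ r → r + total v / m * m) sl))
      by-quotient : ∀ t → total v / m ≡ t → At 3 (a + p) (b + q)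
      by-quotient 0 et = moves-with-sound {v = v} p q 0 hyp ea′ eb′ (trans total≡ (cong (_* m) et)) (∧-conicalˡ _ _ ok′) r sl
      by-quotient 1 et = moves-with-sound {v = v} p q 1 hyp ea′ eb′ (trans total≡ (cong (_* m) et))
        (∧-conicalˡ _ _ (∧-conicalʳ (moves-with tree c Γ p q 0) _ ok′)) r sl
      by-quotient 2 et = moves-with-sound {v = v} p q 2 hyp ea′ eb′ (trans total≡ (cong (_* m) et))
        (∧-conicalʳ (moves-with tree c Γ p q 1) _ (∧-conicalʳ (moves-with tree c Γ p q 0) _ ok′)) r sl
      -- Three coordinates below m sum to less than 3 * m.
      by-quotient (suc (suc (suc t))) et = ⊥-elim (<⇒≱ small (subst (3 * m ≤_) (sym (trans total≡ (cong (_* m) et)))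
          (*-monoˡ-≤ m {3} {3 + t} (s≤s (s≤s (s≤s z≤n))))))
        where
        small : coords v c + (a + b) < 3 * m
        small = +-mono-< (coords<m v c) (+-mono-< a<m (subst (b <_) (sym (+-identityʳ m)) b<m))

  dot-line : ∀ k g (ps : List (ℤ × ℤ)) →
    dot g (map (λ p → proj₁ p ℤ.+ k ℤ.* proj₂ p) ps) ≡ dot g (map proj₁ ps) ℤ.+ k ℤ.* dot g (map proj₂ ps)
  dot-line k [] ps = sym (trans (ℤₚ.+-identityˡ _) (ℤₚ.*-zeroʳ k))
  dot-line k (c ∷ g) [] = sym (trans (ℤₚ.+-identityˡ _) (ℤₚ.*-zeroʳ k))
  dot-line k (c ∷ g) ((x , y) ∷ ps) = trans (cong (λ z → c ℤ.* (x ℤ.+ k ℤ.* y) ℤ.+ z) (dot-line k g ps))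
    (solve 6 (λ k c x y u v → c ⋆ (x ⊹ k ⋆ y) ⊹ (u ⊹ k ⋆ v) := (c ⋆ x ⊹ u) ⊹ k ⋆ (c ⋆ y ⊹ v)) refl
      k c x y (dot g (map proj₁ ps)) (dot g (map proj₂ ps)))

  line : ∀ g x y p q n → dot g (1ℤ ∷ + m ∷ + (x + n * p) ∷ + (y + n * q) ∷ []) ≡
         dot g (1ℤ ∷ + m ∷ + x ∷ + y ∷ []) ℤ.+ + n ℤ.* slope g p q
  line g x y p q n = trans (cong (dot g) (cong₂ _∷_ (still 1ℤ) (cong₂ _∷_ (still (+ m)) (cong₂ _∷_ (moving x p)
      (cong₂ _∷_ (moving y q) refl)))))
    (dot-line (+ n) g ((1ℤ , 0ℤ) ∷ (+ m , 0ℤ) ∷ (+ x , + p) ∷ (+ y , + q) ∷ []))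
    where
    still : ∀ z → z ≡ z ℤ.+ + n ℤ.* 0ℤ
    still z = sym (trans (cong (λ y → z ℤ.+ y) (ℤₚ.*-zeroʳ (+ n))) (ℤₚ.+-identityʳ z))
    moving : ∀ x p → + (x + n * p) ≡ + x ℤ.+ + n ℤ.* + p
    moving x p = cong (λ y → + x ℤ.+ y) (ℤₚ.pos-* n p)

  module _ (params : List ℕ) {Γ : List Form} where
    private
      ρ : List ℤ
      ρ = ι (m ∷ params)

      eval-m : eval ρ m-form ≡ + m
      eval-m = eval-form (m ∷ params) (var 0)

      non-negative : NonNegative ρ
      non-negative = nonnegative-ι (m ∷ params)

    at-point : ∀ g A B {a b} → eval ρ A ≡ + a → eval ρ B ≡ + b →
               eval ρ (substitute (m-form ∷ A ∷ B ∷ []) g) ≡ eval (ι (m ∷ a ∷ b ∷ [])) g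
    at-point g A B ea eb = trans (eval-substitute ρ (m-form ∷ A ∷ B ∷ []) g)
      (cong (λ ρ′ → eval ρ′ g) (cong₂ _∷_ eval-m (cong₂ _∷_ ea (cong₂ _∷_ eb refl))))

    along-sound : ∀ N A B p q gs {n a b} → eval ρ N ≡ + suc n → eval ρ A ≡ + a → eval ρ B ≡ + b →
                  All (Holds ρ) Γ → along Γ N A B p q gs ≡ true →
                  ∀ k → k ≤ n → All (Holds (ι (m ∷ a + k * p ∷ b + k * q ∷ []))) gs
    along-sound N A B p q [] en ea eb hyp e k k≤n = []
    along-sound N A B p q (g ∷ gs) {n} {a} {b} en ea eb hyp e k k≤n =
      head (slope g p q) refl (∧-conicalˡ _ _ e) ∷ along-sound N A B p q gs en ea eb hyp
        (∧-conicalʳ (entails Γ (smallest N g₀ (slope g p q))) _ e) k k≤n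
      where
      g₀ = substitute (m-form ∷ A ∷ B ∷ []) g
      on-line : ∀ s → slope g p q ≡ s →
        eval (ι (m ∷ a + k * p ∷ b + k * q ∷ [])) g ≡ eval ρ g₀ ℤ.+ + k ℤ.* s
      on-line s refl = trans (line g a b p q k) (cong (ℤ._+ + k ℤ.* slope g p q) (sym (at-point g A B ea eb)))
      last-form : eval ρ (N ⊟ constant 1ℤ) ≡ + n
      last-form = trans (eval-⊟ ρ N (constant 1ℤ)) (trans (cong₂ ℤ._-_ en (eval-constant ρ 1ℤ)) refl)
      head : ∀ s → slope g p q ≡ s → entails Γ (smallest N g₀ s) ≡ true →
             Holds (ι (m ∷ a + k * p ∷ b + k * q ∷ [])) g
      head (+ s) es e = subst (0ℤ ℤ.≤_) (sym (on-line (+ s) es))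
        (ℤₚ.+-mono-≤ (entails-sound ρ Γ g₀ non-negative e hyp)
          (subst (0ℤ ℤ.≤_) (ℤₚ.pos-* k s) (+≤+ z≤n)))
      head -[1+ s ] es e = subst (0ℤ ℤ.≤_) (sym (on-line -[1+ s ] es))
        (ℤₚ.≤-trans (subst (0ℤ ℤ.≤_) end (entails-sound ρ Γ (g₀ ⊞ -[1+ s ] ⊡ (N ⊟ constant 1ℤ)) non-negative e hyp))
          (ℤₚ.+-monoʳ-≤ (eval ρ g₀) (ℤₚ.*-monoʳ-≤-nonPos -[1+ s ] (+≤+ k≤n))))
        where
        end : eval ρ (g₀ ⊞ -[1+ s ] ⊡ (N ⊟ constant 1ℤ)) ≡ eval ρ g₀ ℤ.+ + n ℤ.* -[1+ s ]
        end = trans (eval-⊞ ρ g₀ (-[1+ s ] ⊡ (N ⊟ constant 1ℤ)))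
          (cong (λ y → eval ρ g₀ ℤ.+ y) (trans (eval-⊡ ρ -[1+ s ] (N ⊟ constant 1ℤ))
            (trans (cong (-[1+ s ] ℤ.*_) last-form) (ℤₚ.*-comm -[1+ s ] (+ n)))))

  -- Positions are recorded on S = 3. One round is `return`, which keeps (a , b), followed by the
  -- rule, which leads from S = 0 to S = 3.
  iterate-rule : ∀ (R : Rule tree c) n {a b} →
    (∀ k → k < n → All (Holds (ι (m ∷ a + k * Rule.Δ₁ R ∷ b + k * Rule.Δ₂ R ∷ []))) (region-forms (Rule.atoms R))) →
    At 3 a b → At 3 (a + n * Rule.Δ₁ R) (b + n * Rule.Δ₂ R)
  iterate-rule R zero {a} {b} inside r = subst₂ (At 3) (sym (+-identityʳ a)) (sym (+-identityʳ b)) r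
  iterate-rule R (suc n) {a} {b} inside r =
    subst₂ (At 3) (next a (Rule.Δ₁ R)) (next b (Rule.Δ₂ R))
      (apply-rule R (inside n (n<1+n n)) (return (iterate-rule R n (λ k lt → inside k (<-trans lt (n<1+n n))) r)))
    where
    next : ∀ a p → a + n * p + p ≡ a + suc n * p
    next a p = trans (+-assoc a (n * p) p) (cong (λ x → a + x) (+-comm (n * p) p))

  at-cong : ∀ {s a b a′ b′} → a % m ≡ a′ % m → b % m ≡ b′ % m → At s a b → At s a′ b′
  at-cong p q (located v r sl ea eb) = located v r sl (trans ea p) (trans eb q)

  module _ (params : List ℕ) {Γ : List Form} (hyp : All (Holds (ι (m ∷ params))) Γ) where
    private
      ρ : List ℤ
      ρ = ι (m ∷ params)

      eval-m : eval ρ m-form ≡ + m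
      eval-m = eval-form (m ∷ params) (var 0)

      non-negative : NonNegative ρ
      non-negative = nonnegative-ι (m ∷ params)

      natural : ∀ f → Holds ρ f → ∃[ n ] eval ρ f ≡ + n
      natural f h with eval ρ f
      ... | + n = n , refl

      shifted : ∀ A N {a n} p → eval ρ A ≡ + a → eval ρ N ≡ + n → eval ρ (A ⊞ (+ p) ⊡ N) ≡ + (a + n * p)
      shifted A N {a} {n} p ea en rewrite eval-⊞ ρ A ((+ p) ⊡ N) | eval-⊡ ρ (+ p) N | ea | en =
        cong (λ y → + a ℤ.+ y) (trans (sym (ℤₚ.pos-* p n)) (cong +_ (*-comm p n)))

      unwrapped : ∀ A {a} → eval ρ A ≡ + a → entails Γ (A ⊟ m-form) ≡ true →
                  ∃[ a′ ] eval ρ (A ⊟ m-form) ≡ + a′ × a ≡ m + a′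
      unwrapped A {a} ea e with natural (A ⊟ m-form) (entails-sound ρ Γ (A ⊟ m-form) non-negative e hyp)
      ... | a′ , ea′ = a′ , ea′ , ℤₚ.+-injective (begin
        + a                                 ≡⟨ solve 2 (λ a m → a := m ⊹ (a ⊖ m)) refl (+ a) (+ m) ⟩
        + m ℤ.+ (+ a ℤ.- + m)               ≡⟨ cong (λ y → + m ℤ.+ y) (cong₂ ℤ._-_ (sym ea) (sym eval-m)) ⟩
        + m ℤ.+ (eval ρ A ℤ.- eval ρ m-form) ≡⟨ cong (λ y → + m ℤ.+ y) (trans (sym (eval-⊟ ρ A m-form)) ea′) ⟩
        + m ℤ.+ + a′                        ∎)
        where open ≡-Reasoning

    reaches-sound : ∀ A B cs A′ B′ {a b a′ b′} → eval ρ A ≡ + a → eval ρ B ≡ + b → eval ρ A′ ≡ + a′ → eval ρ B′ ≡ + b′ →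
                    reaches Γ A B cs A′ B′ ≡ true → At 3 a b → At 3 a′ b′
    reaches-sound A B [] A′ B′ ea eb ea′ eb′ e r
      with entails-all-sound ρ Γ (A ⊟ A′ ∷ A′ ⊟ A ∷ B ⊟ B′ ∷ B′ ⊟ B ∷ []) non-negative e hyp
    ... | h₁ ∷ h₂ ∷ h₃ ∷ h₄ ∷ [] = subst₂ (At 3)
      (≤-antisym (⊟-+ ρ A A′ h₂ ea ea′) (⊟-+ ρ A′ A h₁ ea′ ea))
      (≤-antisym (⊟-+ ρ B B′ h₄ eb eb′) (⊟-+ ρ B′ B h₃ eb′ eb)) r
    reaches-sound A B (go N R@(rule as _ p q _) ∷ cs) A′ B′ {a} {b} ea eb ea′ eb′ e r
      with natural N (entails-sound ρ Γ N non-negative (∧-conicalˡ _ _ e) hyp)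
    ... | n , en = reaches-sound (A ⊞ (+ p) ⊡ N) (B ⊞ (+ q) ⊡ N) cs A′ B′ (shifted A N p ea en) (shifted B N q eb en) ea′ eb′
      (∧-conicalʳ (along Γ₁ N A B p q (region-forms as)) _ e′) (iterate-rule R n (inside n en) r)
      where
      Γ₁ = N ⊟ constant 1ℤ ∷ Γ
      e′ = ∧-conicalʳ (entails Γ N) _ e
      inside : ∀ n → eval ρ N ≡ + n →
        ∀ k → k < n → All (Holds (ι (m ∷ a + k * p ∷ b + k * q ∷ []))) (region-forms as)
      inside (suc n) en k (s≤s k≤n) = along-sound params N A B p q (region-forms as) en ea eb
        (+-⊟ ρ (constant 1ℤ) N (eval-constant ρ 1ℤ) en (s≤s z≤n) ∷ hyp) (∧-conicalˡ _ _ e′) k k≤n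
    reaches-sound A B (wrap₁ ∷ cs) A′ B′ ea eb ea′ eb′ e r with unwrapped A ea (∧-conicalˡ _ _ e)
    ... | x , ex , refl = reaches-sound (A ⊟ m-form) B cs A′ B′ ex eb ea′ eb′
      (∧-conicalʳ (entails Γ (A ⊟ m-form)) _ e) (at-cong (m+k%m x) refl r)
    reaches-sound A B (wrap₂ ∷ cs) A′ B′ ea eb ea′ eb′ e r with unwrapped B eb (∧-conicalˡ _ _ e)
    ... | x , ex , refl = reaches-sound A (B ⊟ m-form) cs A′ B′ ea ex ea′ eb′
      (∧-conicalʳ (entails Γ (B ⊟ m-form)) _ e) (at-cong refl (m+k%m x) r)

  Follows : Path tree c → List ℕ → Set
  Follows (path Γ (a , b) _ (a′ , b′)) ρ = implies Γ (At 3 (⟦ a ⟧ ρ) (⟦ b ⟧ ρ) → At 3 (⟦ a′ ⟧ ρ) (⟦ b′ ⟧ ρ)) ρ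

  abstract
    along-path : ∀ n (P : Function (suc n) (Path tree c)) → checked (instantiate (suc n) 0 P) ≡ true →
                 Forall n (λ ρ → Follows (instantiate (suc n) 0 P) (m ∷ ρ))
    along-path n P e = forall-intro n (sound (instantiate (suc n) 0 P) e)
      where
      sound : ∀ p → checked p ≡ true → ∀ ρ → Follows p (m ∷ ρ)
      sound (path Γ (a , b) cs (a′ , b′)) e ρ = curry-forms (m ∷ ρ) Γ λ hyp →
        reaches-sound ρ (+-⊟ (ι (m ∷ ρ)) (constant (+ 6)) m-form (eval-constant (ι (m ∷ ρ)) (+ 6)) (eval-form (m ∷ ρ) (var 0)) 6≤m ∷ hyp)
          (form a) (form b) cs (form a′) (form b′)
          (eval-form (m ∷ ρ) a) (eval-form (m ∷ ρ) b) (eval-form (m ∷ ρ) a′) (eval-form (m ∷ ρ) b′) e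

-- Maps under which one point reaches everything

module _ {A : Set} (g : A → A) where

  iter-+ : ∀ n k x → iter g (n + k) x ≡ iter g n (iter g k x)
  iter-+ zero k x = refl
  iter-+ (suc n) k x = cong g (iter-+ n k x)

  iter-* : ∀ k n x → iter g n x ≡ x → iter g (k * n) x ≡ x
  iter-* zero n x h = refl
  iter-* (suc k) n x h = trans (iter-+ n (k * n) x) (trans (cong (iter g n) (iter-* k n x h)) h)

  iter-comm : ∀ n x → iter g n (g x) ≡ g (iter g n x)
  iter-comm zero x = refl
  iter-comm (suc n) x = cong g (iter-comm n x)

  module Cycle {r p : A} (from : ∀ v → ∃[ n ] iter g n r ≡ v) (closes : g p ≡ r) where

    -- Let v be gᵃ r and p be gᵇ r. Then b + 1 steps bring r back to itself, so a * b further steps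
    -- take v to step a * (b + 1) of the orbit, which is r again, and from r one reaches w.
    transitive : ∀ v w → ∃[ n ] iter g n v ≡ w
    transitive v w with from v | from p | from w
    ... | a , refl | b , refl | k , refl = k + a * b , trans (iter-+ k (a * b) _) (cong (iter g k) (begin
      iter g (a * b) (iter g a r)  ≡⟨ iter-+ (a * b) a r ⟨
      iter g (a * b + a) r         ≡⟨ cong (λ n → iter g n r) (trans (+-comm (a * b) a) (sym (*-suc a b))) ⟩
      iter g (a * suc b) r         ≡⟨ iter-* a (suc b) r closes ⟩
      r                            ∎))
      where open ≡-Reasoning

    -- With z = g x = g y, x = gᵇ z and y = gᵃ z, both equal g^((a+1)(b+1)−1) z.
    bijective : Bijective _≡_ _≡_ g
    bijective = injective , λ w → let n , h = transitive (g w) w in iter g n w , λ { refl → trans (sym (iter-comm n w)) h }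
      where
      injective : ∀ {x y} → g x ≡ g y → x ≡ y
      injective {x} {y} gx≡gy with transitive (g x) x | transitive (g x) y
      ... | b , hx | a , hy = begin
        x                                ≡⟨ hx ⟨
        iter g b z                       ≡⟨ cong (iter g b) (iter-* a (suc b) z (cong g hx)) ⟨
        iter g b (iter g (a * suc b) z)  ≡⟨ iter-+ b (a * suc b) z ⟨
        iter g (b + a * suc b) z         ≡⟨ cong (λ n → iter g n z) exponents ⟩
        iter g (a + b * suc a) z         ≡⟨ iter-+ a (b * suc a) z ⟩
        iter g a (iter g (b * suc a) z)  ≡⟨ cong (iter g a) (iter-* b (suc a) z (trans (cong g hy) (sym gx≡gy))) ⟩
        iter g a z                       ≡⟨ hy ⟩
        y                                ∎
        where
        open ≡-Reasoning
        z = g x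
        exponents : b + a * suc b ≡ a + b * suc a
        exponents = begin
          b + a * suc b    ≡⟨ cong (λ n → b + n) (*-suc a b) ⟩
          b + (a + a * b)  ≡⟨ +-assoc b a (a * b) ⟨
          b + a + a * b    ≡⟨ cong₂ _+_ (+-comm b a) (*-comm a b) ⟩
          a + b + b * a    ≡⟨ +-assoc a b (b * a) ⟩
          a + (b + b * a)  ≡⟨ cong (λ n → a + n) (*-suc b a) ⟨
          a + b * suc a    ∎

-- Cancellation modulo m and injectivity on S = 1 and S = 2

module Injectivity (m : ℕ) .{{_ : NonZero m}} where

  open Residues m

  %-cancel-+ʳ : ∀ {x y} n → x < m → y < m → (x + n) % m ≡ (y + n) % m → x ≡ y
  %-cancel-+ʳ {x} {y} n x<m y<m h = begin
    x                          ≡⟨ restore x x<m ⟨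
    ((x + n) % m + n * p) % m  ≡⟨ cong (λ r → (r + n * p) % m) h ⟩
    ((y + n) % m + n * p) % m  ≡⟨ restore y y<m ⟩
    y                          ∎
    where
    open ≡-Reasoning
    -- Modulo m, n * (m - 1) is the negative of n.
    p = pred m
    restore : ∀ x → x < m → ((x + n) % m + n * p) % m ≡ x
    restore x x<m = begin
      ((x + n) % m + n * p) % m  ≡⟨ %-idem-+ˡ (x + n) (n * p) ⟩
      (x + n + n * p) % m        ≡⟨ cong (_% m) (trans (+-assoc x n (n * p)) (cong (λ y → x + y) (sym (*-suc n p)))) ⟩
      (x + n * suc p) % m        ≡⟨ cong (λ q → (x + n * q) % m) (suc-pred m) ⟩
      (x + n * m) % m            ≡⟨ [m+kn]%n≡m%n x n m ⟩
      x % m                      ≡⟨ m<n⇒m%n≡m x<m ⟩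
      x                          ∎

  inc-injective : ∀ {x y} → inc m x ≡ inc m y → x ≡ y
  inc-injective {x} {y} h = toℕ-injective (%-cancel-+ʳ 1 (toℕ<n x) (toℕ<n y)
    (trans (cong (_% m) (+-comm (toℕ x) 1)) (trans (trans (sym (toℕ-inc x)) (trans (cong toℕ h) (toℕ-inc y)))
      (cong (_% m) (+-comm 1 (toℕ y))))))

  step-injective : ∀ e {u w} → step m e u ≡ step m e w → u ≡ w
  step-injective 0F h = cong₂ _,_ (inc-injective (cong proj₁ h)) (cong proj₂ h)
  step-injective 1F h = cong₂ _,_ (cong proj₁ h)
    (cong₂ _,_ (inc-injective (cong (λ v → proj₁ (proj₂ v)) h)) (cong (λ v → proj₂ (proj₂ v)) h))
  step-injective 2F h = cong₂ _,_ (cong proj₁ h)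
    (cong₂ _,_ (cong (λ v → proj₁ (proj₂ v)) h) (inc-injective (cong (λ v → proj₂ (proj₂ v)) h)))

  coords-injective : ∀ {v w : V m} → (∀ e → coords v e ≡ coords w e) → v ≡ w
  coords-injective h = cong₂ _,_ (toℕ-injective (h 0F)) (cong₂ _,_ (toℕ-injective (h 1F)) (toℕ-injective (h 2F)))

  -- Modulo m the coordinate in direction c is S minus the other two, and it lies below m.
  determined : ∀ c {v w : V m} → coords v (axis₁ c) ≡ coords w (axis₁ c) → coords v (axis₂ c) ≡ coords w (axis₂ c) →
               S v ≡ S w → v ≡ w
  determined c {v} {w} p q h = coords-injective (all c p q own)
    where
    own : coords v c ≡ coords w c
    own = %-cancel-+ʳ (coords w (axis₁ c) + coords w (axis₂ c)) (coords<m v c) (coords<m w c)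
      (trans (cong₂ (λ a b → (coords v c + (a + b)) % m) (sym p) (sym q))
        (trans (cong (_% m) (sym (total-split c v))) (trans h (cong (_% m) (total-split c w)))))
    all : ∀ c → coords v (axis₁ c) ≡ coords w (axis₁ c) → coords v (axis₂ c) ≡ coords w (axis₂ c) →
          coords v c ≡ coords w c → ∀ e → coords v e ≡ coords w e
    all 0F p q r 0F = r
    all 0F p q r 1F = p
    all 0F p q r 2F = q
    all 1F p q r 0F = p
    all 1F p q r 1F = r
    all 1F p q r 2F = q
    all 2F p q r 0F = p
    all 2F p q r 1F = q
    all 2F p q r 2F = r

  -- On the slices S = 1 and S = 2 the coordinate that selects the triple is not changed by any colour whose
  -- direction depends on it.
  slice1-keeps : ∀ c z z′ v w → step m (d (slice1 z) c) v ≡ step m (d (slice1 z′) c) w →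
                 d (slice1 z) c ≡ d (slice1 z′) c ⊎ coords v 0F ≡ coords w 0F
  slice1-keeps 0F true true v w h = inj₁ refl
  slice1-keeps 0F true false v w h = inj₂ (cong (λ v → coords v 0F) h)
  slice1-keeps 0F false true v w h = inj₂ (cong (λ v → coords v 0F) h)
  slice1-keeps 0F false false v w h = inj₁ refl
  slice1-keeps 1F true true v w h = inj₁ refl
  slice1-keeps 1F true false v w h = inj₁ refl
  slice1-keeps 1F false true v w h = inj₁ refl
  slice1-keeps 1F false false v w h = inj₁ refl
  slice1-keeps 2F true true v w h = inj₁ refl
  slice1-keeps 2F true false v w h = inj₂ (cong (λ v → coords v 0F) h)
  slice1-keeps 2F false true v w h = inj₂ (cong (λ v → coords v 0F) h)
  slice1-keeps 2F false false v w h = inj₁ refl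

  slice2-keeps : ∀ c z z′ v w → step m (d (slice2 z) c) v ≡ step m (d (slice2 z′) c) w →
                 d (slice2 z) c ≡ d (slice2 z′) c ⊎ coords v 1F ≡ coords w 1F
  slice2-keeps 0F true true v w h = inj₁ refl
  slice2-keeps 0F true false v w h = inj₂ (cong (λ v → coords v 1F) h)
  slice2-keeps 0F false true v w h = inj₂ (cong (λ v → coords v 1F) h)
  slice2-keeps 0F false false v w h = inj₁ refl
  slice2-keeps 1F true true v w h = inj₁ refl
  slice2-keeps 1F true false v w h = inj₁ refl
  slice2-keeps 1F false true v w h = inj₁ refl
  slice2-keeps 1F false false v w h = inj₁ refl
  slice2-keeps 2F true true v w h = inj₁ refl
  slice2-keeps 2F true false v w h = inj₂ (cong (λ v → coords v 1F) h)
  slice2-keeps 2F false true v w h = inj₂ (cong (λ v → coords v 1F) h)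
  slice2-keeps 2F false false v w h = inj₁ refl

-- From full coverage of S = 3 to all vertices

module Conclusion (m : ℕ) .{{_ : NonZero m}} (6≤m : 6 ≤ m) (c : Fin 3) (tree : Tree)
  (represents : ∀ {i j k} → i < m → j < m → k < m →
    Represents (m ∷ i ∷ j ∷ k ∷ []) tree (if (m % 6) ≡ᵇ 4 then caseY m i j k else caseX m i j k)) where

  open Residues m
  open Injectivity m
  open Dynamics m 6≤m c tree represents

  step-cancel : ∀ {e e′ u w} → e ≡ e′ → step m e u ≡ step m e′ w → u ≡ w
  step-cancel {e} refl h = step-injective e h

  f-injective₁ : ∀ {u w} → S u ≡ 1 → S w ≡ 1 → f m c u ≡ f m c w → u ≡ w
  f-injective₁ {u} {w} su sw h
    rewrite f-step u su {d (slice1 (coords u 0F ≡ᵇ 0)) c} refl | f-step w sw {d (slice1 (coords w 0F ≡ᵇ 0)) c} refl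
    with slice1-keeps c (coords u 0F ≡ᵇ 0) (coords w 0F ≡ᵇ 0) u w h
  ... | inj₁ e = step-cancel e h
  ... | inj₂ e = step-cancel (cong (λ x → d (slice1 (x ≡ᵇ 0)) c) e) h

  f-injective₂ : ∀ {u w} → S u ≡ 2 → S w ≡ 2 → f m c u ≡ f m c w → u ≡ w
  f-injective₂ {u} {w} su sw h
    rewrite f-step u su {d (slice2 (coords u 1F ≡ᵇ 0)) c} refl | f-step w sw {d (slice2 (coords w 1F ≡ᵇ 0)) c} refl
    with slice2-keeps c (coords u 1F ≡ᵇ 0) (coords w 1F ≡ᵇ 0) u w h
  ... | inj₁ e = step-cancel e h
  ... | inj₂ e = step-cancel (cong (λ x → d (slice2 (x ≡ᵇ 0)) c) e) h

  coords-root : ∀ e → coords root e ≡ 0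
  coords-root 0F = toℕ-fromℕ< 0<m
  coords-root 1F = toℕ-fromℕ< 0<m
  coords-root 2F = toℕ-fromℕ< 0<m

  S-root : S root ≡ 0
  S-root = trans (cong (_% m) (cong₂ _+_ (cong₂ _+_ (coords-root 0F) (coords-root 1F)) (coords-root 2F)))
    (m<n⇒m%n≡m 0<m)

  0%m : 0 % m ≡ 0
  0%m = m<n⇒m%n≡m 0<m

  base : At 0 0 0
  base = located root (0 , refl) S-root (trans (coords-root (axis₁ c)) (sym 0%m)) (trans (coords-root (axis₂ c)) (sym 0%m))

  first-move : ∀ {cs p q} → moves tree c at-origin cs p q ≡ true → At 3 p q
  first-move {cs} {p} {q} ok = apply-rule (rule at-origin cs p q ok)
    (forms-hold (m ∷ 0 ∷ 0 ∷ []) (# 1 :+ â :≤ m̂ ∷ # 1 :+ b̂ :≤ m̂ ∷ at-origin) (0<m , 0<m , refl , refl)) base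

  S-f : ∀ v → S (f m c v) ≡ suc (S v) % m
  S-f v = trans (cong S (f-step v refl refl)) (S-step (d (route (S v) (coords v 0F) (coords v 1F) (coords v 2F)) c) v)

  -- The orbit needs at least one step to reach f w, whose slice s + 1 is not that of the root. Its
  -- last step starts from some u on the slice of w, and injectivity on this slice identifies u with
  -- w.
  pull-back : ∀ {w s} → S w ≡ s → suc s < m →
              (∀ {u} → S u ≡ s → f m c u ≡ f m c w → u ≡ w) → Reached (f m c w) → Reached w
  pull-back {w} {s} sw lt inj (zero , h) =
    ⊥-elim (0≢1+n (trans (sym S-root) (trans (cong S h) (trans (S-f w) (trans (cong (λ s → suc s % m) sw) (m<n⇒m%n≡m lt))))))
  pull-back {w} {s} sw lt inj (suc n , h) = n , inj (slice (S u) (m%n<n (total u) m) refl) h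
    where
    u = iter (f m c) n root
    slice : ∀ x → x < m → S u ≡ x → S u ≡ s
    slice x x<m e = trans e (%-cancel-+ʳ 1 x<m (<-trans (n<1+n s) lt) (begin
      (x + 1) % m      ≡⟨ cong (_% m) (+-comm x 1) ⟩
      suc x % m        ≡⟨ cong (λ x → suc x % m) e ⟨
      suc (S u) % m    ≡⟨ S-f u ⟨
      S (f m c u)      ≡⟨ cong S h ⟩
      S (f m c w)      ≡⟨ S-f w ⟩
      suc (S w) % m    ≡⟨ cong (λ x → suc x % m) sw ⟩
      suc s % m        ≡⟨ cong (_% m) (+-comm 1 s) ⟩
      (s + 1) % m      ∎))
      where open ≡-Reasoning

  at-vertex : ∀ {s} v → S v ≡ s → At s (coords v (axis₁ c)) (coords v (axis₂ c)) → Reached v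
  at-vertex v sv (located w r sw p q) = subst Reached (determined c
    (trans p (m<n⇒m%n≡m (coords<m v (axis₁ c)))) (trans q (m<n⇒m%n≡m (coords<m v (axis₂ c)))) (trans sw (sym sv))) r

  module _ (covered : ∀ a b → a < m → b < m → At 3 a b) where

    covered-vertex : ∀ v → At 3 (coords v (axis₁ c)) (coords v (axis₂ c))
    covered-vertex v = covered _ _ (coords<m v (axis₁ c)) (coords<m v (axis₂ c))

    reached-high : ∀ s v → S v ≡ 3 + s → Reached v
    reached-high s v e = at-vertex v e (climb s (subst (_< m) e (m%n<n (total v) m)) (covered-vertex v))

    reached-all : ∀ v → Reached v
    reached-all v = by-slice (S v) refl
      where
      reached₂ : ∀ v → S v ≡ 2 → Reached v
      reached₂ v e = pull-back e lt (λ su h → f-injective₂ su e h)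
        (reached-high 0 (f m c v) (trans (S-f v) (trans (cong (λ s → suc s % m) e) (m<n⇒m%n≡m lt))))
        where
        lt : 3 < m
        lt = ≤-trans (s≤s (s≤s (s≤s (s≤s z≤n)))) 6≤m
      by-slice : ∀ s → S v ≡ s → Reached v
      by-slice 0 e = at-vertex v e (return (covered-vertex v))
      by-slice 1 e = pull-back e lt (λ su h → f-injective₁ su e h)
        (reached₂ (f m c v) (trans (S-f v) (trans (cong (λ s → suc s % m) e) (m<n⇒m%n≡m lt))))
        where
        lt : 2 < m
        lt = ≤-trans (s≤s (s≤s (s≤s z≤n))) 6≤m
      by-slice 2 e = reached₂ v e
      by-slice (suc (suc (suc s))) e = reached-high s v e

    -- On S = m - 1 colour c moves in direction c, so the vertex there with a = b = 0 precedes the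
    -- root. This closes the orbit.
    last-vertex : ∃[ p ] f m c p ≡ root
    last-vertex with climb (m ∸ 4) (≤-reflexive (m+[n∸m]≡n 4≤m)) (covered 0 0 0<m 0<m)
      where
      4≤m : 4 ≤ m
      4≤m = ≤-trans (s≤s (s≤s (s≤s (s≤s z≤n)))) 6≤m
    ... | located v _ sl p q = v , trans (f-step v sl refl) (determined c
      (trans (own-step-first c v) (trans p (trans 0%m (sym (coords-root (axis₁ c))))))
      (trans (own-step-second c v) (trans q (trans 0%m (sym (coords-root (axis₂ c))))))
      (trans (S-step c v) (trans (cong (λ s → suc s % m) sl) (trans (cong (_% m) (m+[n∸m]≡n 4≤m)) (trans (n%n≡0 m) (sym S-root))))))
      where
      4≤m : 4 ≤ m
      4≤m = ≤-trans (s≤s (s≤s (s≤s (s≤s z≤n)))) 6≤m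

    open Cycle (f m c) reached-all (proj₂ last-vertex) public

-- The five return maps

infixl 7 _:-_
_:-_ : Expr → Expr → Form
a :- b = form a ⊟ form b

infix 6 _times_
_times_ : ∀ {tree c} → Form → Rule tree c → Move tree c
n times r = go n r

once : ∀ {tree c} → Rule tree c → Move tree c
once r = go (form (# 1)) r

rung : ∀ δ s k → δ + (s + δ * k) ≡ s + δ * suc k
rung δ s k = trans (sym (+-assoc δ s (δ * k))) (trans (cong (_+ δ * k) (+-comm δ s))
  (trans (+-assoc s δ (δ * k)) (cong (λ x → s + x) (sym (*-suc δ k)))))

progression : ∀ {P : ℕ → Set} s δ n → (∀ k → k < n → P (s + δ * k) → P (δ + (s + δ * k))) → P s →
              ∀ k → k ≤ n → P (s + δ * k)
progression {P} s δ n next p zero _ = subst P (sym (trans (cong (λ x → s + x) (*-zeroʳ δ)) (+-identityʳ s))) p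
progression {P} s δ n next p (suc k) lt = subst P (rung δ s k) (next k lt (progression {P} s δ n next p k (<⇒≤ lt)))

divided : ∀ δ .{{_ : NonZero δ}} u → ∃[ r ] ∃[ k ] r < δ × r + δ * k ≡ u
divided δ u = u % δ , u / δ , m%n<n u δ , trans (cong (λ x → u % δ + x) (*-comm δ (u / δ))) (sym (m≡m%n+[m/n]*n u δ))

by-residue : ∀ {m} {P : ℕ → Set} δ .{{_ : NonZero δ}} → (∀ r k → r < δ → r + δ * k < m → P (r + δ * k)) → ∀ u → u < m → P u
by-residue {m} {P} δ p u u<m with divided δ u
... | r , k , r<δ , eq = subst P eq (p r k r<δ (subst (_< m) (sym eq) u<m))

trichotomy : ∀ a b → a < b ⊎ a ≡ b ⊎ b < a
trichotomy a b with <-cmp a b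
... | tri< lt _ _ = inj₁ lt
... | tri≈ _ eq _ = inj₂ (inj₁ eq)
... | tri> _ _ gt = inj₂ (inj₂ gt)

-- The condition 1 ≤ u is carried along because u = 0 is an exception of the return maps to which
-- this applies.
ladder : ∀ {P : ℕ → Set} δ bound → (∀ u → 1 ≤ u → δ + u ≤ bound → P u → P (δ + u)) →
         ∀ s → 1 ≤ s → P s → ∀ k → s + δ * k ≤ bound → P (s + δ * k)
ladder {P} δ bound up s 1≤s p k le = progression {P} s δ k
  (λ j j<k → up (s + δ * j) (≤-trans 1≤s (m≤m+n s (δ * j)))
    (≤-trans (≤-reflexive (rung δ s j)) (≤-trans (+-monoʳ-≤ s (*-monoʳ-≤ δ j<k)) le)))
  p k ≤-refl

module EvenModulus (m : ℕ) (n : ℕ) (m≡ : 6 + 2 * n ≡ m) where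

  6≤m : 6 ≤ m
  6≤m = linear 2 (λ m n → # 6 :+ 2 :* n :≡ m ∷ [] ⊢ # 6 :≤ m ∷ []) refl m n m≡

  1<m : 1 < m
  1<m = ≤-trans (s≤s (s≤s z≤n)) 6≤m

  -- Linear forms have no division, so half of m enters the paths as a variable of its own, tied to
  -- m by 2 * h ≡ m.
  h : ℕ
  h = 3 + n

  2h≡m : 2 * h ≡ m
  2h≡m = linear 2 (λ m n → # 6 :+ 2 :* n :≡ m ∷ [] ⊢ 2 :* (# 3 :+ n) :≡ m ∷ []) refl m n m≡

  m-1 m-2 m-3 m-4 : ℕ
  m-1 = 5 + 2 * n
  m-2 = 4 + 2 * n
  m-3 = 3 + 2 * n
  m-4 = 2 + 2 * n

  m-1<m : m-1 < m
  m-1<m = ≤-reflexive m≡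
  m-2<m : m-2 < m
  m-2<m = <-trans (n<1+n _) m-1<m
  m-3<m : m-3 < m
  m-3<m = <-trans (n<1+n _) m-2<m
  m-4<m : m-4 < m
  m-4<m = <-trans (n<1+n _) m-3<m

-- Colour 0 with the table for m ≡ 0, 2 (mod 6)

module Colour0X where

  diagonal-low diagonal diagonal-bottom bottom bottom₂ left₁ inner₁ left-top inner-top right : Rule caseX-tree 0F
  diagonal-low = rule (# 2 :≤ b̂ ∷ # 2 :+ b̂ :≤ m̂ ∷ # 2 :+ â :≤ m̂ ∷ []) [] 1 1 refl
  diagonal = rule (# 2 :≤ â ∷ # 2 :+ â :≤ m̂ ∷ # 1 :≤ b̂ ∷ []) [] 1 1 refl
  diagonal-bottom = rule (â :≡ # 1 ∷ b̂ :≡ # 0 ∷ []) [] 1 1 refl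
  bottom = rule (# 3 :≤ â ∷ b̂ :≡ # 0 ∷ []) [] 0 1 refl
  bottom₂ = rule (â :≡ # 2 ∷ b̂ :≡ # 0 ∷ []) [] 0 2 refl
  left₁ = rule (â :≡ # 0 ∷ b̂ :≡ # 1 ∷ []) [] 1 0 refl
  inner₁ = rule (â :≡ # 1 ∷ b̂ :≡ # 1 ∷ []) [] 0 1 refl
  left-top = rule (â :≡ # 0 ∷ # 1 :+ b̂ :≡ m̂ ∷ []) [] 0 3 refl
  inner-top = rule (â :≡ # 1 ∷ # 1 :+ b̂ :≡ m̂ ∷ []) [] 0 1 refl
  right = rule (# 1 :+ â :≡ m̂ ∷ # 1 :≤ b̂ ∷ []) [] 1 2 refl

  module Cover (m : ℕ) .{{_ : NonZero m}} (n : ℕ) (m≡ : 6 + 2 * n ≡ m)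
    (m%6 : (m % 6 ≡ᵇ 4) ≡ false) where

    open EvenModulus m n m≡

    abstract
      represents : ∀ {i j k} → i < m → j < m → k < m →
        Represents (m ∷ i ∷ j ∷ k ∷ []) caseX-tree (if (m % 6) ≡ᵇ 4 then caseY m i j k else caseX m i j k)
      represents i<m j<m k<m rewrite m%6 = caseX-represents 6≤m i<m j<m

    open Conclusion m 6≤m 0F caseX-tree represents public
    open Dynamics m 6≤m 0F caseX-tree represents public

    start : At 3 2 0
    start = first-move {[]} refl

    from-start : At 3 2 0 → At 3 0 1
    from-start = along-path 0 (λ m → path [] (# 2 , # 0)
      (once bottom₂ ∷ m :- # 3 times diagonal ∷ once right ∷ wrap₁ ∷ wrap₂ ∷ []) (# 0 , # 1)) refl

    from-1 : At 3 0 1 → At 3 0 3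
    from-1 = along-path 0 (λ m → path [] (# 0 , # 1)
      (once left₁ ∷ once inner₁ ∷ once diagonal-low ∷ m :- # 3 times diagonal ∷ wrap₂ ∷ once bottom ∷ once right ∷ wrap₁ ∷ [])
      (# 0 , # 3)) refl

    -- The difference b - a gains 1 on the bottom row, with shift (0 , 1), and 1 in the right
    -- column, with shift (1 , 2).
    from-middle : ∀ u → 2 ≤ u → 3 + u ≤ m → At 3 0 u → At 3 0 (2 + u)
    from-middle = along-path 1 (λ m u → path (# 2 :≤ u ∷ # 3 :+ u :≤ m ∷ []) (# 0 , u)
      (m :- (# 1 :+ u) times diagonal-low ∷ once diagonal ∷ wrap₂ ∷ once bottom ∷ u :- # 1 times diagonal ∷ once right ∷ wrap₁ ∷ [])
      (# 0 , # 2 :+ u)) refl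

    from-m-2 : ∀ u → 2 + u ≡ m → At 3 0 u → At 3 0 0
    from-m-2 = along-path 1 (λ m u → path (# 2 :+ u :≡ m ∷ []) (# 0 , u)
      (once diagonal-low ∷ once inner-top ∷ wrap₂ ∷ once diagonal-bottom ∷ m :- # 3 times diagonal ∷ once right ∷ wrap₁ ∷ wrap₂ ∷ [])
      (# 0 , # 0)) refl

    from-m-1 : ∀ u → 1 + u ≡ m → At 3 0 u → At 3 0 2
    from-m-1 = along-path 1 (λ m u → path (# 1 :+ u :≡ m ∷ []) (# 0 , u) (once left-top ∷ wrap₂ ∷ []) (# 0 , # 2)) refl

    odd : ∀ k → k ≤ 2 + n → At 3 0 (1 + 2 * k)
    odd = progression {At 3 0} 1 2 (2 + n) next (from-start start)
      where
      next : ∀ k → k < 2 + n → At 3 0 (1 + 2 * k) → At 3 0 (3 + 2 * k)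
      next zero _ = from-1
      next (suc k) lt = from-middle (1 + 2 * suc k) (s≤s (s≤s z≤n))
        (linear 3 (λ m n k → # 6 :+ 2 :* n :≡ m ∷ k :< # 2 :+ n ∷ [] ⊢ # 4 :+ 2 :* k :≤ m ∷ []) refl m n (suc k) m≡ lt)

    even : ∀ k → k ≤ 1 + n → At 3 0 (2 + 2 * k)
    even = progression {At 3 0} 2 2 (1 + n) next
      (from-m-1 (1 + 2 * (2 + n)) (linear 2 (λ m n → # 6 :+ 2 :* n :≡ m ∷ [] ⊢ # 2 :+ 2 :* (# 2 :+ n) :≡ m ∷ []) refl m n m≡)
        (odd (2 + n) ≤-refl))
      where
      next : ∀ k → k < 1 + n → At 3 0 (2 + 2 * k) → At 3 0 (4 + 2 * k)
      next k lt = from-middle (2 + 2 * k) (s≤s (s≤s z≤n))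
        (linear 3 (λ m n k → # 6 :+ 2 :* n :≡ m ∷ k :< # 1 :+ n ∷ [] ⊢ # 5 :+ 2 :* k :≤ m ∷ []) refl m n k m≡ lt)

    -- The cycle on the line is 0 → 1 → 3 → ... → m - 1 → 2 → 4 → ... → m - 2 → 0.
    section : ∀ u → u < m → At 3 0 u
    section u u<m with divided 2 u
    ... | 0 , zero , _ , refl = from-m-2 (2 + 2 * (1 + n))
      (linear 2 (λ m n → # 6 :+ 2 :* n :≡ m ∷ [] ⊢ # 4 :+ 2 :* (# 1 :+ n) :≡ m ∷ []) refl m n m≡) (even (1 + n) ≤-refl)
    ... | 0 , suc k , _ , refl = subst (At 3 0) (sym (*-suc 2 k)) (even k
      (linear 3 (λ m n k → # 6 :+ 2 :* n :≡ m ∷ 2 :* (# 1 :+ k) :< m ∷ [] ⊢ k :≤ # 1 :+ n ∷ []) refl m n k m≡ u<m))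
    ... | 1 , k , _ , refl = odd k
      (linear 3 (λ m n k → # 6 :+ 2 :* n :≡ m ∷ # 1 :+ 2 :* k :< m ∷ [] ⊢ k :≤ # 2 :+ n ∷ []) refl m n k m≡ u<m)
    ... | suc (suc _) , _ , s≤s (s≤s ()) , _

    -- From column 3 on, a point has its diagonal predecessor in the column before. Only b = 0 and b
    -- = 1 differ: (a , m - 1) crosses the top edge to (1 + a , 0), which the bottom row then shifts
    -- to (1 + a , 1).
    cover : ∀ a b → a < m → b < m → At 3 a b
    cover 0 b a<m b<m = section b b<m
    cover 1 0 a<m b<m = along-path 1 (λ m u → path (# 2 :+ u :≡ m ∷ []) (# 0 , u)
      (once diagonal-low ∷ once inner-top ∷ wrap₂ ∷ []) (# 1 , # 0)) refl m-2 m≡ (section m-2 m-2<m)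
    cover 1 1 a<m b<m = along-path 0 (λ m → path [] (# 0 , # 1) (once left₁ ∷ []) (# 1 , # 1)) refl (section 1 b<m)
    cover 1 2 a<m b<m = along-path 0 (λ m → path [] (# 0 , # 1) (once left₁ ∷ once inner₁ ∷ []) (# 1 , # 2)) refl
      (section 1 a<m)
    cover 1 (suc b@(suc (suc _))) a<m b<m = along-path 1 (λ m b → path (# 2 :≤ b ∷ # 1 :+ b :< m ∷ []) (# 0 , b)
      (once diagonal-low ∷ []) (# 1 , # 1 :+ b)) refl b (s≤s (s≤s z≤n)) b<m (section b (<-trans (n<1+n b) b<m))
    cover 2 0 a<m b<m = start
    cover 2 1 a<m b<m = along-path 0 (λ m → path [] (# 1 , # 0) (once diagonal-bottom ∷ []) (# 2 , # 1)) refl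
      (cover 1 0 b<m 0<m)
    cover 2 2 a<m b<m = along-path 0 (λ m → path [] (# 2 , # 0) (once bottom₂ ∷ []) (# 2 , # 2)) refl start
    cover 2 (suc b@(suc (suc _))) a<m b<m = along-path 1 (λ m b → path (# 2 :≤ b ∷ # 1 :+ b :< m ∷ []) (# 1 , b)
      (once diagonal-low ∷ []) (# 2 , # 1 :+ b)) refl b (s≤s (s≤s z≤n)) b<m
      (cover 1 b (<-trans (n<1+n 1) a<m) (<-trans (n<1+n b) b<m))
    cover (suc a@(suc (suc _))) 0 a<m b<m = along-path 2 (λ m a b → path (# 2 :≤ a ∷ # 1 :+ a :< m ∷ # 1 :+ b :≡ m ∷ []) (a , b)
      (once diagonal ∷ wrap₂ ∷ []) (# 1 :+ a , # 0)) refl a m-1 (s≤s (s≤s z≤n)) a<m m≡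
      (cover a m-1 (<-trans (n<1+n a) a<m) m-1<m)
    cover (suc a@(suc (suc _))) 1 a<m b<m = along-path 2 (λ m a b → path (# 2 :≤ a ∷ # 1 :+ a :< m ∷ # 1 :+ b :≡ m ∷ []) (a , b)
      (once diagonal ∷ wrap₂ ∷ once bottom ∷ []) (# 1 :+ a , # 1)) refl a m-1 (s≤s (s≤s z≤n)) a<m m≡
      (cover a m-1 (<-trans (n<1+n a) a<m) m-1<m)
    cover (suc a@(suc (suc _))) (suc b@(suc _)) a<m b<m = along-path 2 (λ m a b → path (# 2 :≤ a ∷ # 1 :+ a :< m ∷ # 1 :≤ b ∷ # 1 :+ b :< m ∷ []) (a , b)
      (once diagonal ∷ []) (# 1 :+ a , # 1 :+ b)) refl a b (s≤s (s≤s z≤n)) a<m (s≤s z≤n) b<m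
      (cover a b (<-trans (n<1+n a) a<m) (<-trans (n<1+n b) b<m))

-- Colour 0 with the table for m ≡ 4 (mod 6)

module Colour0Y where

  left below above antidiagonal diagonal-bottom bottom bottom₂ corner left₁ inner₁ left-top left-top₂ inner-top inner-top₂ right top-right : Rule caseY-tree 0F
  left = rule (# 2 :≤ b̂ ∷ # 3 :+ b̂ :≤ m̂ ∷ # 2 :+ â :+ b̂ :≤ m̂ ∷ []) [] 1 1 refl
  below = rule (# 2 :≤ â ∷ # 1 :≤ b̂ ∷ # 2 :+ â :+ b̂ :≤ m̂ ∷ []) [] 1 1 refl
  above = rule (# 2 :≤ â ∷ # 2 :+ â :≤ m̂ ∷ m̂ :≤ â :+ b̂ ∷ []) [] 1 1 refl
  antidiagonal = rule (# 2 :≤ â ∷ # 2 :+ â :≤ m̂ ∷ # 1 :+ â :+ b̂ :≡ m̂ ∷ []) [] 0 2 refl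
  diagonal-bottom = rule (â :≡ # 1 ∷ b̂ :≡ # 0 ∷ []) [] 1 1 refl
  bottom = rule (# 3 :≤ â ∷ # 2 :+ â :≤ m̂ ∷ b̂ :≡ # 0 ∷ []) [] 0 1 refl
  bottom₂ = rule (â :≡ # 2 ∷ b̂ :≡ # 0 ∷ []) [] 0 2 refl
  corner = rule (# 1 :+ â :≡ m̂ ∷ b̂ :≡ # 0 ∷ []) [] 0 2 refl
  left₁ = rule (â :≡ # 0 ∷ b̂ :≡ # 1 ∷ []) [] 1 0 refl
  inner₁ = rule (â :≡ # 1 ∷ b̂ :≡ # 1 ∷ []) [] 0 1 refl
  left-top = rule (â :≡ # 0 ∷ # 1 :+ b̂ :≡ m̂ ∷ []) [] 0 3 refl
  left-top₂ = rule (â :≡ # 0 ∷ # 2 :+ b̂ :≡ m̂ ∷ []) [] 0 3 refl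
  inner-top = rule (â :≡ # 1 ∷ # 1 :+ b̂ :≡ m̂ ∷ []) [] 0 1 refl
  inner-top₂ = rule (â :≡ # 1 ∷ # 2 :+ b̂ :≡ m̂ ∷ []) [] 0 1 refl
  right = rule (# 1 :+ â :≡ m̂ ∷ # 1 :≤ b̂ ∷ # 2 :+ b̂ :≤ m̂ ∷ []) [] 1 2 refl
  top-right = rule (# 1 :+ â :≡ m̂ ∷ # 1 :+ b̂ :≡ m̂ ∷ []) [] 0 2 refl

  module Cover (m : ℕ) .{{_ : NonZero m}} (n : ℕ) (m≡ : 6 + 2 * n ≡ m) (m%6 : (m % 6 ≡ᵇ 4) ≡ true) where

    open EvenModulus m n m≡

    abstract
      represents : ∀ {i j k} → i < m → j < m → k < m →
        Represents (m ∷ i ∷ j ∷ k ∷ []) caseY-tree (if (m % 6) ≡ᵇ 4 then caseY m i j k else caseX m i j k)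
      represents i<m j<m k<m rewrite m%6 = caseY-represents 6≤m i<m j<m

    open Conclusion m 6≤m 0F caseY-tree represents public
    open Dynamics m 6≤m 0F caseY-tree represents public

    start : At 3 2 0
    start = first-move {[]} refl

    from-start : At 3 2 0 → At 3 0 3
    from-start = along-path 1 (λ m h → path (2 :* h :≡ m ∷ []) (# 2 , # 0)
      (once bottom₂ ∷ h :- # 2 times below ∷ h :- # 1 times above ∷ once top-right ∷ wrap₂ ∷ once right ∷ wrap₁ ∷ [])
      (# 0 , # 3)) refl h 2h≡m

    from-1 : At 3 0 1 → At 3 0 5
    from-1 = along-path 1 (λ m h → path (2 :* h :≡ m ∷ []) (# 0 , # 1)
      (once left₁ ∷ once inner₁ ∷ once left ∷ h :- # 3 times below ∷ once antidiagonal ∷ h :- # 2 times above ∷ wrap₂ ∷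
       once bottom ∷ once below ∷ once above ∷ once right ∷ wrap₁ ∷ []) (# 0 , # 5)) refl h 2h≡m

    -- As a + b is odd, the first diagonal hits a + b = m - 1 and is shifted by (0 , 2). The bottom
    -- row adds 1 to b and flips the parity, so the second diagonal steps over. With 1 from the
    -- right column, b - a gains 2 + 1 + 1 = 4.
    from-odd : ∀ w → 1 ≤ w → 6 + 2 * w ≤ m → At 3 0 (1 + 2 * w) → At 3 0 (5 + 2 * w)
    from-odd w = along-path 2 (λ m h w → path (2 :* h :≡ m ∷ # 1 :≤ w ∷ # 6 :+ 2 :* w :≤ m ∷ []) (# 0 , # 1 :+ 2 :* w)
      (h :- (# 1 :+ w) times left ∷ once antidiagonal ∷ h :- (# 2 :+ w) times above ∷ wrap₂ ∷ once bottom ∷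
       form (# 1 :+ w) times below ∷ form (# 1 :+ w) times above ∷ once right ∷ wrap₁ ∷ []) (# 0 , # 5 :+ 2 :* w))
      refl h w 2h≡m

    -- Now the first diagonal steps over a + b = m - 1 and the second, of opposite parity, hits it;
    -- the gain is again 4.
    from-even : ∀ w → 1 ≤ w → 4 + 2 * w ≤ m → At 3 0 (2 * w) → At 3 0 (4 + 2 * w)
    from-even w = along-path 2 (λ m h w → path (2 :* h :≡ m ∷ # 1 :≤ w ∷ # 4 :+ 2 :* w :≤ m ∷ []) (# 0 , 2 :* w)
      (h :- w times left ∷ h :- w times above ∷ wrap₂ ∷ once bottom ∷ w :- # 1 times below ∷ once antidiagonal ∷
       form w times above ∷ once right ∷ wrap₁ ∷ []) (# 0 , # 4 :+ 2 :* w)) refl h w 2h≡m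

    from-m-3 : ∀ u → 3 + u ≡ m → At 3 0 u → At 3 0 4
    from-m-3 u = along-path 2 (λ m h u → path (2 :* h :≡ m ∷ # 3 :+ u :≡ m ∷ []) (# 0 , u)
      (once left ∷ once inner-top₂ ∷ once inner-top ∷ wrap₂ ∷ once diagonal-bottom ∷ h :- # 2 times below ∷ once antidiagonal ∷
       h :- # 1 times above ∷ wrap₂ ∷ once corner ∷ once right ∷ wrap₁ ∷ []) (# 0 , # 4)) refl h u 2h≡m

    from-m-2 : ∀ u → 2 + u ≡ m → At 3 0 u → At 3 0 1
    from-m-2 = along-path 1 (λ m u → path (# 2 :+ u :≡ m ∷ []) (# 0 , u) (once left-top₂ ∷ wrap₂ ∷ []) (# 0 , # 1)) refl

    from-m-1 : ∀ u → 1 + u ≡ m → At 3 0 u → At 3 0 2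
    from-m-1 = along-path 1 (λ m u → path (# 1 :+ u :≡ m ∷ []) (# 0 , u) (once left-top ∷ wrap₂ ∷ []) (# 0 , # 2)) refl

    -- The steps of 4 are allowed to end at u = m, which is how 0 is reached.
    from-m : ∀ u → u ≡ m → At 3 0 u → At 3 0 0
    from-m = along-path 1 (λ m u → path (u :≡ m ∷ []) (# 0 , u) (wrap₂ ∷ []) (# 0 , # 0)) refl

    plus-4 : ∀ u → 1 ≤ u → 4 + u ≤ m → At 3 0 u → At 3 0 (4 + u)
    plus-4 u 1≤u le with divided 2 u
    ... | 0 , w , _ , refl = from-even w (linear 1 (λ w → # 1 :≤ 2 :* w ∷ [] ⊢ # 1 :≤ w ∷ []) refl w 1≤u) le
    ... | 1 , zero , _ , refl = from-1
    ... | 1 , w@(suc _) , _ , refl = from-odd w (s≤s z≤n)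
      -- The bound needs parity: 5 + 2 * w ≤ 2 * h is rounded to 3 + w ≤ h and then doubled.
      (linear 3 (λ m h w → 2 :* h :≡ m ∷ # 3 :+ w :≤ h ∷ [] ⊢ # 6 :+ 2 :* w :≤ m ∷ []) refl m h w 2h≡m
        (linear 3 (λ m h w → 2 :* h :≡ m ∷ # 5 :+ 2 :* w :≤ m ∷ [] ⊢ # 3 :+ w :≤ h ∷ []) refl m h w 2h≡m le))
    ... | suc (suc _) , _ , s≤s (s≤s ()) , _

    up : ∀ s → 1 ≤ s → At 3 0 s → ∀ k → s + 4 * k ≤ m → At 3 0 (s + 4 * k)
    up = ladder 4 m plus-4

    module _ (q : ℕ) (m≡q : 8 + 4 * q ≡ m) where
      private
        from₃ : ∀ k → k ≤ 1 + q → At 3 0 (3 + 4 * k)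
        from₃ k le = up 3 (s≤s z≤n) (from-start start) k
          (linear 3 (λ m q k → # 8 :+ 4 :* q :≡ m ∷ k :≤ # 1 :+ q ∷ [] ⊢ # 3 :+ 4 :* k :≤ m ∷ []) refl m q k m≡q le)
        from₂ : ∀ k → k ≤ 1 + q → At 3 0 (2 + 4 * k)
        from₂ k le = up 2 (s≤s z≤n) (from-m-1 (3 + 4 * (1 + q))
          (linear 2 (λ m q → # 8 :+ 4 :* q :≡ m ∷ [] ⊢ # 4 :+ 4 :* (# 1 :+ q) :≡ m ∷ []) refl m q m≡q)
          (from₃ (1 + q) ≤-refl)) k
          (linear 3 (λ m q k → # 8 :+ 4 :* q :≡ m ∷ k :≤ # 1 :+ q ∷ [] ⊢ # 2 :+ 4 :* k :≤ m ∷ []) refl m q k m≡q le)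
        from₁ : ∀ k → k ≤ 1 + q → At 3 0 (1 + 4 * k)
        from₁ k le = up 1 (s≤s z≤n) (from-m-2 (2 + 4 * (1 + q))
          (linear 2 (λ m q → # 8 :+ 4 :* q :≡ m ∷ [] ⊢ # 4 :+ 4 :* (# 1 :+ q) :≡ m ∷ []) refl m q m≡q)
          (from₂ (1 + q) ≤-refl)) k
          (linear 3 (λ m q k → # 8 :+ 4 :* q :≡ m ∷ k :≤ # 1 :+ q ∷ [] ⊢ # 1 :+ 4 :* k :≤ m ∷ []) refl m q k m≡q le)
        from₄ : ∀ k → k ≤ 1 + q → At 3 0 (4 + 4 * k)
        from₄ k le = up 4 (s≤s z≤n) (from-m-3 (1 + 4 * (1 + q))
          (linear 2 (λ m q → # 8 :+ 4 :* q :≡ m ∷ [] ⊢ # 4 :+ 4 :* (# 1 :+ q) :≡ m ∷ []) refl m q m≡q)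
          (from₁ (1 + q) ≤-refl)) k
          (linear 3 (λ m q k → # 8 :+ 4 :* q :≡ m ∷ k :≤ # 1 :+ q ∷ [] ⊢ # 4 :+ 4 :* k :≤ m ∷ []) refl m q k m≡q le)
        bound : ∀ r k → r + 4 * k < m → k ≤ 1 + q
        bound r k lt = linear 4 (λ m q r k → # 8 :+ 4 :* q :≡ m ∷ r :+ 4 :* k :< m ∷ [] ⊢ k :≤ # 1 :+ q ∷ [])
          refl m q r k m≡q lt

      -- For m ≡ 0 (mod 4) the classes modulo 4 are linked as 3, ..., m - 1 → 2, ..., m - 2 → 1,
      -- ..., m - 3 → 4, ..., m.
      section-0 : ∀ u → u < m → At 3 0 u
      section-0 u u<m with divided 4 u
      ... | 0 , zero , _ , refl = from-m (4 + 4 * (1 + q))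
        (linear 2 (λ m q → # 8 :+ 4 :* q :≡ m ∷ [] ⊢ # 4 :+ 4 :* (# 1 :+ q) :≡ m ∷ []) refl m q m≡q)
        (from₄ (1 + q) ≤-refl)
      ... | 0 , suc k , _ , refl = subst (At 3 0) (sym (*-suc 4 k)) (from₄ k (bound 4 k (subst (_< m) (*-suc 4 k) u<m)))
      ... | 1 , k , _ , refl = from₁ k (bound 1 k u<m)
      ... | 2 , k , _ , refl = from₂ k (bound 2 k u<m)
      ... | 3 , k , _ , refl = from₃ k (bound 3 k u<m)
      ... | suc (suc (suc (suc _))) , _ , s≤s (s≤s (s≤s (s≤s ()))) , _

    module _ (q : ℕ) (m≡q : 6 + 4 * q ≡ m) where
      private
        from₃ : ∀ k → k ≤ q → At 3 0 (3 + 4 * k)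
        from₃ k le = up 3 (s≤s z≤n) (from-start start) k
          (linear 3 (λ m q k → # 6 :+ 4 :* q :≡ m ∷ k :≤ q ∷ [] ⊢ # 3 :+ 4 :* k :≤ m ∷ []) refl m q k m≡q le)
        from₄ : ∀ k → k ≤ q → At 3 0 (4 + 4 * k)
        from₄ k le = up 4 (s≤s z≤n) (from-m-3 (3 + 4 * q)
          (linear 2 (λ m q → # 6 :+ 4 :* q :≡ m ∷ [] ⊢ # 6 :+ 4 :* q :≡ m ∷ []) refl m q m≡q)
          (from₃ q ≤-refl)) k
          (linear 3 (λ m q k → # 6 :+ 4 :* q :≡ m ∷ k :≤ q ∷ [] ⊢ # 4 :+ 4 :* k :≤ m ∷ []) refl m q k m≡q le)
        from₁ : ∀ k → k ≤ 1 + q → At 3 0 (1 + 4 * k)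
        from₁ k le = up 1 (s≤s z≤n) (from-m-2 (4 + 4 * q)
          (linear 2 (λ m q → # 6 :+ 4 :* q :≡ m ∷ [] ⊢ # 6 :+ 4 :* q :≡ m ∷ []) refl m q m≡q)
          (from₄ q ≤-refl)) k
          (linear 3 (λ m q k → # 6 :+ 4 :* q :≡ m ∷ k :≤ # 1 :+ q ∷ [] ⊢ # 1 :+ 4 :* k :≤ m ∷ []) refl m q k m≡q le)
        from₂ : ∀ k → k ≤ 1 + q → At 3 0 (2 + 4 * k)
        from₂ k le = up 2 (s≤s z≤n) (from-m-1 (1 + 4 * (1 + q))
          (linear 2 (λ m q → # 6 :+ 4 :* q :≡ m ∷ [] ⊢ # 2 :+ 4 :* (# 1 :+ q) :≡ m ∷ []) refl m q m≡q)
          (from₁ (1 + q) ≤-refl)) k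
          (linear 3 (λ m q k → # 6 :+ 4 :* q :≡ m ∷ k :≤ # 1 :+ q ∷ [] ⊢ # 2 :+ 4 :* k :≤ m ∷ []) refl m q k m≡q le)
        bound : ∀ r k → r + 4 * k < m → k ≤ 1 + q
        bound r k lt = linear 4 (λ m q r k → # 6 :+ 4 :* q :≡ m ∷ r :+ 4 :* k :< m ∷ [] ⊢ k :≤ # 1 :+ q ∷ [])
          refl m q r k m≡q lt
        bound′ : ∀ r k → 2 ≤ r → r + 4 * k < m → k ≤ q
        bound′ r k le lt = linear 4 (λ m q r k → # 6 :+ 4 :* q :≡ m ∷ # 2 :≤ r ∷ r :+ 4 :* k :< m ∷ [] ⊢ k :≤ q ∷ [])
          refl m q r k m≡q le lt

      -- For m ≡ 2 (mod 4) the classes are linked as 3, ..., m - 3 → 4, ..., m - 2 → 1, ..., m - 1 →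
      -- 2, ..., m.
      section-2 : ∀ u → u < m → At 3 0 u
      section-2 u u<m with divided 4 u
      ... | 0 , zero , _ , refl = from-m (2 + 4 * (1 + q))
        (linear 2 (λ m q → # 6 :+ 4 :* q :≡ m ∷ [] ⊢ # 2 :+ 4 :* (# 1 :+ q) :≡ m ∷ []) refl m q m≡q)
        (from₂ (1 + q) ≤-refl)
      ... | 0 , suc k , _ , refl = subst (At 3 0) (sym (*-suc 4 k))
        (from₄ k (bound′ 4 k (s≤s (s≤s z≤n)) (subst (_< m) (*-suc 4 k) u<m)))
      ... | 1 , k , _ , refl = from₁ k (bound 1 k u<m)
      ... | 2 , k , _ , refl = from₂ k (bound 2 k u<m)
      ... | 3 , k , _ , refl = from₃ k (bound′ 3 k (s≤s (s≤s z≤n)) u<m)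
      ... | suc (suc (suc (suc _))) , _ , s≤s (s≤s (s≤s (s≤s ()))) , _

    section : ∀ u → u < m → At 3 0 u
    section with divided 2 n
    ... | 0 , q , _ , eq = section-2 q
      (linear 3 (λ m n q → # 6 :+ 2 :* n :≡ m ∷ # 0 :+ 2 :* q :≡ n ∷ [] ⊢ # 6 :+ 4 :* q :≡ m ∷ []) refl m n q m≡ eq)
    ... | 1 , q , _ , eq = section-0 q
      (linear 3 (λ m n q → # 6 :+ 2 :* n :≡ m ∷ # 1 :+ 2 :* q :≡ n ∷ [] ⊢ # 8 :+ 4 :* q :≡ m ∷ []) refl m n q m≡ eq)
    ... | suc (suc _) , _ , s≤s (s≤s ()) , _

    column₁ : ∀ b → b < m → At 3 1 b
    column₁ 0 b<m = along-path 1 (λ m u → path (# 3 :+ u :≡ m ∷ []) (# 0 , u)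
      (once left ∷ once inner-top₂ ∷ once inner-top ∷ wrap₂ ∷ []) (# 1 , # 0)) refl m-3 m≡ (section m-3 m-3<m)
    column₁ 1 b<m = along-path 0 (λ m → path [] (# 0 , # 1) (once left₁ ∷ []) (# 1 , # 1)) refl (section 1 1<m)
    column₁ 2 b<m = along-path 0 (λ m → path [] (# 0 , # 1) (once left₁ ∷ once inner₁ ∷ []) (# 1 , # 2)) refl
      (section 1 1<m)
    column₁ (suc b@(suc (suc _))) b<m with trichotomy (2 + b) m
    ... | inj₁ lt = along-path 1 (λ m b → path (# 2 :≤ b ∷ # 2 :+ b :< m ∷ []) (# 0 , b)
      (once left ∷ []) (# 1 , # 1 :+ b)) refl b (s≤s (s≤s z≤n)) lt (section b (<-trans (n<1+n b) b<m))
    ... | inj₂ (inj₁ eq) = along-path 2 (λ m u b → path (# 3 :+ u :≡ m ∷ # 2 :+ b :≡ m ∷ []) (# 0 , u)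
      (once left ∷ once inner-top₂ ∷ []) (# 1 , # 1 :+ b)) refl m-3 b m≡ eq (section m-3 m-3<m)
    ... | inj₂ (inj₂ gt) = ⊥-elim (<⇒≱ gt b<m)

    column₂ : ∀ b → b < m → At 3 2 b
    column₂ 0 b<m = start
    column₂ 1 b<m = along-path 0 (λ m → path [] (# 1 , # 0) (once diagonal-bottom ∷ []) (# 2 , # 1)) refl
      (column₁ 0 0<m)
    column₂ 2 b<m = along-path 0 (λ m → path [] (# 2 , # 0) (once bottom₂ ∷ []) (# 2 , # 2)) refl start
    column₂ (suc b@(suc (suc _))) b<m with trichotomy (2 + b) m
    ... | inj₁ lt = along-path 1 (λ m b → path (# 2 :≤ b ∷ # 2 :+ b :< m ∷ []) (# 1 , b)
      (once left ∷ []) (# 2 , # 1 :+ b)) refl b (s≤s (s≤s z≤n)) lt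
      (column₁ b (<-trans (n<1+n b) b<m))
    ... | inj₂ (inj₁ eq) = along-path 2 (λ m u b → path (# 4 :+ u :≡ m ∷ # 2 :+ b :≡ m ∷ []) (# 1 , u)
      (once left ∷ once antidiagonal ∷ []) (# 2 , # 1 :+ b)) refl m-4 b m≡ eq (column₁ m-4 m-4<m)
    ... | inj₂ (inj₂ gt) = ⊥-elim (<⇒≱ gt b<m)

    next : ∀ a → 2 ≤ a → 1 + a < m → (∀ b → b < m → At 3 a b) → ∀ b → b < m → At 3 (1 + a) b
    next a 2≤a a<m known 0 b<m = along-path 2 (λ m a b → path (# 2 :≤ a ∷ # 1 :+ a :< m ∷ # 1 :+ b :≡ m ∷ []) (a , b)
      (once above ∷ wrap₂ ∷ []) (# 1 :+ a , # 0)) refl a m-1 2≤a a<m m≡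
      (known m-1 m-1<m)
    next a 2≤a a<m known 1 b<m with trichotomy (2 + a) m
    ... | inj₁ lt = along-path 2 (λ m a b → path (# 2 :≤ a ∷ # 2 :+ a :< m ∷ # 1 :+ b :≡ m ∷ []) (a , b)
      (once above ∷ wrap₂ ∷ once bottom ∷ []) (# 1 :+ a , # 1)) refl a m-1 2≤a lt m≡
      (known m-1 m-1<m)
    ... | inj₂ (inj₁ eq) = along-path 2 (λ m a b → path (# 2 :+ a :≡ m ∷ # 2 :+ b :≡ m ∷ []) (a , b)
      (once above ∷ once top-right ∷ wrap₂ ∷ []) (# 1 :+ a , # 1)) refl a m-2 eq m≡
      (known m-2 m-2<m)
    ... | inj₂ (inj₂ gt) = ⊥-elim (<⇒≱ gt a<m)
    next a 2≤a a<m known (suc b@(suc b′)) b<m with trichotomy (1 + (a + b)) m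
    ... | inj₁ lt = along-path 2 (λ m a b → path (# 2 :≤ a ∷ # 1 :≤ b ∷ # 1 :+ (a :+ b) :< m ∷ []) (a , b)
      (once below ∷ []) (# 1 :+ a , # 1 :+ b)) refl a b 2≤a (s≤s z≤n) lt
      (known b (<-trans (n<1+n b) b<m))
    ... | inj₂ (inj₂ gt) = along-path 2
      (λ m a b → path (# 2 :≤ a ∷ # 1 :+ a :< m ∷ # 1 :+ b :< m ∷ m :< # 1 :+ (a :+ b) ∷ []) (a , b)
      (once above ∷ []) (# 1 :+ a , # 1 :+ b)) refl a b 2≤a a<m b<m gt
      (known b (<-trans (n<1+n b) b<m))
    -- Here (a , b) lies on a + b = m - 1 and is shifted away to (a , b + 2). The target comes
    -- instead from (1 + a , b - 1) on the same line; how that point is reached depends on b.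
    ... | inj₂ (inj₁ eq) with b′
    ...   | 0 = along-path 2 (λ m a b → path (# 1 :+ (a :+ # 1) :≡ m ∷ # 1 :+ b :≡ m ∷ []) (a , b)
      (once above ∷ wrap₂ ∷ once corner ∷ []) (# 1 :+ a , # 2)) refl a m-1 eq m≡
      (known m-1 m-1<m)
    ...   | 1 = along-path 2 (λ m a b → path (# 2 :≤ a ∷ # 1 :+ (a :+ # 2) :≡ m ∷ # 1 :+ b :≡ m ∷ []) (a , b)
      (once above ∷ wrap₂ ∷ once bottom ∷ once antidiagonal ∷ []) (# 1 :+ a , # 3)) refl a m-1 2≤a eq m≡
      (known m-1 m-1<m)
    ...   | suc c@(suc _) = along-path 2
      (λ m a c → path (# 2 :≤ a ∷ # 1 :≤ c ∷ # 1 :+ (a :+ (# 2 :+ c)) :≡ m ∷ []) (a , c)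
      (once below ∷ once antidiagonal ∷ []) (# 1 :+ a , # 3 :+ c)) refl a c 2≤a (s≤s z≤n) eq
      (known c (<-trans (n<1+n c) (<-trans (n<1+n _) (<-trans (n<1+n _) b<m))))

    cover : ∀ a b → a < m → b < m → At 3 a b
    cover 0 b a<m b<m = section b b<m
    cover 1 b a<m b<m = column₁ b b<m
    cover 2 b a<m b<m = column₂ b b<m
    cover (suc a@(suc (suc _))) b a<m b<m =
      next a (s≤s (s≤s z≤n)) a<m (λ b → cover a b (<-trans (n<1+n a) a<m)) b b<m

-- Colour 1 with the table for m ≡ 0, 2 (mod 6)

module Colour1X where

  below above bottom-right top-left antidiagonal top-right bottom left inner-top low : Rule caseX-tree 1F
  below = rule (# 1 :≤ â ∷ # 3 :+ â :≤ m̂ ∷ # 2 :+ â :+ b̂ :≤ m̂ ∷ []) [] 1 1 refl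
  above = rule (# 2 :≤ â ∷ m̂ :≤ â :+ b̂ ∷ # 3 :+ â :+ b̂ :≤ 2 :* m̂ ∷ []) [] 1 1 refl
  bottom-right = rule (# 1 :+ â :≡ m̂ ∷ b̂ :≡ # 0 ∷ []) [] 1 1 refl
  top-left = rule (â :≡ # 0 ∷ # 1 :+ b̂ :≡ m̂ ∷ []) [] 1 1 refl
  antidiagonal = rule (# 1 :≤ â ∷ # 3 :+ â :≤ m̂ ∷ # 1 :+ â :+ b̂ :≡ m̂ ∷ []) [] 2 0 refl
  top-right = rule (# 1 :+ â :≡ m̂ ∷ # 1 :+ b̂ :≡ m̂ ∷ []) [] 2 0 refl
  bottom = rule (# 2 :+ â :≡ m̂ ∷ b̂ :≡ # 0 ∷ []) [] 2 0 refl
  left = rule (â :≡ # 0 ∷ # 1 :≤ b̂ ∷ # 2 :+ b̂ :≤ m̂ ∷ []) [] 1 0 refl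
  inner-top = rule (â :≡ # 1 ∷ # 1 :+ b̂ :≡ m̂ ∷ []) [] 1 0 refl
  low = rule (# 2 :+ â :≡ m̂ ∷ b̂ :≡ # 1 ∷ []) [] 1 0 refl

  module Cover (m : ℕ) .{{_ : NonZero m}} (n : ℕ) (m≡ : 6 + 2 * n ≡ m) (m%6 : (m % 6 ≡ᵇ 4) ≡ false) where

    open EvenModulus m n m≡

    abstract
      represents : ∀ {i j k} → i < m → j < m → k < m →
        Represents (m ∷ i ∷ j ∷ k ∷ []) caseX-tree (if (m % 6) ≡ᵇ 4 then caseY m i j k else caseX m i j k)
      represents i<m j<m k<m rewrite m%6 = caseX-represents 6≤m i<m j<m

    open Conclusion m 6≤m 1F caseX-tree represents public
    open Dynamics m 6≤m 1F caseX-tree represents public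

    start : At 3 2 0
    start = first-move {[]} refl

    -- Odd starts hit a + b = m - 1 on the first diagonal, where a - b gains 2. The left column
    -- gains 1 and flips the parity, so the second diagonal steps over. For even starts only the
    -- second diagonal hits. Either way the gain is 3.
    from-odd : ∀ w → 6 + 2 * w ≤ m → At 3 (1 + 2 * w) 0 → At 3 (4 + 2 * w) 0
    from-odd w = along-path 2 (λ m h w → path (2 :* h :≡ m ∷ # 6 :+ 2 :* w :≤ m ∷ []) (# 1 :+ 2 :* w , # 0)
      (h :- (# 1 :+ w) times below ∷ once antidiagonal ∷ h :- (# 2 :+ w) times above ∷ wrap₁ ∷ once left ∷
       form (# 1 :+ w) times below ∷ form (# 2 :+ w) times above ∷ wrap₂ ∷ []) (# 4 :+ 2 :* w , # 0)) refl h w 2h≡m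

    from-even : ∀ w → 1 ≤ w → 4 + 2 * w ≤ m → At 3 (2 * w) 0 → At 3 (3 + 2 * w) 0
    from-even w = along-path 2 (λ m h w → path (2 :* h :≡ m ∷ # 1 :≤ w ∷ # 4 :+ 2 :* w :≤ m ∷ []) (2 :* w , # 0)
      (h :- w times below ∷ h :- w times above ∷ wrap₁ ∷ once left ∷ w :- # 1 times below ∷ once antidiagonal ∷
       form (# 1 :+ w) times above ∷ wrap₂ ∷ []) (# 3 :+ 2 :* w , # 0)) refl h w 2h≡m

    from-m-3 : ∀ u → 3 + u ≡ m → At 3 u 0 → At 3 1 0
    from-m-3 u = along-path 2 (λ m h u → path (2 :* h :≡ m ∷ # 3 :+ u :≡ m ∷ []) (u , # 0)
      (once below ∷ once low ∷ once above ∷ wrap₁ ∷ once left ∷ h :- # 2 times below ∷ once antidiagonal ∷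
       h :- # 1 times above ∷ wrap₁ ∷ once top-left ∷ wrap₂ ∷ []) (# 1 , # 0)) refl h u 2h≡m

    from-m-2 : ∀ u → 2 + u ≡ m → At 3 u 0 → At 3 0 0
    from-m-2 = along-path 1 (λ m u → path (# 2 :+ u :≡ m ∷ []) (u , # 0) (once bottom ∷ wrap₁ ∷ []) (# 0 , # 0)) refl

    from-m-1 : ∀ u → 1 + u ≡ m → At 3 u 0 → At 3 3 0
    from-m-1 u = along-path 2 (λ m h u → path (2 :* h :≡ m ∷ # 1 :+ u :≡ m ∷ []) (u , # 0)
      (once bottom-right ∷ wrap₁ ∷ once left ∷ h :- # 1 times below ∷ h :- # 1 times above ∷ once top-right ∷ wrap₁ ∷
       once inner-top ∷ once above ∷ wrap₂ ∷ []) (# 3 , # 0)) refl h u 2h≡m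

    plus-3 : ∀ u → 1 ≤ u → 3 + u ≤ m-1 → At 3 u 0 → At 3 (3 + u) 0
    plus-3 u 1≤u le with divided 2 u
    ... | 0 , w , _ , refl = from-even w (linear 1 (λ w → # 1 :≤ 2 :* w ∷ [] ⊢ # 1 :≤ w ∷ []) refl w 1≤u)
      (linear 3 (λ m n w → # 6 :+ 2 :* n :≡ m ∷ # 3 :+ 2 :* w :≤ # 5 :+ 2 :* n ∷ [] ⊢ # 4 :+ 2 :* w :≤ m ∷ []) refl m n w m≡ le)
    ... | 1 , w , _ , refl = from-odd w
      (linear 3 (λ m n w → # 6 :+ 2 :* n :≡ m ∷ w :≤ n ∷ [] ⊢ # 6 :+ 2 :* w :≤ m ∷ []) refl m n w m≡
        (linear 2 (λ n w → # 4 :+ 2 :* w :≤ # 5 :+ 2 :* n ∷ [] ⊢ w :≤ n ∷ []) refl n w le))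
    ... | suc (suc _) , _ , s≤s (s≤s ()) , _

    up : ∀ s → 1 ≤ s → At 3 s 0 → ∀ k → s + 3 * k ≤ m-1 → At 3 (s + 3 * k) 0
    up = ladder {λ u → At 3 u 0} 3 m-1 plus-3

    module _ (q : ℕ) (m≡q : 6 + 6 * q ≡ m) where
      private
        le-m-1 : ∀ {u} → 1 + u ≤ m → u ≤ m-1
        le-m-1 {u} le = linear 3 (λ m n u → # 6 :+ 2 :* n :≡ m ∷ # 1 :+ u :≤ m ∷ [] ⊢ u :≤ # 5 :+ 2 :* n ∷ []) refl m n u m≡ le
        from₂ : ∀ k → k ≤ 1 + 2 * q → At 3 (2 + 3 * k) 0
        from₂ k le = up 2 (s≤s z≤n) start k (le-m-1
          (linear 3 (λ m q k → # 6 :+ 6 :* q :≡ m ∷ k :≤ # 1 :+ 2 :* q ∷ [] ⊢ # 3 :+ 3 :* k :≤ m ∷ []) refl m q k m≡q le))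
        from₃ : ∀ k → k ≤ 2 * q → At 3 (3 + 3 * k) 0
        from₃ k le = up 3 (s≤s z≤n) (from-m-1 (2 + 3 * (1 + 2 * q))
          (linear 2 (λ m q → # 6 :+ 6 :* q :≡ m ∷ [] ⊢ # 3 :+ 3 :* (# 1 :+ 2 :* q) :≡ m ∷ []) refl m q m≡q)
          (from₂ (1 + 2 * q) ≤-refl)) k (le-m-1
          (linear 3 (λ m q k → # 6 :+ 6 :* q :≡ m ∷ k :≤ 2 :* q ∷ [] ⊢ # 4 :+ 3 :* k :≤ m ∷ []) refl m q k m≡q le))
        from₁ : ∀ k → k ≤ 1 + 2 * q → At 3 (1 + 3 * k) 0
        from₁ k le = up 1 (s≤s z≤n) (from-m-3 (3 + 3 * (2 * q))
          (linear 2 (λ m q → # 6 :+ 6 :* q :≡ m ∷ [] ⊢ # 6 :+ 3 :* (2 :* q) :≡ m ∷ []) refl m q m≡q)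
          (from₃ (2 * q) ≤-refl)) k (le-m-1
          (linear 3 (λ m q k → # 6 :+ 6 :* q :≡ m ∷ k :≤ # 1 :+ 2 :* q ∷ [] ⊢ # 2 :+ 3 :* k :≤ m ∷ []) refl m q k m≡q le))

      -- For m ≡ 0 (mod 3) the classes modulo 3 are linked as 2, ..., m - 1 → 3, ..., m - 3 → 1,
      -- ..., m - 2 → 0.
      section-0 : ∀ u → u < m → At 3 u 0
      section-0 u u<m with divided 3 u
      ... | 0 , zero , _ , refl = from-m-2 (1 + 3 * (1 + 2 * q))
        (linear 2 (λ m q → # 6 :+ 6 :* q :≡ m ∷ [] ⊢ # 3 :+ 3 :* (# 1 :+ 2 :* q) :≡ m ∷ []) refl m q m≡q)
        (from₁ (1 + 2 * q) ≤-refl)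
      ... | 0 , suc k , _ , refl = subst (λ u → At 3 u 0) (sym (*-suc 3 k)) (from₃ k
        (linear 3 (λ m q k → # 6 :+ 6 :* q :≡ m ∷ 3 :* (# 1 :+ k) :< m ∷ [] ⊢ k :≤ 2 :* q ∷ []) refl m q k m≡q u<m))
      ... | 1 , k , _ , refl = from₁ k
        (linear 3 (λ m q k → # 6 :+ 6 :* q :≡ m ∷ # 1 :+ 3 :* k :< m ∷ [] ⊢ k :≤ # 1 :+ 2 :* q ∷ []) refl m q k m≡q u<m)
      ... | 2 , k , _ , refl = from₂ k
        (linear 3 (λ m q k → # 6 :+ 6 :* q :≡ m ∷ # 2 :+ 3 :* k :< m ∷ [] ⊢ k :≤ # 1 :+ 2 :* q ∷ []) refl m q k m≡q u<m)
      ... | suc (suc (suc _)) , _ , s≤s (s≤s (s≤s ())) , _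

    module _ (q : ℕ) (m≡q : 8 + 6 * q ≡ m) where
      private
        le-m-1 : ∀ {u} → 1 + u ≤ m → u ≤ m-1
        le-m-1 {u} le = linear 3 (λ m n u → # 6 :+ 2 :* n :≡ m ∷ # 1 :+ u :≤ m ∷ [] ⊢ u :≤ # 5 :+ 2 :* n ∷ []) refl m n u m≡ le
        from₂ : ∀ k → k ≤ 1 + 2 * q → At 3 (2 + 3 * k) 0
        from₂ k le = up 2 (s≤s z≤n) start k (le-m-1
          (linear 3 (λ m q k → # 8 :+ 6 :* q :≡ m ∷ k :≤ # 1 :+ 2 :* q ∷ [] ⊢ # 3 :+ 3 :* k :≤ m ∷ []) refl m q k m≡q le))
        from₁ : ∀ k → k ≤ 2 + 2 * q → At 3 (1 + 3 * k) 0
        from₁ k le = up 1 (s≤s z≤n) (from-m-3 (2 + 3 * (1 + 2 * q))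
          (linear 2 (λ m q → # 8 :+ 6 :* q :≡ m ∷ [] ⊢ # 5 :+ 3 :* (# 1 :+ 2 :* q) :≡ m ∷ []) refl m q m≡q)
          (from₂ (1 + 2 * q) ≤-refl)) k (le-m-1
          (linear 3 (λ m q k → # 8 :+ 6 :* q :≡ m ∷ k :≤ # 2 :+ 2 :* q ∷ [] ⊢ # 2 :+ 3 :* k :≤ m ∷ []) refl m q k m≡q le))
        from₃ : ∀ k → k ≤ 1 + 2 * q → At 3 (3 + 3 * k) 0
        from₃ k le = up 3 (s≤s z≤n) (from-m-1 (1 + 3 * (2 + 2 * q))
          (linear 2 (λ m q → # 8 :+ 6 :* q :≡ m ∷ [] ⊢ # 2 :+ 3 :* (# 2 :+ 2 :* q) :≡ m ∷ []) refl m q m≡q)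
          (from₁ (2 + 2 * q) ≤-refl)) k (le-m-1
          (linear 3 (λ m q k → # 8 :+ 6 :* q :≡ m ∷ k :≤ # 1 :+ 2 :* q ∷ [] ⊢ # 4 :+ 3 :* k :≤ m ∷ []) refl m q k m≡q le))

      -- For m ≡ 2 (mod 3) the classes are linked as 2, ..., m - 3 → 1, ..., m - 1 → 3, ..., m - 2 →
      -- 0.
      section-2 : ∀ u → u < m → At 3 u 0
      section-2 u u<m with divided 3 u
      ... | 0 , zero , _ , refl = from-m-2 (3 + 3 * (1 + 2 * q))
        (linear 2 (λ m q → # 8 :+ 6 :* q :≡ m ∷ [] ⊢ # 5 :+ 3 :* (# 1 :+ 2 :* q) :≡ m ∷ []) refl m q m≡q)
        (from₃ (1 + 2 * q) ≤-refl)
      ... | 0 , suc k , _ , refl = subst (λ u → At 3 u 0) (sym (*-suc 3 k)) (from₃ k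
        (linear 3 (λ m q k → # 8 :+ 6 :* q :≡ m ∷ 3 :* (# 1 :+ k) :< m ∷ [] ⊢ k :≤ # 1 :+ 2 :* q ∷ []) refl m q k m≡q u<m))
      ... | 1 , k , _ , refl = from₁ k
        (linear 3 (λ m q k → # 8 :+ 6 :* q :≡ m ∷ # 1 :+ 3 :* k :< m ∷ [] ⊢ k :≤ # 2 :+ 2 :* q ∷ []) refl m q k m≡q u<m)
      ... | 2 , k , _ , refl = from₂ k
        (linear 3 (λ m q k → # 8 :+ 6 :* q :≡ m ∷ # 2 :+ 3 :* k :< m ∷ [] ⊢ k :≤ # 1 :+ 2 :* q ∷ []) refl m q k m≡q u<m)
      ... | suc (suc (suc _)) , _ , s≤s (s≤s (s≤s ())) , _

    left-column : ∀ b → 1 + b < m → (∀ a → a < m → At 3 a b) → At 3 0 (1 + b)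
    left-column zero b<m known = along-path 1 (λ m x → path (# 1 :+ x :≡ m ∷ []) (x , # 0)
      (once bottom-right ∷ wrap₁ ∷ []) (# 0 , # 1)) refl m-1 m≡ (known m-1 m-1<m)
    left-column b@(suc _) b<m known = along-path 2 (λ m x b → path (# 1 :+ x :≡ m ∷ # 1 :≤ b ∷ # 1 :+ b :< m ∷ []) (x , b)
      (once above ∷ wrap₁ ∷ []) (# 0 , # 1 :+ b)) refl m-1 b m≡ (s≤s z≤n) b<m (known m-1 m-1<m)

    column₁ : ∀ b → 1 + b < m → (∀ a → a < m → At 3 a b) → At 3 1 (1 + b)
    column₁ b b<m known with trichotomy (2 + b) m
    ... | inj₁ lt = along-path 1 (λ m b → path (# 2 :+ b :< m ∷ []) (# 0 , # 1 :+ b)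
      (once left ∷ []) (# 1 , # 1 :+ b)) refl b lt (left-column b b<m known)
    ... | inj₂ (inj₁ eq) = along-path 2 (λ m x b → path (# 2 :+ x :≡ m ∷ # 2 :+ b :≡ m ∷ []) (x , b)
      (once above ∷ once top-right ∷ wrap₁ ∷ []) (# 1 , # 1 :+ b)) refl m-2 b m≡ eq (known m-2 m-2<m)
    ... | inj₂ (inj₂ gt) = ⊥-elim (<⇒≱ gt b<m)

    next : ∀ b → 1 + b < m → (∀ a → a < m → At 3 a b) → ∀ a → a < m → At 3 a (1 + b)
    next b b<m known 0 a<m = left-column b b<m known
    next b b<m known 1 a<m = column₁ b b<m known
    next b b<m known (suc a@(suc a′)) a<m with trichotomy (1 + (a + b)) m
    ... | inj₁ lt with trichotomy (2 + a) m
    ...   | inj₁ lt′ = along-path 2 (λ m a b → path (# 1 :≤ a ∷ # 2 :+ a :< m ∷ # 1 :+ (a :+ b) :< m ∷ []) (a , b)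
      (once below ∷ []) (# 1 :+ a , # 1 :+ b)) refl a b (s≤s z≤n) lt′ lt (known a (<-trans (n<1+n a) a<m))
    ...   | inj₂ (inj₁ eq) = along-path 3 (λ m x a b → path (# 3 :+ x :≡ m ∷ # 2 :+ a :≡ m ∷ # 1 :+ (a :+ b) :< m ∷ []) (x , b)
      (once below ∷ once low ∷ []) (# 1 :+ a , # 1 :+ b)) refl m-3 a b m≡ eq lt (known m-3 m-3<m)
    ...   | inj₂ (inj₂ gt) = ⊥-elim (<⇒≱ gt a<m)
    next b b<m known (suc a@(suc a′)) a<m | inj₂ (inj₂ gt) = along-path 2
      (λ m a b → path (# 1 :≤ a ∷ # 1 :+ a :< m ∷ # 1 :+ b :< m ∷ m :< # 1 :+ (a :+ b) ∷ []) (a , b)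
      (once above ∷ []) (# 1 :+ a , # 1 :+ b)) refl a b (s≤s z≤n) a<m b<m gt (known a (<-trans (n<1+n a) a<m))
    -- As (a , b) is shifted away by (2 , 0), the target is the shift of (a - 1 , 1 + b) on the same
    -- antidiagonal. For a = 1 that point would be the exceptional (0 , m - 1), and the target comes
    -- through `inner-top` instead.
    next b b<m known (suc a@(suc a′)) a<m | inj₂ (inj₁ eq) with a′
    ... | 0 = along-path 2 (λ m x b → path (# 2 :+ x :≡ m ∷ # 2 :+ b :≡ m ∷ []) (x , b)
      (once above ∷ once top-right ∷ wrap₁ ∷ once inner-top ∷ []) (# 2 , # 1 :+ b)) refl m-2 b m≡ eq (known m-2 m-2<m)
    ... | 1 = along-path 2 (λ m x b → path (# 1 :+ x :≡ m ∷ # 3 :+ b :≡ m ∷ []) (x , b)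
      (once above ∷ wrap₁ ∷ once left ∷ once antidiagonal ∷ []) (# 3 , # 1 :+ b)) refl m-1 b m≡ eq (known m-1 m-1<m)
    ... | suc c@(suc _) = along-path 2 (λ m c b → path (# 1 :≤ c ∷ # 3 :+ c :< m ∷ # 3 :+ (c :+ b) :≡ m ∷ []) (c , b)
      (once below ∷ once antidiagonal ∷ []) (# 3 :+ c , # 1 :+ b)) refl c b (s≤s z≤n) a<m eq
      (known c (<-trans (n<1+n c) (<-trans (n<1+n _) (<-trans (n<1+n _) a<m))))

    cover : (∀ u → u < m → At 3 u 0) → ∀ b → b < m → ∀ a → a < m → At 3 a b
    cover section zero b<m a a<m = section a a<m
    cover section (suc b) b<m a a<m = next b b<m (cover section b (<-trans (n<1+n b) b<m)) a a<m

-- Colour 1 with the table for m ≡ 4 (mod 6)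

module Colour1Y where

  below above bottom-right top-left antidiagonal top-right bottom bottom₁ left inner₁ inner₂ low : Rule caseY-tree 1F
  below = rule (# 2 :≤ â ∷ # 3 :+ â :≤ m̂ ∷ # 2 :+ â :+ b̂ :≤ m̂ ∷ []) [] 1 1 refl
  above = rule (# 3 :≤ â ∷ m̂ :≤ â :+ b̂ ∷ # 3 :+ â :+ b̂ :≤ 2 :* m̂ ∷ []) [] 1 1 refl
  bottom-right = rule (# 1 :+ â :≡ m̂ ∷ b̂ :≡ # 0 ∷ []) [] 1 1 refl
  top-left = rule (â :≡ # 0 ∷ # 1 :+ b̂ :≡ m̂ ∷ []) [] 1 1 refl
  antidiagonal = rule (# 2 :≤ â ∷ # 3 :+ â :≤ m̂ ∷ # 1 :+ â :+ b̂ :≡ m̂ ∷ []) [] 2 0 refl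
  top-right = rule (# 1 :+ â :≡ m̂ ∷ # 1 :+ b̂ :≡ m̂ ∷ []) [] 2 0 refl
  bottom = rule (# 2 :+ â :≡ m̂ ∷ b̂ :≡ # 0 ∷ []) [] 2 0 refl
  bottom₁ = rule (â :≡ # 1 ∷ b̂ :≡ # 0 ∷ []) [] 2 0 refl
  left = rule (â :≡ # 0 ∷ # 1 :≤ b̂ ∷ # 2 :+ b̂ :≤ m̂ ∷ []) [] 1 0 refl
  -- On a = 1 different clauses of the table apply for b ≤ m - 3, b = m - 2 and b = m - 1. All of
  -- them give colour 1 its own direction.
  inner₁ = rule (â :≡ # 1 ∷ # 1 :≤ b̂ ∷ []) ((# 2 :+ b̂ , m̂) ∷ (# 1 :+ b̂ , m̂) ∷ []) 1 0 refl
  inner₂ = rule (â :≡ # 2 ∷ m̂ :≤ # 2 :+ b̂ ∷ []) ((# 2 :+ b̂ , # 1 :+ m̂) ∷ []) 1 0 refl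
  low = rule (# 2 :+ â :≡ m̂ ∷ b̂ :≡ # 1 ∷ []) [] 1 0 refl

  module Cover (m : ℕ) .{{_ : NonZero m}} (q : ℕ) (m≡q : 10 + 6 * q ≡ m) (m%6 : (m % 6 ≡ᵇ 4) ≡ true) where

    n : ℕ
    n = 2 + 3 * q

    m≡ : 6 + 2 * n ≡ m
    m≡ = linear 2 (λ m q → # 10 :+ 6 :* q :≡ m ∷ [] ⊢ # 6 :+ 2 :* (# 2 :+ 3 :* q) :≡ m ∷ []) refl m q m≡q

    10≤m : 10 ≤ m
    10≤m = linear 2 (λ m q → # 10 :+ 6 :* q :≡ m ∷ [] ⊢ # 10 :≤ m ∷ []) refl m q m≡q

    open EvenModulus m n m≡

    abstract
      represents : ∀ {i j k} → i < m → j < m → k < m →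
        Represents (m ∷ i ∷ j ∷ k ∷ []) caseY-tree (if (m % 6) ≡ᵇ 4 then caseY m i j k else caseX m i j k)
      represents i<m j<m k<m rewrite m%6 = caseY-represents 6≤m i<m j<m

    open Conclusion m 6≤m 1F caseY-tree represents public
    open Dynamics m 6≤m 1F caseY-tree represents public

    start : At 3 2 0
    start = first-move {[]} refl

    from-1 : At 3 1 0 → At 3 3 0
    from-1 = along-path 0 (λ m → path [] (# 1 , # 0) (once bottom₁ ∷ []) (# 3 , # 0)) refl

    from-2 : At 3 2 0 → At 3 5 0
    from-2 = along-path 1 (λ m h → path (2 :* h :≡ m ∷ []) (# 2 , # 0)
      (h :- # 1 times below ∷ h :- # 1 times above ∷ wrap₁ ∷ once left ∷ once inner₁ ∷ once inner₂ ∷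
       form (# 2) times above ∷ wrap₂ ∷ []) (# 5 , # 0)) refl h 2h≡m

    -- Columns 0 and 1 each shift by (1 , 0), which together keeps the parity of a + b. Even starts
    -- therefore never hit a + b = m - 1, and a - b gains 2.
    from-even : ∀ w → 2 ≤ w → 4 + 2 * w ≤ m → At 3 (2 * w) 0 → At 3 (2 + 2 * w) 0
    from-even w = along-path 2 (λ m h w → path (2 :* h :≡ m ∷ # 2 :≤ w ∷ # 4 :+ 2 :* w :≤ m ∷ []) (2 :* w , # 0)
      (h :- w times below ∷ h :- w times above ∷ wrap₁ ∷ once left ∷ once inner₁ ∷
       w :- # 1 times below ∷ form (# 1 :+ w) times above ∷ wrap₂ ∷ []) (# 2 :+ 2 :* w , # 0)) refl h w 2h≡m

    -- With the parity kept, both diagonals hit a + b = m - 1, and a - b gains 2 + 1 + 1 + 2 = 6.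
    from-odd : ∀ w → 1 ≤ w → 8 + 2 * w ≤ m → At 3 (1 + 2 * w) 0 → At 3 (7 + 2 * w) 0
    from-odd w = along-path 2 (λ m h w → path (2 :* h :≡ m ∷ # 1 :≤ w ∷ # 8 :+ 2 :* w :≤ m ∷ []) (# 1 :+ 2 :* w , # 0)
      (h :- (# 1 :+ w) times below ∷ once antidiagonal ∷ h :- (# 2 :+ w) times above ∷ wrap₁ ∷ once left ∷ once inner₁ ∷
       form w times below ∷ once antidiagonal ∷ form (# 3 :+ w) times above ∷ wrap₂ ∷ []) (# 7 :+ 2 :* w , # 0)) refl h w 2h≡m

    from-m-5 : ∀ w → 1 ≤ w → 6 + 2 * w ≡ m → At 3 (1 + 2 * w) 0 → At 3 1 0
    from-m-5 w = along-path 2 (λ m h w → path (2 :* h :≡ m ∷ # 1 :≤ w ∷ # 6 :+ 2 :* w :≡ m ∷ []) (# 1 :+ 2 :* w , # 0)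
      (h :- (# 1 :+ w) times below ∷ once antidiagonal ∷ h :- (# 2 :+ w) times above ∷ wrap₁ ∷ once left ∷ once inner₁ ∷
       form w times below ∷ once antidiagonal ∷ form (# 2 :+ w) times above ∷ wrap₁ ∷ once top-left ∷ wrap₂ ∷ [])
      (# 1 , # 0)) refl h w 2h≡m

    from-m-3 : ∀ u → 3 + u ≡ m → At 3 u 0 → At 3 4 0
    from-m-3 u = along-path 2 (λ m h u → path (2 :* h :≡ m ∷ # 3 :+ u :≡ m ∷ []) (u , # 0)
      (once below ∷ once low ∷ once above ∷ wrap₁ ∷ once left ∷ once inner₁ ∷ h :- # 2 times below ∷
       h :- # 1 times above ∷ once top-right ∷ wrap₁ ∷ once inner₁ ∷ once inner₂ ∷ once above ∷ wrap₂ ∷ []) (# 4 , # 0))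
      refl h u 2h≡m

    from-m-2 : ∀ u → 2 + u ≡ m → At 3 u 0 → At 3 0 0
    from-m-2 = along-path 1 (λ m u → path (# 2 :+ u :≡ m ∷ []) (u , # 0) (once bottom ∷ wrap₁ ∷ []) (# 0 , # 0)) refl

    from-m-1 : ∀ u → 1 + u ≡ m → At 3 u 0 → At 3 7 0
    from-m-1 u = along-path 2 (λ m h u → path (2 :* h :≡ m ∷ # 10 :≤ m ∷ # 1 :+ u :≡ m ∷ []) (u , # 0)
      (once bottom-right ∷ wrap₁ ∷ once left ∷ once inner₁ ∷ h :- # 2 times below ∷ once antidiagonal ∷
       h :- # 2 times above ∷ wrap₁ ∷ once left ∷ once inner₁ ∷ once antidiagonal ∷ form (# 3) times above ∷ wrap₂ ∷ [])
      (# 7 , # 0)) refl h u 2h≡m 10≤m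

    plus-6 : ∀ w → 1 ≤ w → ∀ k → 2 + 2 * w + 6 * k ≤ m → At 3 (1 + 2 * w) 0 → At 3 (1 + 2 * w + 6 * k) 0
    plus-6 w 1≤w k le p = progression {λ u → At 3 u 0} (1 + 2 * w) 6 k next p k ≤-refl
      where
      next : ∀ j → j < k → At 3 (1 + 2 * w + 6 * j) 0 → At 3 (6 + (1 + 2 * w + 6 * j)) 0
      next j j<k r = subst (λ u → At 3 u 0)
        (linear 2 (λ w j → [] ⊢ # 7 :+ 2 :* (w :+ 3 :* j) :≡ # 6 :+ (# 1 :+ 2 :* w :+ 6 :* j) ∷ []) refl w j)
        (from-odd (w + 3 * j) (≤-trans 1≤w (m≤m+n w (3 * j)))
          (linear 4 (λ m w j k → # 2 :+ 2 :* w :+ 6 :* k :≤ m ∷ j :< k ∷ [] ⊢ # 8 :+ 2 :* (w :+ 3 :* j) :≤ m ∷ [])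
            refl m w j k le j<k)
          (subst (λ u → At 3 u 0)
            (linear 2 (λ w j → [] ⊢ # 1 :+ 2 :* w :+ 6 :* j :≡ # 1 :+ 2 :* (w :+ 3 :* j) ∷ []) refl w j) r))

    from₅ : ∀ k → k ≤ q → At 3 (5 + 6 * k) 0
    from₅ k le = plus-6 2 (s≤s z≤n) k
      (linear 3 (λ m q k → # 10 :+ 6 :* q :≡ m ∷ k :≤ q ∷ [] ⊢ # 6 :+ 6 :* k :≤ m ∷ []) refl m q k m≡q le) (from-2 start)

    at-1 : At 3 1 0
    at-1 = from-m-5 (2 + 3 * q) (s≤s z≤n)
      (linear 2 (λ m q → # 10 :+ 6 :* q :≡ m ∷ [] ⊢ # 6 :+ 2 :* (# 2 :+ 3 :* q) :≡ m ∷ []) refl m q m≡q)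
      (subst (λ u → At 3 u 0) (linear 1 (λ q → [] ⊢ # 5 :+ 6 :* q :≡ # 1 :+ 2 :* (# 2 :+ 3 :* q) ∷ []) refl q) (from₅ q ≤-refl))

    from₃ : ∀ k → k ≤ 1 + q → At 3 (3 + 6 * k) 0
    from₃ k le = plus-6 1 (s≤s z≤n) k
      (linear 3 (λ m q k → # 10 :+ 6 :* q :≡ m ∷ k :≤ # 1 :+ q ∷ [] ⊢ # 4 :+ 6 :* k :≤ m ∷ []) refl m q k m≡q le) (from-1 at-1)

    from₇ : ∀ k → k ≤ q → At 3 (7 + 6 * k) 0
    from₇ k le = plus-6 3 (s≤s z≤n) k
      (linear 3 (λ m q k → # 10 :+ 6 :* q :≡ m ∷ k :≤ q ∷ [] ⊢ # 8 :+ 6 :* k :≤ m ∷ []) refl m q k m≡q le)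
      (from-m-1 (3 + 6 * (1 + q))
        (linear 2 (λ m q → # 10 :+ 6 :* q :≡ m ∷ [] ⊢ # 4 :+ 6 :* (# 1 :+ q) :≡ m ∷ []) refl m q m≡q) (from₃ (1 + q) ≤-refl))

    from₄ : ∀ k → k ≤ 2 + 3 * q → At 3 (4 + 2 * k) 0
    from₄ = progression {λ u → At 3 u 0} 4 2 (2 + 3 * q) next (from-m-3 (7 + 6 * q)
      (linear 2 (λ m q → # 10 :+ 6 :* q :≡ m ∷ [] ⊢ # 3 :+ (# 7 :+ 6 :* q) :≡ m ∷ []) refl m q m≡q) (from₇ q ≤-refl))
      where
      next : ∀ k → k < 2 + 3 * q → At 3 (4 + 2 * k) 0 → At 3 (6 + 2 * k) 0
      next k lt r = subst (λ u → At 3 u 0) (linear 1 (λ k → [] ⊢ # 2 :+ 2 :* (# 2 :+ k) :≡ # 6 :+ 2 :* k ∷ []) refl k)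
        (from-even (2 + k) (s≤s (s≤s z≤n))
          (linear 3 (λ m q k → # 10 :+ 6 :* q :≡ m ∷ k :< # 2 :+ 3 :* q ∷ [] ⊢ # 4 :+ 2 :* (# 2 :+ k) :≤ m ∷ []) refl m q k m≡q lt)
          (subst (λ u → At 3 u 0) (linear 1 (λ k → [] ⊢ # 4 :+ 2 :* k :≡ 2 :* (# 2 :+ k) ∷ []) refl k) r))

    residue₀ : ∀ k → 0 + 6 * k < m → At 3 (0 + 6 * k) 0
    residue₀ zero lt = from-m-2 (4 + 2 * (2 + 3 * q))
      (linear 2 (λ m q → # 10 :+ 6 :* q :≡ m ∷ [] ⊢ # 6 :+ 2 :* (# 2 :+ 3 :* q) :≡ m ∷ []) refl m q m≡q) (from₄ (2 + 3 * q) ≤-refl)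
    residue₀ (suc k) lt = subst (λ u → At 3 u 0)
      (linear 1 (λ k → [] ⊢ # 4 :+ 2 :* (# 1 :+ 3 :* k) :≡ 6 :* (# 1 :+ k) ∷ []) refl k) (from₄ (1 + 3 * k)
      (linear 3 (λ m q k → # 10 :+ 6 :* q :≡ m ∷ 6 :* (# 1 :+ k) :< m ∷ [] ⊢ # 1 :+ 3 :* k :≤ # 2 :+ 3 :* q ∷ []) refl m q k m≡q lt))

    residue₁ : ∀ k → 1 + 6 * k < m → At 3 (1 + 6 * k) 0
    residue₁ zero lt = at-1
    residue₁ (suc k) lt = subst (λ u → At 3 u 0)
      (linear 1 (λ k → [] ⊢ # 7 :+ 6 :* k :≡ # 1 :+ 6 :* (# 1 :+ k) ∷ []) refl k) (from₇ k
      (linear 3 (λ m q k → # 10 :+ 6 :* q :≡ m ∷ # 1 :+ 6 :* (# 1 :+ k) :< m ∷ [] ⊢ k :≤ q ∷ []) refl m q k m≡q lt))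

    residue₂ : ∀ k → 2 + 6 * k < m → At 3 (2 + 6 * k) 0
    residue₂ zero lt = start
    residue₂ (suc k) lt = subst (λ u → At 3 u 0)
      (linear 1 (λ k → [] ⊢ # 4 :+ 2 :* (# 2 :+ 3 :* k) :≡ # 2 :+ 6 :* (# 1 :+ k) ∷ []) refl k) (from₄ (2 + 3 * k)
      (linear 3 (λ m q k → # 10 :+ 6 :* q :≡ m ∷ # 2 :+ 6 :* (# 1 :+ k) :< m ∷ [] ⊢ # 2 :+ 3 :* k :≤ # 2 :+ 3 :* q ∷ []) refl m q k m≡q lt))

    residue₃ : ∀ k → 3 + 6 * k < m → At 3 (3 + 6 * k) 0
    residue₃ k lt = from₃ k
      (linear 3 (λ m q k → # 10 :+ 6 :* q :≡ m ∷ # 3 :+ 6 :* k :< m ∷ [] ⊢ k :≤ # 1 :+ q ∷ []) refl m q k m≡q lt)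

    residue₄ : ∀ k → 4 + 6 * k < m → At 3 (4 + 6 * k) 0
    residue₄ k lt = subst (λ u → At 3 u 0)
      (linear 1 (λ k → [] ⊢ # 4 :+ 2 :* (3 :* k) :≡ # 4 :+ 6 :* k ∷ []) refl k) (from₄ (3 * k)
      (linear 3 (λ m q k → # 10 :+ 6 :* q :≡ m ∷ # 4 :+ 6 :* k :< m ∷ [] ⊢ 3 :* k :≤ # 2 :+ 3 :* q ∷ []) refl m q k m≡q lt))

    residue₅ : ∀ k → 5 + 6 * k < m → At 3 (5 + 6 * k) 0
    residue₅ k lt = from₅ k
      (linear 3 (λ m q k → # 10 :+ 6 :* q :≡ m ∷ # 5 :+ 6 :* k :< m ∷ [] ⊢ k :≤ q ∷ []) refl m q k m≡q lt)

    residue : ∀ r k → r < 6 → r + 6 * k < m → At 3 (r + 6 * k) 0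
    residue 0 k _ = residue₀ k
    residue 1 k _ = residue₁ k
    residue 2 k _ = residue₂ k
    residue 3 k _ = residue₃ k
    residue 4 k _ = residue₄ k
    residue 5 k _ = residue₅ k
    residue (suc (suc (suc (suc (suc (suc _)))))) _ (s≤s (s≤s (s≤s (s≤s (s≤s (s≤s ()))))))

    -- The cycle is 2 → 5, ..., m - 5 → 1 → 3, ..., m - 1 → 7, ..., m - 3 → 4, ..., m - 2 → 0 → 2,
    -- with steps of 6 through the odd classes and of 2 from 4 on.
    section : ∀ u → u < m → At 3 u 0
    section = by-residue 6 residue

    left-column : ∀ b → 1 + b < m → (∀ a → a < m → At 3 a b) → At 3 0 (1 + b)
    left-column zero b<m known = along-path 1 (λ m x → path (# 1 :+ x :≡ m ∷ []) (x , # 0)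
      (once bottom-right ∷ wrap₁ ∷ []) (# 0 , # 1)) refl m-1 m≡ (known m-1 m-1<m)
    left-column b@(suc _) b<m known = along-path 2 (λ m x b → path (# 1 :+ x :≡ m ∷ # 1 :≤ b ∷ # 1 :+ b :< m ∷ []) (x , b)
      (once above ∷ wrap₁ ∷ []) (# 0 , # 1 :+ b)) refl m-1 b m≡ (s≤s z≤n) b<m (known m-1 m-1<m)

    column₁ : ∀ b → 1 + b < m → (∀ a → a < m → At 3 a b) → At 3 1 (1 + b)
    column₁ b b<m known with trichotomy (2 + b) m
    ... | inj₁ lt = along-path 1 (λ m b → path (# 2 :+ b :< m ∷ []) (# 0 , # 1 :+ b)
      (once left ∷ []) (# 1 , # 1 :+ b)) refl b lt (left-column b b<m known)
    ... | inj₂ (inj₁ eq) = along-path 2 (λ m x b → path (# 2 :+ x :≡ m ∷ # 2 :+ b :≡ m ∷ []) (x , b)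
      (once above ∷ once top-right ∷ wrap₁ ∷ []) (# 1 , # 1 :+ b)) refl m-2 b m≡ eq (known m-2 m-2<m)
    ... | inj₂ (inj₂ gt) = ⊥-elim (<⇒≱ gt b<m)

    column₂ : ∀ b → 1 + b < m → (∀ a → a < m → At 3 a b) → At 3 2 (1 + b)
    column₂ b b<m known = along-path 1 (λ m b → path (# 1 :+ b :< m ∷ []) (# 1 , # 1 :+ b)
      (once inner₁ ∷ []) (# 2 , # 1 :+ b)) refl b b<m (column₁ b b<m known)

    column₃ : ∀ b → 1 + b < m → (∀ a → a < m → At 3 a b) → At 3 3 (1 + b)
    column₃ b b<m known with <-≤-connex (3 + b) m
    ... | inj₁ lt = along-path 1 (λ m b → path (# 3 :+ b :< m ∷ []) (# 2 , b)
      (once below ∷ []) (# 3 , # 1 :+ b)) refl b lt (known 2 (≤-trans (s≤s (s≤s (s≤s z≤n))) 6≤m))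
    ... | inj₂ ge = along-path 1 (λ m b → path (m :≤ # 3 :+ b ∷ # 1 :+ b :< m ∷ []) (# 2 , # 1 :+ b)
      (once inner₂ ∷ []) (# 3 , # 1 :+ b)) refl b ge b<m (column₂ b b<m known)

    next-below : ∀ a b → 2 ≤ a → 1 + a < m → 1 + (a + b) < m → (∀ a → a < m → At 3 a b) → At 3 (1 + a) (1 + b)
    next-below a b 2≤a a<m lt known with trichotomy (2 + a) m
    ... | inj₁ lt′ = along-path 2 (λ m a b → path (# 2 :≤ a ∷ # 2 :+ a :< m ∷ # 1 :+ (a :+ b) :< m ∷ []) (a , b)
      (once below ∷ []) (# 1 :+ a , # 1 :+ b)) refl a b 2≤a lt′ lt (known a (<-trans (n<1+n a) a<m))
    ... | inj₂ (inj₁ eq) = along-path 3 (λ m x a b → path (# 3 :+ x :≡ m ∷ # 2 :+ a :≡ m ∷ # 1 :+ (a :+ b) :< m ∷ []) (x , b)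
      (once below ∷ once low ∷ []) (# 1 :+ a , # 1 :+ b)) refl m-3 a b m≡ eq lt (known m-3 m-3<m)
    ... | inj₂ (inj₂ gt) = ⊥-elim (<⇒≱ gt a<m)

    next-above : ∀ a b → 3 ≤ a → 1 + a < m → 1 + b < m → m < 1 + (a + b) → (∀ a → a < m → At 3 a b) → At 3 (1 + a) (1 + b)
    next-above a b 3≤a a<m b<m gt known = along-path 2
      (λ m a b → path (# 3 :≤ a ∷ # 1 :+ a :< m ∷ # 1 :+ b :< m ∷ m :< # 1 :+ (a :+ b) ∷ []) (a , b)
      (once above ∷ []) (# 1 :+ a , # 1 :+ b)) refl a b 3≤a a<m b<m gt (known a (<-trans (n<1+n a) a<m))

    -- The target is the antidiagonal shift of (2 + c , 1 + b). For c = 0 this point is supplied by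
    -- `column₂` in the new row; otherwise it has a diagonal predecessor in row b.
    next-on : ∀ c b → 4 + c < m → 1 + b < m → 4 + (c + b) ≡ m → (∀ a → a < m → At 3 a b) → At 3 (4 + c) (1 + b)
    next-on zero b a<m b<m eq known = along-path 1 (λ m b → path (# 4 :+ b :≡ m ∷ []) (# 2 , # 1 :+ b)
      (once antidiagonal ∷ []) (# 4 , # 1 :+ b)) refl b eq (column₂ b b<m known)
    next-on (suc c) b a<m b<m eq known = along-path 2
      (λ m c b → path (# 2 :≤ c ∷ # 3 :+ c :< m ∷ # 3 :+ (c :+ b) :≡ m ∷ []) (c , b)
      (once below ∷ once antidiagonal ∷ []) (# 3 :+ c , # 1 :+ b)) refl (2 + c) b (s≤s (s≤s z≤n)) a<m eq
      (known (2 + c) (<-trans (n<1+n _) (<-trans (n<1+n _) (<-trans (n<1+n _) a<m))))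

    next-high : ∀ c b → 4 + c < m → 1 + b < m → (∀ a → a < m → At 3 a b) → At 3 (4 + c) (1 + b)
    next-high c b a<m b<m known with trichotomy (4 + (c + b)) m
    ... | inj₁ lt = next-below (3 + c) b (s≤s (s≤s z≤n)) a<m lt known
    ... | inj₂ (inj₁ eq) = next-on c b a<m b<m eq known
    ... | inj₂ (inj₂ gt) = next-above (3 + c) b (s≤s (s≤s (s≤s z≤n))) a<m b<m gt known

    next : ∀ b → 1 + b < m → (∀ a → a < m → At 3 a b) → ∀ a → a < m → At 3 a (1 + b)
    next b b<m known 0 a<m = left-column b b<m known
    next b b<m known 1 a<m = column₁ b b<m known
    next b b<m known 2 a<m = column₂ b b<m known
    next b b<m known 3 a<m = column₃ b b<m known
    next b b<m known (suc (suc (suc (suc c)))) a<m = next-high c b a<m b<m known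

    cover : ∀ b → b < m → ∀ a → a < m → At 3 a b
    cover zero b<m a a<m = section a a<m
    cover (suc b) b<m a a<m = next b b<m (cover b (<-trans (n<1+n b) b<m)) a a<m

-- The two tables give colour 2 the same directions, so its rules are stated once and checked against both.
module Colour2 where

  data Rule₂ : Set where
    bottom below above origin row₁ row₁-end antidiagonal antidiagonal₁ antidiagonal₂ top top-left right corner right₂ : Rule₂

  atoms₂ : Rule₂ → List Atom
  atoms₂ bottom = # 1 :≤ â ∷ # 2 :+ â :≤ m̂ ∷ b̂ :≡ # 0 ∷ []
  atoms₂ below = # 2 :≤ b̂ ∷ # 2 :+ b̂ :≤ m̂ ∷ # 1 :+ â :+ b̂ :≤ m̂ ∷ []
  atoms₂ above = # 2 :≤ b̂ ∷ # 2 :+ b̂ :≤ m̂ ∷ # 2 :+ â :≤ m̂ ∷ # 1 :+ m̂ :≤ â :+ b̂ ∷ []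
  atoms₂ origin = at-origin
  atoms₂ row₁ = # 2 :+ â :≤ m̂ ∷ b̂ :≡ # 1 ∷ []
  atoms₂ row₁-end = # 1 :+ â :≡ m̂ ∷ b̂ :≡ # 1 ∷ []
  atoms₂ antidiagonal = # 3 :≤ â ∷ # 2 :+ â :≤ m̂ ∷ â :+ b̂ :≡ m̂ ∷ []
  atoms₂ antidiagonal₁ = â :≡ # 1 ∷ # 1 :+ b̂ :≡ m̂ ∷ []
  atoms₂ antidiagonal₂ = â :≡ # 2 ∷ # 2 :+ b̂ :≡ m̂ ∷ []
  atoms₂ top = # 2 :≤ â ∷ # 2 :+ â :≤ m̂ ∷ # 1 :+ b̂ :≡ m̂ ∷ []
  atoms₂ top-left = â :≡ # 0 ∷ # 1 :+ b̂ :≡ m̂ ∷ []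
  atoms₂ right = # 1 :+ â :≡ m̂ ∷ # 3 :≤ b̂ ∷ []
  atoms₂ corner = # 1 :+ â :≡ m̂ ∷ b̂ :≡ # 0 ∷ []
  atoms₂ right₂ = # 1 :+ â :≡ m̂ ∷ b̂ :≡ # 2 ∷ []

  shift₂ : Rule₂ → ℕ × ℕ
  shift₂ bottom = 1 , 1
  shift₂ below = 1 , 1
  shift₂ above = 1 , 1
  shift₂ origin = 1 , 0
  shift₂ row₁ = 0 , 1
  shift₂ row₁-end = 1 , 0
  shift₂ antidiagonal = 0 , 2
  shift₂ antidiagonal₁ = 0 , 2
  shift₂ antidiagonal₂ = 1 , 2
  shift₂ top = 2 , 1
  shift₂ top-left = 2 , 1
  shift₂ right = 1 , 0
  shift₂ corner = 0 , 2
  shift₂ right₂ = 0 , 1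

  cuts₂ : Rule₂ → List (Expr × Expr)
  cuts₂ row₁ = (â , # 1) ∷ (â , # 2) ∷ (# 2 :+ â , m̂) ∷ []
  cuts₂ antidiagonal = (# 2 :+ â , m̂) ∷ []
  cuts₂ _ = []

  Admits : Tree → Set
  Admits tree = ∀ r → moves tree 2F (atoms₂ r) (cuts₂ r) (proj₁ (shift₂ r)) (proj₂ (shift₂ r)) ≡ true

  caseX-admits : Admits caseX-tree
  caseX-admits bottom = refl
  caseX-admits below = refl
  caseX-admits above = refl
  caseX-admits origin = refl
  caseX-admits row₁ = refl
  caseX-admits row₁-end = refl
  caseX-admits antidiagonal = refl
  caseX-admits antidiagonal₁ = refl
  caseX-admits antidiagonal₂ = refl
  caseX-admits top = refl
  caseX-admits top-left = refl
  caseX-admits right = refl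
  caseX-admits corner = refl
  caseX-admits right₂ = refl

  caseY-admits : Admits caseY-tree
  caseY-admits bottom = refl
  caseY-admits below = refl
  caseY-admits above = refl
  caseY-admits origin = refl
  caseY-admits row₁ = refl
  caseY-admits row₁-end = refl
  caseY-admits antidiagonal = refl
  caseY-admits antidiagonal₁ = refl
  caseY-admits antidiagonal₂ = refl
  caseY-admits top = refl
  caseY-admits top-left = refl
  caseY-admits right = refl
  caseY-admits corner = refl
  caseY-admits right₂ = refl

  module Cover (m : ℕ) .{{_ : NonZero m}} (n : ℕ) (m≡ : 6 + 2 * n ≡ m) (tree : Tree) (admits : Admits tree)
    (represents : ∀ {i j k} → i < m → j < m → k < m →
      Represents (m ∷ i ∷ j ∷ k ∷ []) tree (if (m % 6) ≡ᵇ 4 then caseY m i j k else caseX m i j k)) where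

    open EvenModulus m n m≡
    open Conclusion m 6≤m 2F tree represents public
    open Dynamics m 6≤m 2F tree represents public

    private
      rule₂ : Rule₂ → Rule tree 2F
      rule₂ r = rule (atoms₂ r) (cuts₂ r) (proj₁ (shift₂ r)) (proj₂ (shift₂ r)) (admits r)

      _*ᵣ_ : Form → Rule₂ → Move tree 2F
      n *ᵣ r = n times rule₂ r

      one : Rule₂ → Move tree 2F
      one r = once (rule₂ r)

      infix 6 _*ᵣ_

    start : At 3 1 0
    start = first-move {[]} (admits origin)

    from-1 : ∀ v → 1 + v ≡ m → At 3 1 0 → At 3 v 0
    from-1 v = along-path 2 (λ m h v → path (2 :* h :≡ m ∷ # 1 :+ v :≡ m ∷ []) (# 1 , # 0)
      (one bottom ∷ one row₁ ∷ h :- # 2 *ᵣ below ∷ one antidiagonal ∷ h :- # 3 *ᵣ above ∷ one top ∷ wrap₂ ∷ [])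
      (v , # 0)) refl h v 2h≡m

    from-m-1 : ∀ v → 2 + v ≡ m → At 3 (1 + v) 0 → At 3 v 0
    from-m-1 v = along-path 2 (λ m h v → path (2 :* h :≡ m ∷ # 2 :+ v :≡ m ∷ []) (# 1 :+ v , # 0)
      (one corner ∷ one right₂ ∷ one right ∷ wrap₁ ∷ h :- # 1 *ᵣ below ∷ h :- # 3 *ᵣ above ∷ one top ∷ wrap₂ ∷ [])
      (v , # 0)) refl h v 2h≡m

    -- The return of 2 to the line is stopped at (1 , 1) because row 1 needs this point: unlike (a ,
    -- 1) with a ≥ 2, it is not the image of a point of row 0 under `bottom`, which excludes a = 0.
    from-2-midway : At 3 2 0 → At 3 1 1
    from-2-midway = along-path 1 (λ m h → path (2 :* h :≡ m ∷ []) (# 2 , # 0)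
      (one bottom ∷ one row₁ ∷ h :- # 2 *ᵣ below ∷ h :- # 2 *ᵣ above ∷ one right ∷ wrap₁ ∷ one below ∷ one antidiagonal₁ ∷ wrap₂ ∷ [])
      (# 1 , # 1)) refl h 2h≡m

    from-midway : At 3 1 1 → At 3 0 0
    from-midway = along-path 1 (λ m h → path (2 :* h :≡ m ∷ []) (# 1 , # 1)
      (one row₁ ∷ h :- # 1 *ᵣ below ∷ h :- # 2 *ᵣ above ∷ one top ∷ wrap₁ ∷ wrap₂ ∷ []) (# 0 , # 0)) refl h 2h≡m

    from-3 : At 3 3 0 → At 3 2 0
    from-3 = along-path 1 (λ m h → path (2 :* h :≡ m ∷ []) (# 3 , # 0)
      (one bottom ∷ one row₁ ∷ h :- # 3 *ᵣ below ∷ one antidiagonal ∷ h :- # 2 *ᵣ above ∷ one right ∷ wrap₁ ∷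
       one top-left ∷ wrap₂ ∷ []) (# 2 , # 0)) refl h 2h≡m

    -- Contributions to a - b: -1 from row 1, -2 from the antidiagonal a + b = m, +1 from the right
    -- column, +1 from the top row; together -1. Odd starts meet the antidiagonal on the first
    -- diagonal, even ones on the second.
    from-odd : ∀ w → 2 ≤ w → 4 + 2 * w ≤ m → At 3 (1 + 2 * w) 0 → At 3 (2 * w) 0
    from-odd w = along-path 2 (λ m h w → path (2 :* h :≡ m ∷ # 2 :≤ w ∷ # 4 :+ 2 :* w :≤ m ∷ []) (# 1 :+ 2 :* w , # 0)
      (one bottom ∷ one row₁ ∷ h :- (# 2 :+ w) *ᵣ below ∷ one antidiagonal ∷ h :- (# 1 :+ w) *ᵣ above ∷ one right ∷ wrap₁ ∷
       form w *ᵣ below ∷ w :- # 2 *ᵣ above ∷ one top ∷ wrap₂ ∷ []) (2 :* w , # 0)) refl h w 2h≡m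

    -- From 2 * w the second diagonal meets a + b = m at a = w; for w = 2 this is the exceptional
    -- point of `antidiagonal₂`.
    from-4 : 8 ≤ m → At 3 4 0 → At 3 3 0
    from-4 = along-path 1 (λ m h → path (2 :* h :≡ m ∷ # 8 :≤ m ∷ []) (# 4 , # 0)
      (one bottom ∷ one row₁ ∷ h :- # 3 *ᵣ below ∷ h :- # 3 *ᵣ above ∷ one right ∷ wrap₁ ∷ form (# 2) *ᵣ below ∷
       one antidiagonal₂ ∷ wrap₂ ∷ []) (# 3 , # 0)) refl h 2h≡m

    from-even : ∀ w → 3 ≤ w → 4 + 2 * w ≤ m → At 3 (2 * w) 0 → ∀ v → 1 + v ≡ 2 * w → At 3 v 0
    from-even w le₁ le₂ r v eq = along-path 3
      (λ m h w v → path (2 :* h :≡ m ∷ # 3 :≤ w ∷ # 4 :+ 2 :* w :≤ m ∷ # 1 :+ v :≡ 2 :* w ∷ []) (2 :* w , # 0)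
      (one bottom ∷ one row₁ ∷ h :- (# 1 :+ w) *ᵣ below ∷ h :- (# 1 :+ w) *ᵣ above ∷ one right ∷ wrap₁ ∷
       form w *ᵣ below ∷ one antidiagonal ∷ w :- # 3 *ᵣ above ∷ one top ∷ wrap₂ ∷ []) (v , # 0)) refl h w v 2h≡m le₁ le₂ eq r

    from-m-2 : 8 ≤ m → ∀ v → 3 + v ≡ m → At 3 (1 + v) 0 → At 3 v 0
    from-m-2 8≤m v = along-path 2 (λ m h v → path (2 :* h :≡ m ∷ # 8 :≤ m ∷ # 3 :+ v :≡ m ∷ []) (# 1 :+ v , # 0)
      (one bottom ∷ one row₁-end ∷ wrap₁ ∷ one row₁ ∷ h :- # 1 *ᵣ below ∷ one antidiagonal ∷ h :- # 4 *ᵣ above ∷ one top ∷ wrap₂ ∷ [])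
      (v , # 0)) refl h v 2h≡m 8≤m

    -- The diagonal from (0 , 2) meets a + b = m at a = h - 1, which for m = 6 is the exceptional
    -- value 2.
    from-m-2-six : m ≡ 6 → At 3 4 0 → At 3 3 0
    from-m-2-six = along-path 0 (λ m → path (m :≡ # 6 ∷ []) (# 4 , # 0)
      (one bottom ∷ one row₁-end ∷ wrap₁ ∷ one row₁ ∷ form (# 2) *ᵣ below ∷ one antidiagonal₂ ∷ wrap₂ ∷ []) (# 3 , # 0)) refl

    down-even : ∀ w → 2 ≤ w → 4 + 2 * w ≤ m → At 3 (2 * w) 0 → ∀ v → 1 + v ≡ 2 * w → At 3 v 0
    down-even 2 _ le r v eq = subst (λ v → At 3 v 0) (sym (suc-injective eq)) (from-4 le r)
    down-even (suc (suc (suc w))) _ le r v eq = from-even (3 + w) (s≤s (s≤s (s≤s z≤n))) le r v eq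
    down-even 1 (s≤s ()) _ _ _ _

    down-odd : ∀ w → 1 ≤ w → 4 + 2 * w ≤ m → At 3 (1 + 2 * w) 0 → At 3 (2 * w) 0
    down-odd 1 _ _ r = from-3 r
    down-odd (suc (suc w)) _ le r = from-odd (2 + w) (s≤s (s≤s z≤n)) le r

    down : ∀ v → 2 ≤ v → 4 + v ≤ m → At 3 (1 + v) 0 → At 3 v 0
    down v 2≤v le r with divided 2 v
    ... | 0 , w , _ , eq = subst (λ v → At 3 v 0) eq (down-odd w
      (linear 2 (λ w v → 2 :* w :≡ v ∷ # 2 :≤ v ∷ [] ⊢ # 1 :≤ w ∷ []) refl w v eq 2≤v)
      (linear 3 (λ m w v → 2 :* w :≡ v ∷ # 4 :+ v :≤ m ∷ [] ⊢ # 4 :+ 2 :* w :≤ m ∷ []) refl m w v eq le)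
      (subst (λ v → At 3 (1 + v) 0) (sym eq) r))
    ... | 1 , w , _ , eq = down-even (1 + w)
      (linear 2 (λ w v → # 1 :+ 2 :* w :≡ v ∷ # 2 :≤ v ∷ [] ⊢ # 2 :≤ # 1 :+ w ∷ []) refl w v eq 2≤v)
      (linear 3 (λ m h w → 2 :* h :≡ m ∷ # 3 :+ w :≤ h ∷ [] ⊢ # 4 :+ 2 :* (# 1 :+ w) :≤ m ∷ []) refl m h w 2h≡m
        (linear 4 (λ m h w v → 2 :* h :≡ m ∷ # 1 :+ 2 :* w :≡ v ∷ # 4 :+ v :≤ m ∷ [] ⊢ # 3 :+ w :≤ h ∷ []) refl m h w v 2h≡m eq le))
      (subst (λ v → At 3 v 0) (linear 2 (λ w v → # 1 :+ 2 :* w :≡ v ∷ [] ⊢ # 1 :+ v :≡ 2 :* (# 1 :+ w) ∷ []) refl w v eq) r)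
      v (linear 2 (λ w v → # 1 :+ 2 :* w :≡ v ∷ [] ⊢ # 1 :+ v :≡ 2 :* (# 1 :+ w) ∷ []) refl w v eq)
    ... | suc (suc _) , _ , s≤s (s≤s ()) , _

    at-m-3 : At 3 m-3 0
    at-m-3 with trichotomy m 7
    ... | inj₁ lt = subst (λ v → At 3 v 0)
      (linear 2 (λ m n → # 6 :+ 2 :* n :≡ m ∷ m :< # 7 ∷ [] ⊢ # 3 :≡ # 3 :+ 2 :* n ∷ []) refl m n m≡ lt)
      (from-m-2-six (linear 2 (λ m n → # 6 :+ 2 :* n :≡ m ∷ m :< # 7 ∷ [] ⊢ m :≡ # 6 ∷ []) refl m n m≡ lt)
        (subst (λ v → At 3 v 0)
          (linear 2 (λ m n → # 6 :+ 2 :* n :≡ m ∷ m :< # 7 ∷ [] ⊢ # 4 :+ 2 :* n :≡ # 4 ∷ []) refl m n m≡ lt)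
          (from-m-1 m-2 m≡ (from-1 m-1 m≡ start))))
    ... | inj₂ (inj₂ gt) = from-m-2 gt m-3 m≡ (from-m-1 m-2 m≡ (from-1 m-1 m≡ start))
    -- The equation 6 + 2 * n ≡ 7 has the rational solution 1/2. Rounding it both ways, to n ≥ 1 and
    -- to n ≤ 0, gives the contradiction.
    ... | inj₂ (inj₁ eq) = ⊥-elim (linear 1 (λ n → # 1 :≤ n ∷ n :≤ # 0 ∷ [] ⊢⊥) refl n
      (linear 2 (λ m n → # 6 :+ 2 :* n :≡ m ∷ m :≡ # 7 ∷ [] ⊢ # 1 :≤ n ∷ []) refl m n m≡ eq)
      (linear 2 (λ m n → # 6 :+ 2 :* n :≡ m ∷ m :≡ # 7 ∷ [] ⊢ n :≤ # 0 ∷ []) refl m n m≡ eq))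

    descend : ∀ k v → 2 ≤ v → k + v ≡ m-3 → At 3 v 0
    descend zero v _ refl = at-m-3
    descend (suc k) v 2≤v eq = down v 2≤v
      (linear 4 (λ m n k v → # 6 :+ 2 :* n :≡ m ∷ # 1 :+ k :+ v :≡ # 3 :+ 2 :* n ∷ [] ⊢ # 4 :+ v :≤ m ∷ []) refl m n k v m≡ eq)
      (descend k (suc v) (≤-trans 2≤v (n≤1+n v)) (trans (+-suc k v) eq))

    at-2 : At 3 2 0
    at-2 = descend (1 + 2 * n) 2 ≤-refl (linear 1 (λ n → [] ⊢ # 1 :+ 2 :* n :+ # 2 :≡ # 3 :+ 2 :* n ∷ []) refl n)

    middle : ∀ u → 2 ≤ u → u < m → At 3 u 0
    middle u 2≤u u<m with trichotomy u m-2
    ... | inj₁ lt = descend (m-3 ∸ u) u 2≤u (m∸n+n≡m (≤-pred lt))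
    ... | inj₂ (inj₁ refl) = from-m-1 m-2 m≡ (from-1 m-1 m≡ start)
    ... | inj₂ (inj₂ gt) = subst (λ v → At 3 v 0)
      (linear 3 (λ m n u → # 6 :+ 2 :* n :≡ m ∷ # 4 :+ 2 :* n :< u ∷ u :< m ∷ [] ⊢ # 5 :+ 2 :* n :≡ u ∷ []) refl m n u m≡ gt u<m)
      (from-1 m-1 m≡ start)

    -- The cycle on the line is 0 → 1 → m - 1 → m - 2 → ... → 2 → 0.
    section : ∀ u → u < m → At 3 u 0
    section 0 _ = from-midway (from-2-midway at-2)
    section 1 _ = start
    section u@(suc (suc _)) u<m = middle u (s≤s (s≤s z≤n)) u<m

    row-1 : ∀ a → a < m → At 3 a 1
    row-1 0 a<m = along-path 1 (λ m x → path (# 2 :+ x :≡ m ∷ []) (x , # 0) (one bottom ∷ one row₁-end ∷ wrap₁ ∷ []) (# 0 , # 1))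
      refl m-2 m≡ (section m-2 m-2<m)
    row-1 1 a<m = from-2-midway at-2
    row-1 (suc a@(suc _)) a<m = along-path 1 (λ m a → path (# 1 :≤ a ∷ # 1 :+ a :< m ∷ []) (a , # 0) (one bottom ∷ []) (# 1 :+ a , # 1))
      refl a (s≤s z≤n) a<m (section a (<-trans (n<1+n a) a<m))

    row-2 : ∀ a → a < m → At 3 a 2
    row-2 a a<m with trichotomy (1 + a) m
    ... | inj₁ lt = along-path 1 (λ m a → path (# 1 :+ a :< m ∷ []) (a , # 1) (one row₁ ∷ []) (a , # 2)) refl a lt (row-1 a a<m)
    ... | inj₂ (inj₁ eq) = along-path 1 (λ m a → path (# 1 :+ a :≡ m ∷ []) (a , # 0) (one corner ∷ []) (a , # 2)) refl a eq (section a a<m)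
    ... | inj₂ (inj₂ gt) = ⊥-elim (<⇒≱ gt a<m)

    module _ (b : ℕ) (b<m : 3 + b < m) (known₁ : ∀ a → a < m → At 3 a (1 + b)) (known₂ : ∀ a → a < m → At 3 a (2 + b)) where

      next-on : ∀ a → 1 + a < m → a + (2 + b) ≡ m → At 3 (1 + a) (3 + b)
      next-on a a<m eq with trichotomy (2 + a) m
      ... | inj₁ lt = along-path 2 (λ m a b → path (# 2 :+ a :< m ∷ a :+ (# 2 :+ b) :≡ m ∷ # 3 :+ b :< m ∷ []) (# 1 :+ a , # 1 :+ b)
        (one antidiagonal ∷ []) (# 1 :+ a , # 3 :+ b)) refl a b lt eq b<m (known₁ (1 + a) a<m)
      ... | inj₂ (inj₁ eq′) = along-path 2 (λ m a b → path (# 2 :+ a :≡ m ∷ a :+ (# 2 :+ b) :≡ m ∷ []) (# 1 :+ a , # 0)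
        (one corner ∷ one right₂ ∷ []) (# 1 :+ a , # 3 :+ b)) refl a b eq′ eq (section (1 + a) a<m)
      ... | inj₂ (inj₂ gt) = ⊥-elim (<⇒≱ gt a<m)

      next-positive : ∀ a → 1 + a < m → At 3 (1 + a) (3 + b)
      next-positive a a<m with trichotomy (a + (2 + b)) m
      ... | inj₁ lt = along-path 2 (λ m a b → path (a :+ (# 2 :+ b) :< m ∷ # 3 :+ b :< m ∷ []) (a , # 2 :+ b)
        (one below ∷ []) (# 1 :+ a , # 3 :+ b)) refl a b lt b<m (known₂ a (<-trans (n<1+n a) a<m))
      ... | inj₂ (inj₁ eq) = next-on a a<m eq
      ... | inj₂ (inj₂ gt) = along-path 2 (λ m a b → path (m :< a :+ (# 2 :+ b) ∷ # 1 :+ a :< m ∷ # 3 :+ b :< m ∷ []) (a , # 2 :+ b)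
        (one above ∷ []) (# 1 :+ a , # 3 :+ b)) refl a b gt a<m b<m (known₂ a (<-trans (n<1+n a) a<m))

      next : ∀ a → a < m → At 3 a (3 + b)
      -- Column 0 is filled last: the right column shifts (m - 1 , 3 + b), in the same row, across
      -- the edge.
      next zero _ = along-path 2 (λ m x b → path (# 1 :+ x :≡ m ∷ # 3 :+ b :< m ∷ []) (x , # 3 :+ b) (one right ∷ wrap₁ ∷ []) (# 0 , # 3 :+ b))
        refl m-1 b m≡ b<m (next-positive m-2 m-1<m)
      next (suc a) a<m = next-positive a a<m

    -- Two earlier rows are used because the antidiagonal shifts by (0 , 2).
    cover : ∀ b → b < m → ∀ a → a < m → At 3 a b
    cover 0 _ = section
    cover 1 _ = row-1
    cover 2 _ = row-2
    cover (suc (suc (suc b))) b<m = next b b<m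
      (cover (suc b) (<-trans (n<1+n _) (<-trans (n<1+n _) b<m))) (cover (suc (suc b)) (<-trans (n<1+n _) b<m))

-- Hamilton cycles

injective? : ∀ τ → Dec (∀ c c′ → d τ c ≡ d τ c′ → c ≡ c′)
injective? τ = all? λ c → all? λ c′ → (d τ c ≟ d τ c′) →-dec (c ≟ c′)

surjective? : ∀ τ → Dec (∀ e → ∃ λ c → d τ c ≡ e)
surjective? τ = all? λ e → any? λ c → d τ c ≟ e

d-injective : ∀ τ c c′ → d τ c ≡ d τ c′ → c ≡ c′
d-injective p012 = toWitness {a? = injective? p012} tt
d-injective p021 = toWitness {a? = injective? p021} tt
d-injective p102 = toWitness {a? = injective? p102} tt
d-injective p120 = toWitness {a? = injective? p120} tt
d-injective p201 = toWitness {a? = injective? p201} tt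
d-injective p210 = toWitness {a? = injective? p210} tt

d-surjective : ∀ τ e → ∃ λ c → d τ c ≡ e
d-surjective p012 = toWitness {a? = surjective? p012} tt
d-surjective p021 = toWitness {a? = surjective? p021} tt
d-surjective p102 = toWitness {a? = surjective? p102} tt
d-surjective p120 = toWitness {a? = surjective? p120} tt
d-surjective p201 = toWitness {a? = surjective? p201} tt
d-surjective p210 = toWitness {a? = surjective? p210} tt

d-bijective : ∀ τ → Bijective _≡_ _≡_ (d τ)
d-bijective τ = d-injective τ _ _ , λ e → let c , h = d-surjective τ e in c , λ { refl → h }

Hamiltonian : (m : ℕ) .{{_ : NonZero m}} → Fin 3 → Set
Hamiltonian m c = Bijective _≡_ _≡_ (f m c) × (∀ v w → ∃[ n ] iter (f m c) n v ≡ w)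

module _ (m : ℕ) .{{_ : NonZero m}} (n : ℕ) (m≡ : 6 + 2 * n ≡ m) (m%6 : (m % 6 ≡ᵇ 4) ≡ false) where

  hamiltonian-0X : Hamiltonian m 0F
  hamiltonian-0X = bijective cover , transitive cover
    where open Colour0X.Cover m n m≡ m%6

  -- How the classes modulo 3 are linked depends on m modulo 3, so coverage of the line b = 0 is
  -- supplied separately for m ≡ 0 and m ≡ 2 (mod 6).
  hamiltonian-1X : (∀ u → u < m → Colour1X.Cover.At m n m≡ m%6 3 u 0) → Hamiltonian m 1F
  hamiltonian-1X section = bijective covered , transitive covered
    where
    open Colour1X.Cover m n m≡ m%6
    covered : ∀ a b → a < m → b < m → At 3 a b
    covered a b a<m b<m = cover section b b<m a a<m

  hamiltonian-2X : Hamiltonian m 2F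
  hamiltonian-2X = bijective covered , transitive covered
    where
    open Colour2.Cover m n m≡ caseX-tree Colour2.caseX-admits (Colour0X.Cover.represents m n m≡ m%6)
    covered : ∀ a b → a < m → b < m → At 3 a b
    covered a b a<m b<m = cover b b<m a a<m

module _ (m : ℕ) .{{_ : NonZero m}} (q : ℕ) (m≡ : 10 + 6 * q ≡ m) (m%6 : (m % 6 ≡ᵇ 4) ≡ true) where

  private
    n : ℕ
    n = 2 + 3 * q
    m≡n : 6 + 2 * n ≡ m
    m≡n = linear 2 (λ m q → # 10 :+ 6 :* q :≡ m ∷ [] ⊢ # 6 :+ 2 :* (# 2 :+ 3 :* q) :≡ m ∷ []) refl m q m≡

  hamiltonian-0Y : Hamiltonian m 0F
  hamiltonian-0Y = bijective cover , transitive cover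
    where open Colour0Y.Cover m n m≡n m%6

  hamiltonian-1Y : Hamiltonian m 1F
  hamiltonian-1Y = bijective covered , transitive covered
    where
    open Colour1Y.Cover m q m≡ m%6
    covered : ∀ a b → a < m → b < m → At 3 a b
    covered a b a<m b<m = cover b b<m a a<m

  hamiltonian-2Y : Hamiltonian m 2F
  hamiltonian-2Y = bijective covered , transitive covered
    where
    open Colour2.Cover m n m≡n caseY-tree Colour2.caseY-admits (Colour0Y.Cover.represents m n m≡n m%6)
    covered : ∀ a b → a < m → b < m → At 3 a b
    covered a b a<m b<m = cover b b<m a a<m

residue-6 : ∀ {m} r k → r + 6 * k ≡ m → m % 6 ≡ r % 6
residue-6 r k refl = trans (cong (λ x → (r + x) % 6) (*-comm 6 k)) ([m+kn]%n≡m%n r k 6)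

-- For m = 6 + 2n the residue of n modulo 3 fixes m modulo 6 as 0, 2 or 4, and with it the table.
hamiltonian : (m : ℕ) .{{_ : NonZero m}} (n : ℕ) → 6 + 2 * n ≡ m → ∀ c → Hamiltonian m c
hamiltonian m n m≡ with divided 3 n
... | 0 , q , _ , eq = λ { 0F → hamiltonian-0X m n m≡ m%6 ; 1F → hamiltonian-1X m n m≡ m%6 section ; 2F → hamiltonian-2X m n m≡ m%6 }
  where
  m≡q : 6 + 6 * q ≡ m
  m≡q = linear 3 (λ m n q → # 6 :+ 2 :* n :≡ m ∷ 3 :* q :≡ n ∷ [] ⊢ # 6 :+ 6 :* q :≡ m ∷ []) refl m n q m≡ eq
  m%6 : (m % 6 ≡ᵇ 4) ≡ false
  m%6 = cong (_≡ᵇ 4) (residue-6 6 q m≡q)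
  section : ∀ u → u < m → Colour1X.Cover.At m n m≡ m%6 3 u 0
  section = Colour1X.Cover.section-0 m n m≡ m%6 q m≡q
... | 1 , q , _ , eq = λ { 0F → hamiltonian-0X m n m≡ m%6 ; 1F → hamiltonian-1X m n m≡ m%6 section ; 2F → hamiltonian-2X m n m≡ m%6 }
  where
  m≡q : 8 + 6 * q ≡ m
  m≡q = linear 3 (λ m n q → # 6 :+ 2 :* n :≡ m ∷ # 1 :+ 3 :* q :≡ n ∷ [] ⊢ # 8 :+ 6 :* q :≡ m ∷ []) refl m n q m≡ eq
  m%6 : (m % 6 ≡ᵇ 4) ≡ false
  m%6 = cong (_≡ᵇ 4) (residue-6 8 q m≡q)
  section : ∀ u → u < m → Colour1X.Cover.At m n m≡ m%6 3 u 0
  section = Colour1X.Cover.section-2 m n m≡ m%6 q m≡q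
... | 2 , q , _ , eq = λ { 0F → hamiltonian-0Y m q m≡q m%6 ; 1F → hamiltonian-1Y m q m≡q m%6 ; 2F → hamiltonian-2Y m q m≡q m%6 }
  where
  m≡q : 10 + 6 * q ≡ m
  m≡q = linear 3 (λ m n q → # 6 :+ 2 :* n :≡ m ∷ # 2 :+ 3 :* q :≡ n ∷ [] ⊢ # 10 :+ 6 :* q :≡ m ∷ []) refl m n q m≡ eq
  m%6 : (m % 6 ≡ᵇ 4) ≡ true
  m%6 = cong (_≡ᵇ 4) (residue-6 10 q m≡q)
... | suc (suc (suc _)) , _ , s≤s (s≤s (s≤s ())) , _

theorem4p26 : (m : ℕ) → .{{_ : NonZero m}} → 6 ≤ m → 2 ∣ m →
    -- at every vertex the three colours use the three directions (each arc gets exactly one colour)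
    (∀ (v : V m) → Bijective _≡_ _≡_ (λ (c : Fin 3) → d (routeE m v) c))
    -- each f_c is a permutation of V
    × (∀ (c : Fin 3) → Bijective _≡_ _≡_ (f m c))
    -- each f_c is a single cycle through all m^3 vertices
    × (∀ (c : Fin 3) (v w : V m) → ∃[ n ] iter (f m c) n v ≡ w)
theorem4p26 m 6≤m (divides q m≡q*2) =
  (λ v → d-bijective (routeE m v)) , (λ c → proj₁ (cycles c)) , (λ c → proj₂ (cycles c))
  where
  m≡2q : m ≡ 2 * q
  m≡2q = trans m≡q*2 (*-comm q 2)
  3≤q : 3 ≤ q
  3≤q = linear 2 (λ m q → m :≡ 2 :* q ∷ # 6 :≤ m ∷ [] ⊢ # 3 :≤ q ∷ []) refl m q m≡2q 6≤m
  cycles : ∀ c → Hamiltonian m c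
  cycles = hamiltonian m (q ∸ 3) (linear 3 (λ m q n → m :≡ 2 :* q ∷ # 3 :+ n :≡ q ∷ [] ⊢ # 6 :+ 2 :* n :≡ m ∷ [])
    refl m q (q ∸ 3) m≡2q (m+[n∸m]≡n 3≤q))
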